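{- Let $p$ be an odd prime, $n$ a positive integer, $q=p^n$, and let $\xi\in\mathbb F_{q^2}\setminus\mathbb F_q$; write $x=x_0+x_1\xi$ ($x_0,x_1\in\mathbb F_q$) for $x\in\mathbb F_{q^2}$. Let $\mathcal U_\xi:=\{(x,t\xi):x\in\mathbb F_{q^2},t\in\mathbb F_q\}\cup\{(\infty)\}$. Then $\mathcal U_\xi$ is a unital in $\Pi(f)$ for each of the following functions $f$ on $\mathbb F_{q^2}$ (each of which is planar): (a) if $q\equiv 1\pmod 4$ and $\alpha$ is a nonsquare in $\mathbb F_q$: $f(x)=(x_0^2+\alpha x_1^{2p^i})+2x_0x_1\xi$, where $0<i<n$; (b) if $q\equiv 1\pmod 4$ and $\alpha$ is a nonsquare in $\mathbb F_q$: $f(x)=(x_0^{p^k+1}+\alpha x_1^{p^{k+i}+p^i})+2x_0x_1\xi$, where $0<i,k<n$ and $n/\gcd(k,n)$ is odd; (c) if $p=3$ and $n$ is odd: $f(x)=(x_0^2+x_1^{10})+(2x_0x_1+x_1^6)\xi$; (d) if $p=3$ and $n=5$: $f(x)=(x_0^2+x_1^{18})+(2x_0x_1+x_1^{54})\xi$; (e) if $q\equiv 3\pmod 4$: $f(x)=bx^{p^k+1}+(bx^{p^k+1})^{p^n}+\xi x^{p^n+1}$, where $0<k<n$, $n/\gcd(k,n)$ is odd and $b$ is a nonsquare in $\mathbb F_{q^2}^*$.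
   Context: A function $f:\mathbb F_{q^2}\to\mathbb F_{q^2}$ is planar if for every $a\neq 0$ the map $x\mapsto f(x+a)-f(x)$ is a bijection. For planar $f$, $\Pi(f)$ is the projective plane with points $(x,y)\in\mathbb F_{q^2}^2$ and $(a)$ for $a\in\mathbb F_{q^2}\cup\{\infty\}$, and lines $L_{a,b}=\{(x,f(x+a)-b):x\in\mathbb F_{q^2}\}\cup\{(a)\}$ ($a,b\in\mathbb F_{q^2}$), $N_a=\{(a,y):y\in\mathbb F_{q^2}\}\cup\{(\infty)\}$ ($a\in\mathbb F_{q^2}$), $L_\infty=\{(a):a\in\mathbb F_{q^2}\cup\{\infty\}\}$, incidence being membership. A unital in $\Pi(f)$ is a set of $q^3+1$ points meeting every line in exactly $1$ or $q+1$ points.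
   Formalization: In (e), planarity of f is claimed only for even k, since for odd k it fails (with j²=−1 and y≠0, f(u+y)−f(u) takes equal values at u=0 and u=jy); that 𝒰_ξ has q³+1 points and meets every line of Π(f) in 1 or q+1 points is still proved for all k. -}

module Defs where

open import Level as Level using (Level; _⊔_)
open import Algebra.Bundles using (CommutativeRing)
open import Algebra.Morphism.Structures using (IsRingMonomorphism)
import Algebra.Properties.Ring as RingProperties
import Algebra.Properties.Semiring.Exp as Exp
import Algebra.Properties.Semiring.Mult as Mult
open import Data.Fin.Base using (Fin; zero; suc; remQuot; combine)
open import Data.Fin.Properties using (any?; injective⇒≤; combine-remQuot)
import Data.Fin.Properties as Fin
open import Data.Nat.Base as ℕ using (ℕ)
open import Data.Nat.Divisibility using (_∣_; quotient)
open import Data.Nat.GCD using (gcd[m,n]∣n)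
import Data.Nat.Properties as ℕ
open import Data.Product.Base using (Σ; ∃; ∃₂; _×_; _,_; proj₁; proj₂)
open import Data.Sum.Base using (_⊎_)
open import Function.Base using (_∘_)
open import Function.Bundles using (Inverse)
open import Function.Definitions using (Bijective)
open import Relation.Binary.Bundles using (Setoid)
open import Relation.Binary.Definitions using (Decidable)
import Relation.Binary.Construct.On as On
open import Relation.Binary.PropositionalEquality as ≡ using (_≡_)
open import Relation.Nullary using (¬_; yes; no; contradiction)
open import Relation.Nullary.Decidable using (map′)
open import Relation.Unary using (Pred; _∩_)

private variable
  a c ℓ ℓ′ c₁ ℓ₁ c₂ ℓ₂ : Level

-- n / gcd(k,n) is odd.
OddCofactor : ℕ → ℕ → Set
OddCofactor k n = ¬ 2 ∣ quotient (gcd[m,n]∣n k n)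

HasSize : Setoid c ℓ → ℕ → Set (c ⊔ ℓ)
HasSize S m = Inverse (≡.setoid (Fin m)) S

-- Elements of a subset are counted up to the equality of the ambient setoid,
-- not up to equality of membership proofs.
SubsetHasSize : (S : Setoid c ℓ) → Pred (Setoid.Carrier S) ℓ′ → ℕ → Set (c ⊔ ℓ ⊔ ℓ′)
SubsetHasSize S P m = HasSize (On.setoid S (proj₁ {B = P})) m

record IsFieldOfOrder (R : CommutativeRing c ℓ) (m : ℕ) : Set (c ⊔ ℓ) where
  open CommutativeRing R
  field
    1≉0     : 1# ≉ 0#
    inverse : ∀ x → x ≉ 0# → ∃ λ y → x * y ≈ 1#
    order   : HasSize setoid m

  open Inverse order public using (to; from; from-cong; inverseˡ; inverseʳ)

  _≈?_ : Decidable _≈_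
  x ≈? y = map′
    (λ eq → trans (sym (inverseˡ ≡.refl)) (inverseˡ eq))
    from-cong
    (from x Fin.≟ from y)

-- 0# is a square, so a nonsquare is automatically nonzero.
Nonsquare : (R : CommutativeRing c ℓ) → CommutativeRing.Carrier R → Set (c ⊔ ℓ)
Nonsquare R x = ¬ ∃ λ z → z * z ≈ x
  where open CommutativeRing R

-- F plays the role of 𝔽_q and K that of 𝔽_{q²}; the inclusion is ι.
record QuadraticExtension (F : CommutativeRing c₁ ℓ₁) (K : CommutativeRing c₂ ℓ₂) (q : ℕ)
       : Set (c₁ ⊔ ℓ₁ ⊔ c₂ ⊔ ℓ₂) where
  field
    F-field : IsFieldOfOrder F q
    K-field : IsFieldOfOrder K (q ℕ.^ 2)
    ι       : CommutativeRing.Carrier F → CommutativeRing.Carrier K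
    ι-mono  : IsRingMonomorphism (CommutativeRing.rawRing F) (CommutativeRing.rawRing K) ι

record IncidenceStructure c ℓ a : Set (Level.suc (c ⊔ ℓ ⊔ a)) where
  field
    points : Setoid c ℓ
    Line   : Set c

  Point : Set c
  Point = Setoid.Carrier points

  field
    _on_ : Point → Line → Set a

IsUnital : ℕ → (Π : IncidenceStructure c ℓ a) →
           Pred (IncidenceStructure.Point Π) ℓ′ → Set (c ⊔ ℓ ⊔ a ⊔ ℓ′)
IsUnital q Π U =
  SubsetHasSize points U (q ℕ.^ 3 ℕ.+ 1) ×
  (∀ l → SubsetHasSize points (U ∩ (_on l)) 1 ⊎
         SubsetHasSize points (U ∩ (_on l)) (q ℕ.+ 1))
  where open IncidenceStructure Π

module Plane (K : CommutativeRing c ℓ) where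
  open CommutativeRing K

  Planar : (Carrier → Carrier) → Set (c ⊔ ℓ)
  Planar f = ∀ a → a ≉ 0# → Bijective _≈_ _≈_ (λ x → f (x + a) - f x)

  data Point : Set c where
    pt   : Carrier → Carrier → Point
    dir  : Carrier → Point
    dir∞ : Point

  data _≈ₚ_ : Point → Point → Set (c ⊔ ℓ) where
    affine : ∀ {x x′ y y′} → x ≈ x′ → y ≈ y′ → pt x y ≈ₚ pt x′ y′
    slope  : ∀ {a a′} → a ≈ a′ → dir a ≈ₚ dir a′
    ∞      : dir∞ ≈ₚ dir∞

  points : Setoid c (c ⊔ ℓ)
  points = record
    { Carrier = Point
    ; _≈_ = _≈ₚ_
    ; isEquivalence = record { refl = reflₚ ; sym = symₚ ; trans = transₚ }
    }
    where
    reflₚ : ∀ {P} → P ≈ₚ P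
    reflₚ {pt _ _} = affine refl refl
    reflₚ {dir _}  = slope refl
    reflₚ {dir∞}   = ∞

    symₚ : ∀ {P Q} → P ≈ₚ Q → Q ≈ₚ P
    symₚ (affine p q) = affine (sym p) (sym q)
    symₚ (slope p)    = slope (sym p)
    symₚ ∞            = ∞

    transₚ : ∀ {P Q R} → P ≈ₚ Q → Q ≈ₚ R → P ≈ₚ R
    transₚ (affine p q) (affine p′ q′) = affine (trans p p′) (trans q q′)
    transₚ (slope p)    (slope p′)     = slope (trans p p′)
    transₚ ∞            ∞              = ∞

  data Line : Set c where
    L  : Carrier → Carrier → Line
    N  : Carrier → Line
    L∞ : Line

  data _∈[_]_ : Point → (Carrier → Carrier) → Line → Set (c ⊔ ℓ) where
    L-affine : ∀ {f a b x y} → y ≈ f (x + a) - b → pt x y ∈[ f ] L a b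
    L-slope  : ∀ {f a b a′} → a′ ≈ a → dir a′ ∈[ f ] L a b
    N-affine : ∀ {f a x y} → x ≈ a → pt x y ∈[ f ] N a
    N-∞      : ∀ {f a} → dir∞ ∈[ f ] N a
    L∞-slope : ∀ {f a} → dir a ∈[ f ] L∞
    L∞-∞     : ∀ {f} → dir∞ ∈[ f ] L∞

  -- Points, lines and incidence make sense for every f; Π f is a projective
  -- plane when f is planar.
  Π : (Carrier → Carrier) → IncidenceStructure c (c ⊔ ℓ) (c ⊔ ℓ)
  Π f = record { points = points ; Line = Line ; _on_ = λ P l → P ∈[ f ] l }

module Setting
  (F : CommutativeRing c₁ ℓ₁) (K : CommutativeRing c₂ ℓ₂) (p n : ℕ)
  (E : QuadraticExtension F K (p ℕ.^ n))
  (ξ : CommutativeRing.Carrier K)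
  (ξ∉F : ∀ s → ¬ CommutativeRing._≈_ K (QuadraticExtension.ι E s) ξ)
  where

  private
    module F where
      open CommutativeRing F public
      open Exp semiring public using (_^_)
      open Mult semiring public using () renaming (_×_ to _·_)
      open IsFieldOfOrder (QuadraticExtension.F-field E) public
    module K where
      open CommutativeRing K public
      open Exp semiring public using (_^_)
      open IsFieldOfOrder (QuadraticExtension.K-field E) public

    q : ℕ
    q = p ℕ.^ n

  open QuadraticExtension E using (ι; ι-mono)
  open Plane K

  infix 5 _⊕_·ξ
  _⊕_·ξ : F.Carrier → F.Carrier → K.Carrier
  s ⊕ t ·ξ = ι s K.+ ι t K.* ξ

  ------------------------------------------------------------------------
  -- Every x ∈ K is x₀ + x₁ξ for unique x₀, x₁ ∈ F: uniqueness holds because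
  -- ξ ∉ F, existence because |F|² = |K|.

  private
    module ι = IsRingMonomorphism ι-mono
    module KP = RingProperties K.ring
    module FP = RingProperties F.ring
    open import Relation.Binary.Reasoning.Setoid K.setoid
    open import Algebra.Properties.CommutativeSemigroup K.*-commutativeSemigroup
      using (xy∙z≈xz∙y)

    ι-sub : ∀ s t → ι (s F.- t) K.≈ ι s K.- ι t
    ι-sub s t = K.trans (ι.+-homo s (F.- t)) (K.+-congˡ (ι.-‿homo t))

    difference : ∀ {u v w z} → u K.+ v K.≈ w K.+ z → v K.- z K.≈ w K.- u
    difference {u} {v} {w} {z} eq = begin
      v K.- z                      ≈⟨ K.+-congʳ (lemma u v) ⟨
      ((u K.+ v) K.- u) K.- z      ≈⟨ K.+-congʳ (K.+-congʳ eq) ⟩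
      ((w K.+ z) K.- u) K.- z      ≈⟨ swap ⟩
      (w K.- u)                    ∎
      where
      lemma : ∀ u v → (u K.+ v) K.- u K.≈ v
      lemma u v = begin
        (u K.+ v) K.- u    ≈⟨ K.+-congʳ (K.+-comm u v) ⟩
        (v K.+ u) K.- u    ≈⟨ K.+-assoc v u (K.- u) ⟩
        v K.+ (u K.- u)    ≈⟨ K.+-congˡ (K.-‿inverseʳ u) ⟩
        v K.+ K.0#         ≈⟨ K.+-identityʳ v ⟩
        v                  ∎
      swap : ((w K.+ z) K.- u) K.- z K.≈ w K.- u
      swap = begin
        ((w K.+ z) K.- u) K.- z   ≈⟨ K.+-congʳ (K.+-congʳ (K.+-comm w z)) ⟩
        ((z K.+ w) K.- u) K.- z   ≈⟨ K.+-congʳ (K.+-assoc z w (K.- u)) ⟩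
        (z K.+ (w K.- u)) K.- z   ≈⟨ lemma z (w K.- u) ⟩
        w K.- u                   ∎

  ξ-coordinate-unique : ∀ {s t s′ t′} → (s ⊕ t ·ξ) K.≈ (s′ ⊕ t′ ·ξ) → t F.≈ t′
  ξ-coordinate-unique {s} {t} {s′} {t′} eq with t F.≈? t′
  ... | yes t≈t′ = t≈t′
  ... | no  t≉t′ = contradiction (K.sym ξ∈F) (ξ∉F ((s′ F.- s) F.* d⁻¹))
    where
    d = t F.- t′
    d≉0 : d F.≉ F.0#
    d≉0 d≈0 = t≉t′ (FP.x∙y⁻¹≈ε⇒x≈y t t′ d≈0)
    d⁻¹ = proj₁ (F.inverse d d≉0)
    dξ : ι d K.* ξ K.≈ ι (s′ F.- s)
    dξ = begin
      ι d K.* ξ                      ≈⟨ K.*-congʳ (ι-sub t t′) ⟩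
      (ι t K.- ι t′) K.* ξ           ≈⟨ KP.[y-z]x≈yx-zx ξ (ι t) (ι t′) ⟩
      ι t K.* ξ K.- ι t′ K.* ξ       ≈⟨ difference eq ⟩
      ι s′ K.- ι s                   ≈⟨ ι-sub s′ s ⟨
      ι (s′ F.- s)                   ∎
    ξ∈F : ξ K.≈ ι ((s′ F.- s) F.* d⁻¹)
    ξ∈F = begin
      ξ                              ≈⟨ K.*-identityˡ ξ ⟨
      K.1# K.* ξ                     ≈⟨ K.*-congʳ ι.1#-homo ⟨
      ι F.1# K.* ξ                   ≈⟨ K.*-congʳ (ι.⟦⟧-cong (proj₂ (F.inverse d d≉0))) ⟨
      ι (d F.* d⁻¹) K.* ξ            ≈⟨ K.*-congʳ (ι.*-homo d d⁻¹) ⟩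
      (ι d K.* ι d⁻¹) K.* ξ          ≈⟨ xy∙z≈xz∙y (ι d) (ι d⁻¹) ξ ⟩
      (ι d K.* ξ) K.* ι d⁻¹          ≈⟨ K.*-congʳ dξ ⟩
      ι (s′ F.- s) K.* ι d⁻¹         ≈⟨ ι.*-homo (s′ F.- s) d⁻¹ ⟨
      ι ((s′ F.- s) F.* d⁻¹)         ∎

  1-coordinate-unique : ∀ {s t s′ t′} → (s ⊕ t ·ξ) K.≈ (s′ ⊕ t′ ·ξ) → s F.≈ s′
  1-coordinate-unique {s} {t} {s′} {t′} eq = ι.injective
    (KP.+-cancelʳ (ι t K.* ξ) (ι s) (ι s′)
      (K.trans eq (K.+-congˡ (K.*-congʳ (ι.⟦⟧-cong (F.sym (ξ-coordinate-unique eq)))))))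

  private
    element : Fin q → Fin q → K.Carrier
    element i j = F.to i ⊕ F.to j ·ξ

    to-injective : ∀ {i j} → F.to i F.≈ F.to j → i ≡ j
    to-injective eq = ≡.trans (≡.sym (F.inverseʳ F.refl)) (F.inverseʳ eq)

    from-injective : ∀ {x y} → K.from x ≡ K.from y → x K.≈ y
    from-injective eq = K.trans (K.sym (K.inverseˡ ≡.refl)) (K.inverseˡ eq)

    element-injective : ∀ {i j i′ j′} → element i j K.≈ element i′ j′ → i ≡ i′ × j ≡ j′
    element-injective eq =
      to-injective (1-coordinate-unique eq) , to-injective (ξ-coordinate-unique eq)

  coordinates : ∀ x → ∃₂ λ s t → x K.≈ (s ⊕ t ·ξ)
  coordinates x with any? (λ i → any? (λ j → x K.≈? element i j))
  ... | yes (i , j , eq) = F.to i , F.to j , eq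
  ... | no  none         = contradiction (injective⇒≤ code-injective) (ℕ.<⇒≱ q²<)
    where
    point : Fin (ℕ.suc (q ℕ.* q)) → K.Carrier
    point zero    = x
    point (suc m) = element (proj₁ (remQuot {q} q m)) (proj₂ (remQuot {q} q m))

    point-injective : ∀ m m′ → point m K.≈ point m′ → m ≡ m′
    point-injective zero    zero     _  = ≡.refl
    point-injective zero    (suc m′) eq = contradiction (_ , _ , eq) none
    point-injective (suc m) zero     eq = contradiction (_ , _ , K.sym eq) none
    point-injective (suc m) (suc m′) eq = ≡.cong suc
      (≡.trans (≡.sym (combine-remQuot {q} q m))
        (≡.trans (≡.cong₂ combine (proj₁ (element-injective eq)) (proj₂ (element-injective eq)))
          (combine-remQuot {q} q m′)))

    code-injective : ∀ {m m′} → K.from (point m) ≡ K.from (point m′) → m ≡ m′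
    code-injective eq = point-injective _ _ (from-injective eq)

    q²< : q ℕ.^ 2 ℕ.< ℕ.suc (q ℕ.* q)
    q²< = ℕ.s≤s (ℕ.≤-reflexive (≡.cong (q ℕ.*_) (ℕ.*-identityʳ q)))

  x₀ x₁ : K.Carrier → F.Carrier
  x₀ x = proj₁ (coordinates x)
  x₁ x = proj₁ (proj₂ (coordinates x))

  ------------------------------------------------------------------------

  data 𝒰 : Pred Point (c₁ ⊔ c₂ ⊔ ℓ₂) where
    affine : ∀ {x y} t → y K.≈ ι t K.* ξ → 𝒰 (pt x y)
    ∞      : 𝒰 dir∞

  module _ where
    open F

    dickson : F.Carrier → ℕ → K.Carrier → K.Carrier
    dickson α i x =
      (x₀ x ^ 2 + α * x₁ x ^ (2 ℕ.* p ℕ.^ i)) ⊕ 2 · (x₀ x * x₁ x) ·ξ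

    zhouPott : F.Carrier → ℕ → ℕ → K.Carrier → K.Carrier
    zhouPott α i k x =
      (x₀ x ^ (p ℕ.^ k ℕ.+ 1) + α * x₁ x ^ (p ℕ.^ (k ℕ.+ i) ℕ.+ p ℕ.^ i))
      ⊕ 2 · (x₀ x * x₁ x) ·ξ

    cohenGanley : K.Carrier → K.Carrier
    cohenGanley x =
      (x₀ x ^ 2 + x₁ x ^ 10) ⊕ (2 · (x₀ x * x₁ x) + x₁ x ^ 6) ·ξ

    penttilaWilliams : K.Carrier → K.Carrier
    penttilaWilliams x =
      (x₀ x ^ 2 + x₁ x ^ 18) ⊕ (2 · (x₀ x * x₁ x) + x₁ x ^ 54) ·ξ

  module _ where
    open K

    budaghyanHelleseth : K.Carrier → ℕ → K.Carrier → K.Carrier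
    budaghyanHelleseth b k x =
      b * x ^ (p ℕ.^ k ℕ.+ 1) + (b * x ^ (p ℕ.^ k ℕ.+ 1)) ^ (p ℕ.^ n)
      + ξ * x ^ (p ℕ.^ n ℕ.+ 1)

{-# OPTIONS --safe #-}
-- An affine point of a line L a b lies in 𝒰 precisely when f(x + a) and b have the same 1-coordinate, so
-- everything reduces to showing that the 1-coordinate g of f has one zero and takes every other value in F
-- exactly q + 1 times. For this it is enough that g has a single zero and that for every d ≠ 0 some injection
-- of K multiplies g by d. In (a)–(d), n/gcd(k,n) odd makes x ↦ x^(pᵏ+1) a bijective reparametrisation of
-- squaring, and g becomes an anisotropic form u² + αv², the norm form of F(√−α). In (e), g(x) is the
-- trace of bx^(pᵏ+1), which vanishes only at 0 because elements of trace 0 are squares in K when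
-- q ≡ 3 (mod 4), and x ↦ νx multiplies it by ν^(pᵏ+1), which can be any element of F.
-- Planarity: f(x + a) − f(x) = f(a) + B(x, a) with B biadditive, so it suffices that B(x, a) = 0 forces
-- x = 0 or a = 0; this comes down to some element being a nonsquare.
module Submission where

open import Algebra.Bundles using (CommutativeMonoid; CommutativeRing)
open import Algebra.Morphism.Structures using (IsRingMonomorphism)
import Algebra.Properties.CommutativeMonoid.Sum as Sum
import Algebra.Properties.CommutativeSemiring.Binomial as Binomial
import Algebra.Properties.CommutativeSemiring.Exp as CExp
import Algebra.Properties.Ring as RingProperties
import Algebra.Properties.Semiring.Exp as Exp
import Algebra.Properties.Semiring.Mult as Mult
import Algebra.Properties.Semiring.Mult.TCOptimised as TCMult
import Algebra.Solver.Ring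
open import Algebra.Solver.Ring.AlmostCommutativeRing using (_-Raw-AlmostCommutative⟶_; fromCommutativeRing)
open import Data.Fin.Base using (Fin; combine; fromℕ; inject₁; punchOut; remQuot; suc; toℕ; zero)
open import Data.Fin.Properties using (any?; combine-remQuot; injective⇒≤; punchInᵢ≢i; punchOut-injective; remQuot-combine; toℕ-fromℕ; toℕ-inject₁; toℕ<n)
import Data.Fin.Properties as Fin
open import Data.Integer.Base as ℤ using (+_; -[1+_]; ∣_∣; _⊖_; _◃_; sign; ℤ)
import Data.Integer.Properties as ℤ
open import Data.Maybe.Base as Maybe using (Maybe)
open import Data.Nat.Base as ℕ using (_!; _%_; _/_; _∸_; NonZero; suc; zero; ℕ)
open import Data.Nat.Combinatorics using (_C_; k![n∸k]!∣n!; nCn≡1)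
open import Data.Nat.Combinatorics.Specification using (nCk≡n!/k![n-k]!)
open import Data.Nat.Divisibility using (_∣_; divides; quotient; ∣-refl; ∣m⇒∣m*n; ∣⇒≤)
open import Data.Nat.DivMod using ([m+kn]%n≡m%n; m/n*n≡m; m≡m%n+[m/n]*n)
open import Data.Nat.GCD using (gcd; gcd[m,n]∣m; gcd[m,n]∣n)
open import Data.Nat.Primality using (Prime; euclidsLemma; prime⇒irreducible; prime⇒nonTrivial; prime⇒nonZero)
import Data.Nat.Properties as ℕ
open import Data.Nat.Solver using (module +-*-Solver)
open import Data.Product.Base using (_,_; _×_; proj₁; proj₂; ∃; ∃₂)
open import Data.Sign.Base as Sign using (Sign)
open import Data.Sum.Base as Sum⊎ using ([_,_]′; _⊎_; inj₁; inj₂)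
open import Data.Vec.Functional using (init; last; removeAt; replicate; tail)
open import Function.Base using (_∘_)
open import Function.Bundles using (Inverse)
open import Level using (Level; _⊔_)
open import Relation.Binary.Bundles using (Setoid)
open import Relation.Binary.Definitions using (Tri; tri<; tri≈; tri>)
open import Relation.Binary.PropositionalEquality as ≡ using (_≡_; _≢_)
open import Relation.Nullary using (contradiction; Dec; no; yes; ¬_)
open import Relation.Nullary.Decidable using (_×-dec_; dec⇒maybe; map′; ¬?)
open import Relation.Unary using (Decidable; Pred; _∩_)

open import Defs

-- The oddness of `n/gcd(k,n)` enters as a statement about iteration: an odd number j of
-- applications of x ↦ x^P, P = pᵏ, is the identity on F. Hence x^P = -x forces x = 0, and (Pʲ +
-- 1)/(P + 1) is an odd integer e with (uᵉ)^(P+1) = u², which is the reparametrisation. The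
-- multiplicative group is never shown to be cyclic; facts about squares come from counting. For a
-- nonsquare a, the elements z² and az² exhaust the field by the pigeonhole principle, and in odd
-- characteristic -1 is a nonsquare exactly when q ≡ 3 (mod 4). Every nonzero d must be a scaling
-- factor, and the only hard d are those outside the obvious square class. In (a) and (b) they are
-- values αs². In (c) and (d) the form is u² + v² with -1 a nonsquare, so -1 has to be a sum of two
-- squares. In (e) -1 has to be a (P+1)-st power in K; for odd k it is the norm of s + ti, where
-- again s² + t² = -1, and s and t must lie in the prime field for x ↦ x^P to fix them.

private variable
  c ℓ c₁ c₂ ℓ₁ ℓ₂ ℓ₃ ℓ₄ : Level

-- A ring solver with integer coefficients over an arbitrary commutative ring.

module IntegerSolver (R : CommutativeRing c ℓ) where
  open CommutativeRing R
  open RingProperties ring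
  open TCMult semiring renaming (_×_ to _·_)
  open import Relation.Binary.Reasoning.Setoid setoid

  private
    -- The optimised multiple makes `⟦ + 1 ⟧` definitionally `1#`, so that `con (+ 1)` matches a
    -- literal `1#` in a goal.
    ⟦_⟧ : ℤ → Carrier
    ⟦ + n ⟧      = n · 1#
    ⟦ -[1+ n ] ⟧ = - (suc n · 1#)

    cancel : ∀ x y z → (x + y) - (x + z) ≈ y - z
    cancel x y z = begin
      (x + y) - (x + z)      ≈⟨ +-cong (+-comm x y) (sym (-‿+-comm x z)) ⟩
      (y + x) + (- x - z)    ≈⟨ +-assoc y x _ ⟩
      y + (x + (- x - z))    ≈⟨ +-congˡ (+-assoc x (- x) (- z)) ⟨
      y + ((x - x) - z)      ≈⟨ +-congˡ (+-congʳ (-‿inverseʳ x)) ⟩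
      y + (0# - z)           ≈⟨ +-congˡ (+-identityˡ (- z)) ⟩
      y - z                  ∎

    ⊖-homo : ∀ m n → ⟦ m ⊖ n ⟧ ≈ m · 1# - n · 1#
    ⊖-homo zero    zero    = sym (-‿inverseʳ 0#)
    ⊖-homo zero    (suc n) = sym (+-identityˡ _)
    ⊖-homo (suc m) zero    = sym (trans (+-congˡ -0#≈0#) (+-identityʳ _))
    ⊖-homo (suc m) (suc n) = begin
      ⟦ suc m ⊖ suc n ⟧              ≡⟨ ≡.cong ⟦_⟧ (ℤ.[1+m]⊖[1+n]≡m⊖n m n) ⟩
      ⟦ m ⊖ n ⟧                      ≈⟨ ⊖-homo m n ⟩
      m · 1# - n · 1#                ≈⟨ cancel 1# (m · 1#) (n · 1#) ⟨
      (1# + m · 1#) - (1# + n · 1#)  ≈⟨ +-cong (×-homo-+ 1# 1 m) (-‿cong (×-homo-+ 1# 1 n)) ⟨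
      suc m · 1# - suc n · 1#        ∎

    +-homo : ∀ i j → ⟦ i ℤ.+ j ⟧ ≈ ⟦ i ⟧ + ⟦ j ⟧
    +-homo (+ m)    (+ n)    = ×-homo-+ 1# m n
    +-homo (+ m)    -[1+ n ] = ⊖-homo m (suc n)
    +-homo -[1+ m ] (+ n)    = trans (⊖-homo n (suc m)) (+-comm _ _)
    +-homo -[1+ m ] -[1+ n ] = begin
      - (suc (suc (m ℕ.+ n)) · 1#)     ≡⟨ ≡.cong (λ k → - (suc k · 1#)) (≡.sym (ℕ.+-suc m n)) ⟩
      - ((suc m ℕ.+ suc n) · 1#)       ≈⟨ -‿cong (×-homo-+ 1# (suc m) (suc n)) ⟩
      - (suc m · 1# + suc n · 1#)      ≈⟨ -‿+-comm _ _ ⟨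
      - (suc m · 1#) - (suc n · 1#)    ∎

    signed : Sign → Carrier → Carrier
    signed Sign.+ x = x
    signed Sign.- x = - x

    ◃-homo : ∀ σ n → ⟦ σ ◃ n ⟧ ≈ signed σ (n · 1#)
    ◃-homo Sign.+ zero    = refl
    ◃-homo Sign.- zero    = sym -0#≈0#
    ◃-homo Sign.+ (suc n) = refl
    ◃-homo Sign.- (suc n) = refl

    signed-cong : ∀ σ {x y} → x ≈ y → signed σ x ≈ signed σ y
    signed-cong Sign.+ = λ eq → eq
    signed-cong Sign.- = -‿cong

    signed-* : ∀ σ τ x y → signed (σ Sign.* τ) (x * y) ≈ signed σ x * signed τ y
    signed-* Sign.+ Sign.+ x y = refl
    signed-* Sign.+ Sign.- x y = -‿distribʳ-* x y
    signed-* Sign.- Sign.+ x y = -‿distribˡ-* x y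
    signed-* Sign.- Sign.- x y = begin
      x * y          ≈⟨ -‿involutive (x * y) ⟨
      - - (x * y)    ≈⟨ -‿cong (-‿distribʳ-* x y) ⟩
      - (x * - y)    ≈⟨ -‿distribˡ-* x (- y) ⟩
      - x * - y      ∎

    signed-abs : ∀ i → ⟦ i ⟧ ≈ signed (sign i) (∣ i ∣ · 1#)
    signed-abs (+ n)    = refl
    signed-abs -[1+ n ] = refl

    *-homo : ∀ i j → ⟦ i ℤ.* j ⟧ ≈ ⟦ i ⟧ * ⟦ j ⟧
    *-homo i j = begin
      ⟦ i ℤ.* j ⟧                                            ≈⟨ ◃-homo σ (∣ i ∣ ℕ.* ∣ j ∣) ⟩
      signed σ ((∣ i ∣ ℕ.* ∣ j ∣) · 1#)                      ≈⟨ signed-cong σ (×1-homo-* ∣ i ∣ ∣ j ∣) ⟩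
      signed σ ((∣ i ∣ · 1#) * (∣ j ∣ · 1#))                 ≈⟨ signed-* (sign i) (sign j) _ _ ⟩
      signed (sign i) (∣ i ∣ · 1#) * signed (sign j) (∣ j ∣ · 1#)
                                                             ≈⟨ *-cong (signed-abs i) (signed-abs j) ⟨
      ⟦ i ⟧ * ⟦ j ⟧                                          ∎
      where σ = sign i Sign.* sign j

    -‿homo : ∀ i → ⟦ ℤ.- i ⟧ ≈ - ⟦ i ⟧
    -‿homo (+ zero)  = sym -0#≈0#
    -‿homo (+ suc n) = refl
    -‿homo -[1+ n ]  = sym (-‿involutive _)

    morphism : CommutativeRing.rawRing ℤ.+-*-commutativeRing -Raw-AlmostCommutative⟶ fromCommutativeRing R
    morphism = record
      { ⟦_⟧ = ⟦_⟧ ; +-homo = +-homo ; *-homo = *-homo ; -‿homo = -‿homo ; 0-homo = refl ; 1-homo = refl }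

    _coeff≟_ : ∀ i j → Maybe (⟦ i ⟧ ≈ ⟦ j ⟧)
    i coeff≟ j = Maybe.map (reflexive ∘ ≡.cong ⟦_⟧) (dec⇒maybe (i ℤ.≟ j))

  open Algebra.Solver.Ring _ _ morphism _coeff≟_ public
    using (Polynomial; solve; con; _:=_; _:+_; _:*_; _:-_; :-_; _:^_)

-- Counting subsets of finite setoids, and sums over them.

open Sum ℕ.+-0-commutativeMonoid using () renaming
  (sum to sumℕ; sum-cong-≗ to sumℕ-cong; sum-remove to sumℕ-remove; ∑-comm to sumℕ-comm; ∑-distrib-+ to sumℕ-distrib-+)

sumℕ-const : ∀ {n} (f : Fin n → ℕ) {k} → (∀ i → f i ≡ k) → sumℕ f ≡ n ℕ.* k
sumℕ-const {zero}  f eq = ≡.refl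
sumℕ-const {suc n} f eq = ≡.cong₂ ℕ._+_ (eq zero) (sumℕ-const (f ∘ suc) (eq ∘ suc))

indicator : {P : Set ℓ₃} → Dec P → ℕ
indicator (yes _) = 1
indicator (no _)  = 0

count : ∀ {n} {P : Pred (Fin n) ℓ₃} → Decidable P → ℕ
count P? = sumℕ (indicator ∘ P?)

subset-size : (S : Setoid c ℓ) →
              let open Setoid S in
              {P : Pred Carrier ℓ₃} {m : ℕ} (elt : Fin m → Carrier) →
              (∀ i → P (elt i)) → (∀ {i j} → elt i ≈ elt j → i ≡ j) →
              (∀ x → P x → ∃ λ i → elt i ≈ x) → SubsetHasSize S P m
subset-size S elt elt-∈ elt-injective covers = record
  { to        = λ i → elt i , elt-∈ i
  ; from      = λ (x , x∈P) → proj₁ (covers x x∈P)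
  ; to-cong   = λ { ≡.refl → Setoid.refl S }
  ; from-cong = λ {(x , x∈P)} {(y , y∈P)} eq → elt-injective
      (trans (proj₂ (covers x x∈P)) (trans eq (sym (proj₂ (covers y y∈P)))))
  ; inverse   = (λ { {x , x∈P} ≡.refl → proj₂ (covers x x∈P) })
              , (λ {_} {(x , x∈P)} eq → elt-injective (trans (proj₂ (covers x x∈P)) eq))
  }
  where open Setoid S

subset-size-map : {S : Setoid c₁ ℓ₁} {T : Setoid c₂ ℓ₂} →
                  let open Setoid S using () renaming (_≈_ to _≈ₛ_)
                      open Setoid T using () renaming (_≈_ to _≈ₜ_)
                  in
                  {P : Pred (Setoid.Carrier S) ℓ₃} {Q : Pred (Setoid.Carrier T) ℓ₄} {m : ℕ}
                  (h : Setoid.Carrier S → Setoid.Carrier T) →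
                  (∀ {x y} → x ≈ₛ y → h x ≈ₜ h y) → (∀ {x y} → h x ≈ₜ h y → x ≈ₛ y) →
                  (∀ x → P x → Q (h x)) → (∀ y → Q y → ∃ λ x → P x × h x ≈ₜ y) →
                  SubsetHasSize S P m → SubsetHasSize T Q m
subset-size-map {S = S} {T = T} h h-cong h-injective P⇒Q covers size =
  subset-size T (h ∘ proj₁ ∘ to) (λ i → P⇒Q _ (proj₂ (to i))) to-injective
    (λ y y∈Q → let x , x∈P , hx≈y = covers y y∈Q in
      from (x , x∈P) , Setoid.trans T (h-cong (inverseˡ ≡.refl)) hx≈y)
  where
  open Inverse size
  to-injective : ∀ {i j} → Setoid._≈_ T (h (proj₁ (to i))) (h (proj₁ (to j))) → i ≡ j
  to-injective {i} eq = ≡.trans (≡.sym (inverseʳ {y = to i} (Setoid.refl S))) (inverseʳ (h-injective eq))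

count-size : ∀ {n} {P : Pred (Fin n) ℓ₃} (P? : Decidable P) → SubsetHasSize (≡.setoid (Fin n)) P (count P?)
count-size {n = zero}  P? = subset-size (≡.setoid _) (λ ()) (λ ()) (λ { {()} }) (λ ())
count-size {n = suc n} {P = P} P? with P? zero | count-size {P = P ∘ suc} (P? ∘ suc)
... | no ¬P0 | size = subset-size-map {P = P ∘ suc} suc (≡.cong suc) Fin.suc-injective (λ _ Pi → Pi) covers size
  where
  covers : ∀ i → P i → ∃ λ j → P (suc j) × suc j ≡ i
  covers zero    P0 = contradiction P0 ¬P0
  covers (suc i) Pi = i , Pi , ≡.refl
... | yes P0 | size = subset-size (≡.setoid _) elt elt-∈ elt-injective covers
  where
  open Inverse size
  elt : Fin (suc _) → Fin (suc n)
  elt zero    = zero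
  elt (suc i) = suc (proj₁ (to i))
  elt-∈ : ∀ i → P (elt i)
  elt-∈ zero    = P0
  elt-∈ (suc i) = proj₂ (to i)
  elt-injective : ∀ {i j} → elt i ≡ elt j → i ≡ j
  elt-injective {zero}  {zero}  eq = ≡.refl
  elt-injective {zero}  {suc j} ()
  elt-injective {suc i} {zero}  ()
  elt-injective {suc i} {suc j} eq = ≡.cong suc
    (≡.trans (≡.sym (inverseʳ {y = to i} ≡.refl)) (inverseʳ (Fin.suc-injective eq)))
  covers : ∀ i → P i → ∃ λ j → elt j ≡ i
  covers zero    _  = zero , ≡.refl
  covers (suc i) Pi = suc (from (i , Pi)) , ≡.cong suc (inverseˡ ≡.refl)

subset-size-≤ : {S : Setoid c₁ ℓ₁} {T : Setoid c₂ ℓ₂} →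
                let open Setoid S using () renaming (_≈_ to _≈ₛ_)
                    open Setoid T using () renaming (_≈_ to _≈ₜ_)
                in
                {P : Pred (Setoid.Carrier S) ℓ₃} {Q : Pred (Setoid.Carrier T) ℓ₄} {m n : ℕ}
                (h : Setoid.Carrier S → Setoid.Carrier T) →
                (∀ {x y} → h x ≈ₜ h y → x ≈ₛ y) → (∀ x → P x → Q (h x)) →
                SubsetHasSize S P m → SubsetHasSize T Q n → m ℕ.≤ n
subset-size-≤ {S = S} {T = T} h h-injective P⇒Q size size′ = injective⇒≤ code-injective
  where
  module I = Inverse size
  module J = Inverse size′
  code : Fin _ → Fin _
  code i = J.from (h (proj₁ (I.to i)) , P⇒Q _ (proj₂ (I.to i)))
  code-injective : ∀ {i j} → code i ≡ code j → i ≡ j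
  code-injective {i} eq = ≡.trans (≡.sym (I.inverseʳ {y = I.to i} (Setoid.refl S)))
    (I.inverseʳ (h-injective (Setoid.trans T (Setoid.sym T (J.inverseˡ ≡.refl)) (J.inverseˡ eq))))

count-unique : ∀ {n m} {P : Pred (Fin n) ℓ₃} (P? : Decidable P) →
               SubsetHasSize (≡.setoid (Fin n)) P m → count P? ≡ m
count-unique {P = P} P? size = ℕ.≤-antisym
  (subset-size-≤ {P = P} (λ i → i) (λ eq → eq) (λ _ Pi → Pi) (count-size P?) size)
  (subset-size-≤ {P = P} (λ i → i) (λ eq → eq) (λ _ Pi → Pi) size (count-size P?))

size-1 : (S : Setoid c ℓ) →
         let open Setoid S in
         {P : Pred Carrier ℓ₃} (x : Carrier) → P x →
         (∀ y → P y → x ≈ y) → SubsetHasSize S P 1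
size-1 S x Px unique = subset-size S (λ _ → x) (λ _ → Px) (λ { {zero} {zero} _ → ≡.refl ; {suc ()} ; {zero} {suc ()} })
    (λ y Py → zero , unique y Py)

-- If `j` were missed, `punchOut` would turn `f` into an injection into a smaller `Fin`.
injective⇒surjective-Fin : ∀ {n} (f : Fin n → Fin n) → (∀ {i j} → f i ≡ f j → i ≡ j) → ∀ j → ∃ λ i → f i ≡ j
injective⇒surjective-Fin {n} f f-injective j with any? (λ i → f i Fin.≟ j)
... | yes found = found
injective⇒surjective-Fin {suc n} f f-injective j | no none =
  contradiction (injective⇒≤ {f = λ i → punchOut (j≢f i)} (λ eq → f-injective (punchOut-injective (j≢f _) (j≢f _) eq)))
    ℕ.1+n≰n
  where
  j≢f : ∀ i → j ≢ f i
  j≢f i eq = none (i , ≡.sym eq)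

injective⇒surjective : {S : Setoid c₁ ℓ₁} {T : Setoid c₂ ℓ₂} →
                       let open Setoid S using () renaming (_≈_ to _≈ₛ_)
                           open Setoid T using () renaming (_≈_ to _≈ₜ_)
                       in
                       {m : ℕ} → HasSize S m → HasSize T m →
                       (h : Setoid.Carrier S → Setoid.Carrier T) → (∀ {x y} → h x ≈ₜ h y → x ≈ₛ y) →
                       ∀ y → ∃ λ x → h x ≈ₜ y
injective⇒surjective {S = S} {T = T} size size′ h h-injective y = I.to (proj₁ found) ,
  Setoid.trans T (Setoid.sym T (J.inverseˡ ≡.refl)) (J.inverseˡ (proj₂ found))
  where
  module I = Inverse size
  module J = Inverse size′
  found = injective⇒surjective-Fin (J.from ∘ h ∘ I.to)
    (λ eq → ≡.trans (≡.sym (I.inverseʳ (Setoid.refl S)))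
      (I.inverseʳ (h-injective (Setoid.trans T (Setoid.sym T (J.inverseˡ ≡.refl)) (J.inverseˡ eq)))))
    (J.from y)

module _ {S : Setoid c₁ ℓ₁} {n : ℕ} (size : HasSize S n) (M : CommutativeMonoid c ℓ) where
  private
    module S = Setoid S
    module M = CommutativeMonoid M
    open Inverse size
  open Sum M

  total : (S.Carrier → M.Carrier) → M.Carrier
  total h = sum (h ∘ to)

  -- Change of variables. The monoid is arbitrary because three are used: addition and
  -- multiplication of a field, and addition of natural numbers for counting.
  total-permute : (h : S.Carrier → M.Carrier) → (∀ {x y} → x S.≈ y → h x M.≈ h y) →
                  (π π⁻ : S.Carrier → S.Carrier) →
                  (∀ {x y} → x S.≈ y → π x S.≈ π y) → (∀ {x y} → x S.≈ y → π⁻ x S.≈ π⁻ y) →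
                  (∀ x → π (π⁻ x) S.≈ x) → (∀ x → π⁻ (π x) S.≈ x) →
                  total h M.≈ total (h ∘ π)
  total-permute h h-cong π π⁻ π-cong π⁻-cong ππ⁻ π⁻π = M.trans
    (sum-permute (h ∘ to) (record
      { to = from ∘ π ∘ to ; from = from ∘ π⁻ ∘ to ; to-cong = ≡.cong _ ; from-cong = ≡.cong _
      ; inverse = (λ { ≡.refl → round π π⁻ π-cong ππ⁻ _ }) , (λ { ≡.refl → round π⁻ π π⁻-cong π⁻π _ }) }))
    (sum-cong-≋ {n} (λ i → h-cong (inverseˡ ≡.refl)))
    where
    round : ∀ f g → (∀ {x y} → x S.≈ y → f x S.≈ f y) → (∀ x → f (g x) S.≈ x) →
            ∀ i → from (f (to (from (g (to i))))) ≡ i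
    round f g f-cong fg i = inverseʳ (S.trans (f-cong (inverseˡ ≡.refl)) (fg (to i)))

-- Parity, residues modulo 4, and divisibility by a prime.

Odd : ℕ → Set
Odd n = ∃ λ h → n ≡ 1 ℕ.+ 2 ℕ.* h

infix 4 _≡_[mod4]
_≡_[mod4] : ℕ → ℕ → Set
m ≡ r [mod4] = ∃ λ t → m ≡ r ℕ.+ 4 ℕ.* t

even⊎odd : ∀ n → (∃ λ h → n ≡ 2 ℕ.* h) ⊎ Odd n
even⊎odd zero    = inj₁ (0 , ≡.refl)
even⊎odd (suc n) with even⊎odd n
... | inj₁ (h , eq) = inj₂ (h , ≡.cong suc eq)
... | inj₂ (h , eq) = inj₁ (suc h , ≡.trans (≡.cong suc eq) (≡.cong suc (≡.sym (ℕ.+-suc h (h ℕ.+ 0)))))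

odd : ∀ {n} → ¬ 2 ∣ n → Odd n
odd {n} 2∤n with even⊎odd n
... | inj₁ (h , eq) = contradiction (divides h (≡.trans eq (ℕ.*-comm 2 h))) 2∤n
... | inj₂ found    = found

odd-* : ∀ {m n} → Odd m → Odd n → Odd (m ℕ.* n)
odd-* (h , ≡.refl) (i , ≡.refl) = h ℕ.+ i ℕ.+ 2 ℕ.* (h ℕ.* i) ,
  solve 2 (λ h i → (con 1 :+ con 2 :* h) :* (con 1 :+ con 2 :* i) := con 1 :+ con 2 :* (h :+ i :+ con 2 :* (h :* i))) ≡.refl h i
  where open +-*-Solver

odd-^ : ∀ {m} k → Odd m → Odd (m ℕ.^ k)
odd-^ zero    odd-m = 0 , ≡.refl
odd-^ (suc k) odd-m = odd-* odd-m (odd-^ k odd-m)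

odd-prime : ∀ {p} → Prime p → p ≢ 2 → Odd p
odd-prime p-prime p≢2 = odd λ 2∣p → [ (λ ()) , (λ eq → p≢2 (≡.sym eq)) ]′ (prime⇒irreducible p-prime 2∣p)

-- The quotient is 1 − P + P² − ⋯ + P²ʰ, an odd number of odd terms.
P+1∣P^odd+1 : ∀ {P} → Odd P → ∀ h →
              ∃ λ w → (1 ℕ.+ 2 ℕ.* w) ℕ.* (P ℕ.+ 1) ≡ P ℕ.^ (1 ℕ.+ 2 ℕ.* h) ℕ.+ 1
P+1∣P^odd+1 {P} _ zero = 0 , solve 1 (λ P → con 1 :* (P :+ con 1) := P :* con 1 :+ con 1) ≡.refl P
  where open +-*-Solver
P+1∣P^odd+1 {P} odd-P@(v , ≡.refl) (suc h) with P+1∣P^odd+1 odd-P h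
... | w , eq = w ℕ.+ X ℕ.* v , (begin
  (1 ℕ.+ 2 ℕ.* (w ℕ.+ X ℕ.* v)) ℕ.* (P ℕ.+ 1)
    ≡⟨ solve 3 (λ w v X → (con 1 :+ con 2 :* (w :+ X :* v)) :* (con 1 :+ con 2 :* v :+ con 1) :=
         (con 1 :+ con 2 :* w) :* (con 1 :+ con 2 :* v :+ con 1) :+ X :* con 2 :* v :* (con 1 :+ con 2 :* v :+ con 1)) ≡.refl w v X ⟩
  (1 ℕ.+ 2 ℕ.* w) ℕ.* (P ℕ.+ 1) ℕ.+ X ℕ.* 2 ℕ.* v ℕ.* (P ℕ.+ 1)
    ≡⟨ ≡.cong (ℕ._+ X ℕ.* 2 ℕ.* v ℕ.* (P ℕ.+ 1)) eq ⟩
  (X ℕ.+ 1) ℕ.+ X ℕ.* 2 ℕ.* v ℕ.* (P ℕ.+ 1)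
    ≡⟨ solve 2 (λ v X → (X :+ con 1) :+ X :* con 2 :* v :* (con 1 :+ con 2 :* v :+ con 1) :=
         (con 1 :+ con 2 :* v) :* ((con 1 :+ con 2 :* v) :* X) :+ con 1) ≡.refl v X ⟩
  P ℕ.^ (3 ℕ.+ 2 ℕ.* h) ℕ.+ 1
    ≡⟨ ≡.cong (λ k → P ℕ.^ (2 ℕ.+ k) ℕ.+ 1) (≡.sym (ℕ.+-suc h (h ℕ.+ 0))) ⟩
  P ℕ.^ (1 ℕ.+ 2 ℕ.* suc h) ℕ.+ 1 ∎)
  where
  open +-*-Solver
  open ≡.≡-Reasoning
  X = P ℕ.^ (1 ℕ.+ 2 ℕ.* h)

odd+1 : ∀ {m} ((v , _) : Odd m) → m ℕ.+ 1 ≡ (1 ℕ.+ v) ℕ.+ (1 ℕ.+ v)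
odd+1 (v , ≡.refl) = solve 1 (λ v → con 1 :+ con 2 :* v :+ con 1 := con 1 :+ v :+ (con 1 :+ v)) ≡.refl v
  where open +-*-Solver

1+2[1+2t]≡3+4t : ∀ t → 1 ℕ.+ ((1 ℕ.+ (t ℕ.+ t)) ℕ.+ (1 ℕ.+ (t ℕ.+ t))) ≡ 3 ℕ.+ 4 ℕ.* t
1+2[1+2t]≡3+4t = solve 1 (λ t → con 1 :+ ((con 1 :+ (t :+ t)) :+ (con 1 :+ (t :+ t))) := con 3 :+ con 4 :* t) ≡.refl
  where open +-*-Solver

m^[k+i]+m^i≡[m^k+1]m^i : ∀ m k i → m ℕ.^ (k ℕ.+ i) ℕ.+ m ℕ.^ i ≡ (m ℕ.^ k ℕ.+ 1) ℕ.* m ℕ.^ i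
m^[k+i]+m^i≡[m^k+1]m^i m k i = ≡.trans (≡.cong (ℕ._+ m ℕ.^ i) (ℕ.^-distribˡ-+-* m k i))
  (solve 2 (λ x y → x :* y :+ y := (x :+ con 1) :* y) ≡.refl (m ℕ.^ k) (m ℕ.^ i))
  where open +-*-Solver

residue[4] : ∀ {m r} → m % 4 ≡ r → m ≡ r [mod4]
residue[4] {m} ≡.refl = m / 4 , ≡.trans (m≡m%n+[m/n]*n m 4) (≡.cong (m % 4 ℕ.+_) (ℕ.*-comm (m / 4) 4))

residue[4]-unique : ∀ {m r s} → m ≡ r [mod4] → m ≡ s [mod4] → r % 4 ≡ s % 4
residue[4]-unique {m} {r} {s} (t , eq) (u , eq′) = ≡.trans (≡.sym ([m+kn]%n≡m%n r t 4)) (≡.trans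
  (≡.cong (_% 4) (≡.trans (≡.cong (r ℕ.+_) (ℕ.*-comm t 4)) (≡.trans (≡.trans (≡.sym eq) eq′) (≡.cong (s ℕ.+_) (ℕ.*-comm 4 u)))))
  ([m+kn]%n≡m%n s u 4))

odd-square[4] : ∀ {m} → Odd m → m ℕ.^ 2 ≡ 1 [mod4]
odd-square[4] (v , ≡.refl) = v ℕ.+ v ℕ.* v ,
  solve 1 (λ v → (con 1 :+ con 2 :* v) :* ((con 1 :+ con 2 :* v) :* con 1) := con 1 :+ con 4 :* (v :+ v :* v)) ≡.refl v
  where open +-*-Solver

even-power[4] : ∀ {m} h → Odd m → m ℕ.^ (2 ℕ.* h) ≡ 1 [mod4]
even-power[4] {m} h m-odd = ≡.subst (λ e → e ≡ 1 [mod4])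
  (≡.trans (ℕ.^-*-assoc m h 2) (≡.cong (m ℕ.^_) (ℕ.*-comm h 2))) (odd-square[4] (odd-^ h m-odd))

^-odd[4] : ∀ {m} n → Odd m → Odd n → m ℕ.^ n ≡ m [mod4]
^-odd[4] {m} n m-odd (h , ≡.refl) = let t , eq = even-power[4] h m-odd in m ℕ.* t ,
  ≡.trans (≡.cong (m ℕ.*_) eq) (solve 2 (λ m t → m :* (con 1 :+ con 4 :* t) := m :+ con 4 :* (m :* t)) ≡.refl m t)
  where open +-*-Solver

^-odd-3[4] : ∀ {m} n → m ≡ 3 [mod4] → Odd n → m ℕ.^ n ≡ 3 [mod4]
^-odd-3[4] n (u , ≡.refl) n-odd = let t , eq = ^-odd[4] n (1 ℕ.+ 2 ℕ.* u , 3+4u-odd) n-odd in u ℕ.+ t ,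
  ≡.trans eq (solve 2 (λ u t → con 3 :+ con 4 :* u :+ con 4 :* t := con 3 :+ con 4 :* (u :+ t)) ≡.refl u t)
  where
  open +-*-Solver
  3+4u-odd : 3 ℕ.+ 4 ℕ.* u ≡ 1 ℕ.+ 2 ℕ.* (1 ℕ.+ 2 ℕ.* u)
  3+4u-odd = solve 1 (λ u → con 3 :+ con 4 :* u := con 1 :+ con 2 :* (con 1 :+ con 2 :* u)) ≡.refl u

-- An even power of an odd number is 1 modulo 4. In (e) this makes `n` odd, which gives x ↦ x^(pᵏ)
-- an odd period on F.
odd-exponent : ∀ {m} n → Odd m → m ℕ.^ n ≡ 3 [mod4] → Odd n
odd-exponent {m} n m-odd m^n≡3[4] = [ even , (λ n-odd → n-odd) ]′ (even⊎odd n)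
  where
  even : (∃ λ h → n ≡ 2 ℕ.* h) → Odd n
  even (h , ≡.refl) = contradiction (residue[4]-unique {r = 3} {s = 1} m^n≡3[4] (even-power[4] h m-odd)) (λ ())

odd-base[4] : ∀ {m} n → Odd m → Odd n → m ℕ.^ n ≡ 3 [mod4] →
              m ≡ 3 [mod4]
odd-base[4] {m} n (v , m≡) n-odd m^n≡3[4] = [ even , (λ (w , v≡) → w , ≡.trans m≡ (≡.trans (≡.cong (λ v → 1 ℕ.+ 2 ℕ.* v) v≡)
    (solve 1 (λ w → con 1 :+ con 2 :* (con 1 :+ con 2 :* w) := con 3 :+ con 4 :* w) ≡.refl w))) ]′ (even⊎odd v)
  where
  open +-*-Solver
  even : (∃ λ w → v ≡ 2 ℕ.* w) → m ≡ 3 [mod4]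
  even (w , ≡.refl) = let t , m^n≡ = ^-odd[4] n (v , m≡) n-odd in contradiction
    (residue[4]-unique {r = 3} {s = 1} m^n≡3[4] (w ℕ.+ t , ≡.trans m^n≡ (≡.trans (≡.cong (ℕ._+ 4 ℕ.* t) m≡)
      (solve 2 (λ w t → con 1 :+ con 2 :* (con 2 :* w) :+ con 4 :* t := con 1 :+ con 4 :* (w :+ t)) ≡.refl w t)))) (λ ())

-- Both products are lcm(k, n): `j` iterations of x ↦ x^(pᵏ) amount to `r` iterations of x ↦ x^(pⁿ),
-- the identity on F.
odd-cofactor : ∀ {k n} → OddCofactor k n → ∃₂ λ j r → Odd j × k ℕ.* j ≡ n ℕ.* r
odd-cofactor {k} {n} j-odd = j , r , odd j-odd , (begin
  k ℕ.* j            ≡⟨ ≡.cong (ℕ._* j) (_∣_.equality (gcd[m,n]∣m k n)) ⟩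
  r ℕ.* g ℕ.* j      ≡⟨ solve 3 (λ r g j → r :* g :* j := j :* g :* r) ≡.refl r g j ⟩
  j ℕ.* g ℕ.* r      ≡⟨ ≡.cong (ℕ._* r) (_∣_.equality (gcd[m,n]∣n k n)) ⟨
  n ℕ.* r            ∎)
  where
  open +-*-Solver
  open ≡.≡-Reasoning
  g = gcd k n
  j = quotient (gcd[m,n]∣n k n)
  r = quotient (gcd[m,n]∣m k n)

prime∤! : ∀ {p} → Prime p → ∀ k → k ℕ.< p → ¬ p ∣ k !
prime∤! p-prime zero    0<p p∣1 = contradiction (∣⇒≤ p∣1) (ℕ.<⇒≱ (ℕ.nonTrivial⇒n>1 _ {{prime⇒nonTrivial p-prime}}))
prime∤! p-prime (suc k) k<p p∣ with euclidsLemma (suc k) (k !) p-prime p∣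
... | inj₁ p∣1+k = contradiction (∣⇒≤ p∣1+k) (ℕ.<⇒≱ k<p)
... | inj₂ p∣k!  = prime∤! p-prime k (ℕ.<-trans (ℕ.n<1+n k) k<p) p∣k!

-- `p` divides p! = (p C k) · k! (p - k)!, and neither factorial on the right.
prime∣nCk : ∀ {p} → Prime p → ∀ k → 0 ℕ.< k → k ℕ.< p → p ∣ p C k
prime∣nCk {p} p-prime k@(suc _) 0<k k<p
  with euclidsLemma (p C k) (k ! ℕ.* (p ∸ k) !) p-prime (≡.subst (p ∣_) (≡.sym nCk*) (n∣n! p {{prime⇒nonZero p-prime}}))
  where
  instance
    k![p-k]!≢0 = ℕ._!*_!≢0 k (p ∸ k)
  n∣n! : ∀ n .{{_ : NonZero n}} → n ∣ n !
  n∣n! (suc n) = ∣m⇒∣m*n (n !) ∣-refl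
  nCk* : (p C k) ℕ.* (k ! ℕ.* (p ∸ k) !) ≡ p !
  nCk* = ≡.trans (≡.cong (ℕ._* (k ! ℕ.* (p ∸ k) !)) (nCk≡n!/k![n-k]! (ℕ.<⇒≤ k<p))) (m/n*n≡m (k![n∸k]!∣n! (ℕ.<⇒≤ k<p)))
... | inj₁ p∣nCk = p∣nCk
... | inj₂ p∣k![p-k]! with euclidsLemma (k !) ((p ∸ k) !) p-prime p∣k![p-k]!
...   | inj₁ p∣k!     = contradiction p∣k! (prime∤! p-prime k k<p)
...   | inj₂ p∣[p-k]! = contradiction p∣[p-k]! (prime∤! p-prime (p ∸ k) (ℕ.∸-monoʳ-< {p} 0<k (ℕ.<⇒≤ k<p)))

indicator-yes : {P : Set ℓ₃} (P? : Dec P) → P → indicator P? ≡ 1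
indicator-yes (yes _) _ = ≡.refl
indicator-yes (no ¬P) P = contradiction P ¬P

indicator-no : {P : Set ℓ₃} (P? : Dec P) → ¬ P → indicator P? ≡ 0
indicator-no (yes P) ¬P = contradiction P ¬P
indicator-no (no _)  _  = ≡.refl

-- Finite fields: Fermat's theorem and the square classes.

module FiniteField (R : CommutativeRing c ℓ) {q : ℕ} (R-field : IsFieldOfOrder R q) where
  open CommutativeRing R public hiding (zero)
  open IsFieldOfOrder R-field public
  open RingProperties ring public
  open Exp semiring public
  open CExp commutativeSemiring public using (^-distrib-*)
  open Mult semiring public using (×1-homo-*; ×-congʳ; ×-assoc-*) renaming (_×_ to _·_)
  open IntegerSolver R public
  open import Relation.Binary.Reasoning.Setoid setoid

  x-y≈0⇒x≈y : ∀ {x y} → x - y ≈ 0# → x ≈ y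
  x-y≈0⇒x≈y {x} {y} = x∙y⁻¹≈ε⇒x≈y x y

  *-cancelˡ-≉0 : ∀ {x y z} → x ≉ 0# → x * y ≈ x * z → y ≈ z
  *-cancelˡ-≉0 {x} {y} {z} x≉0 eq = let x⁻¹ , xx⁻¹ = inverse x x≉0 in begin
    y                ≈⟨ *-identityˡ y ⟨
    1# * y           ≈⟨ *-congʳ xx⁻¹ ⟨
    x * x⁻¹ * y      ≈⟨ solve 3 (λ x x⁻¹ y → x :* x⁻¹ :* y := x⁻¹ :* (x :* y)) refl x x⁻¹ y ⟩
    x⁻¹ * (x * y)    ≈⟨ *-congˡ eq ⟩
    x⁻¹ * (x * z)    ≈⟨ solve 3 (λ x x⁻¹ y → x⁻¹ :* (x :* y) := x :* x⁻¹ :* y) refl x x⁻¹ z ⟩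
    x * x⁻¹ * z      ≈⟨ *-congʳ xx⁻¹ ⟩
    1# * z           ≈⟨ *-identityˡ z ⟩
    z                ∎

  xy≈0⇒y≈0 : ∀ {x y} → x ≉ 0# → x * y ≈ 0# → y ≈ 0#
  xy≈0⇒y≈0 x≉0 eq = *-cancelˡ-≉0 x≉0 (trans eq (sym (zeroʳ _)))

  xy≈0 : ∀ {x y} → x * y ≈ 0# → x ≈ 0# ⊎ y ≈ 0#
  xy≈0 {x} eq with x ≈? 0#
  ... | yes x≈0 = inj₁ x≈0
  ... | no  x≉0 = inj₂ (xy≈0⇒y≈0 x≉0 eq)

  xy≉0 : ∀ {x y} → x ≉ 0# → y ≉ 0# → x * y ≉ 0#
  xy≉0 x≉0 y≉0 eq = y≉0 (xy≈0⇒y≈0 x≉0 eq)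

  -x≉0 : ∀ {x} → x ≉ 0# → - x ≉ 0#
  -x≉0 x≉0 eq = x≉0 (trans (sym (-‿involutive _)) (trans (-‿cong eq) -0#≈0#))

  x²≈y²⇒x≈±y : ∀ {x y} → x * x ≈ y * y → x ≈ y ⊎ x ≈ - y
  x²≈y²⇒x≈±y {x} {y} eq = [ (λ x-y≈0 → inj₁ (x-y≈0⇒x≈y x-y≈0)) , (λ x+y≈0 → inj₂ (+-inverseˡ-unique x y x+y≈0)) ]′
    (xy≈0 {x - y} {x + y} (trans
      (solve 2 (λ x y → (x :- y) :* (x :+ y) := x :* x :- y :* y) refl x y) (x≈y⇒x∙y⁻¹≈ε eq)))

  x²≈0⇒x≈0 : ∀ {x} → x * x ≈ 0# → x ≈ 0#
  x²≈0⇒x≈0 eq = [ (λ x → x) , (λ x → x) ]′ (xy≈0 eq)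

  ^-≉0 : ∀ {x} n → x ≉ 0# → x ^ n ≉ 0#
  ^-≉0 zero    x≉0 = 1≉0
  ^-≉0 (suc n) x≉0 = xy≉0 x≉0 (^-≉0 n x≉0)

  1^n≈1 : ∀ n → 1# ^ n ≈ 1#
  1^n≈1 zero    = refl
  1^n≈1 (suc n) = trans (*-identityˡ _) (1^n≈1 n)

  [-x]²≈x² : ∀ x → - x * - x ≈ x * x
  [-x]²≈x² = solve 1 (λ x → :- x :* :- x := x :* x) refl

  [-x]^odd≈-x^odd : ∀ x h → (- x) ^ (1 ℕ.+ 2 ℕ.* h) ≈ - (x ^ (1 ℕ.+ 2 ℕ.* h))
  [-x]^odd≈-x^odd x h = begin
    - x * (- x) ^ (2 ℕ.* h)     ≈⟨ *-congˡ (^-assocʳ (- x) 2 h) ⟨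
    - x * ((- x) ^ 2) ^ h       ≈⟨ *-congˡ (^-congˡ h (solve 1 (λ x → (:- x) :^ 2 := x :^ 2) refl x)) ⟩
    - x * (x ^ 2) ^ h           ≈⟨ *-congˡ (^-assocʳ x 2 h) ⟩
    - x * x ^ (2 ℕ.* h)         ≈⟨ -‿distribˡ-* x _ ⟨
    - (x * x ^ (2 ℕ.* h))       ∎

  -- The junk value at 0 makes inversion a permutation of the whole field.
  inv : Carrier → Carrier
  inv x with x ≈? 0#
  ... | yes _   = 0#
  ... | no  x≉0 = proj₁ (inverse x x≉0)

  inv-inverse : ∀ {x} → x ≉ 0# → x * inv x ≈ 1#
  inv-inverse {x} x≉0 with x ≈? 0#
  ... | yes x≈0 = contradiction x≈0 x≉0
  ... | no  x≉0 = proj₂ (inverse x x≉0)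

  inv-0 : ∀ {x} → x ≈ 0# → inv x ≈ 0#
  inv-0 {x} x≈0 with x ≈? 0#
  ... | yes _   = refl
  ... | no  x≉0 = contradiction x≈0 x≉0

  inv-unique : ∀ {x y} → x * y ≈ 1# → inv x ≈ y
  inv-unique {x} {y} xy≈1 with x ≈? 0#
  ... | yes x≈0 = contradiction (trans (sym xy≈1) (trans (*-congʳ x≈0) (zeroˡ y))) 1≉0
  ... | no  x≉0 = *-cancelˡ-≉0 x≉0 (trans (proj₂ (inverse x x≉0)) (sym xy≈1))

  inv-cong : ∀ {x y} → x ≈ y → inv x ≈ inv y
  inv-cong {x} {y} x≈y with y ≈? 0#
  ... | yes y≈0 = inv-0 (trans x≈y y≈0)
  ... | no  y≉0 = inv-unique (trans (*-congʳ x≈y) (proj₂ (inverse y y≉0)))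

  inv-≉0 : ∀ {x} → x ≉ 0# → inv x ≉ 0#
  inv-≉0 x≉0 eq = 1≉0 (trans (sym (inv-inverse x≉0)) (trans (*-congˡ eq) (zeroʳ _)))

  inv-involutive : ∀ x → inv (inv x) ≈ x
  inv-involutive x with x ≈? 0#
  ... | yes x≈0 = trans (inv-0 refl) (sym x≈0)
  ... | no  x≉0 = inv-unique (trans (*-comm _ _) (proj₂ (inverse x x≉0)))

  -- Translation by `x` permutes the field, so the sum of all elements does not change when `q · x`
  -- is added to it.
  order-annihilates : ∀ x → q · x ≈ 0#
  order-annihilates x = +-cancelˡ (total order +-commutativeMonoid (λ y → y)) _ _ (begin
    Σ (λ y → y) + q · x              ≈⟨ +-congˡ (sum-replicate q) ⟨
    Σ (λ y → y) + sum (replicate q x) ≈⟨ ∑-distrib-+ to (λ _ → x) ⟨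
    Σ (λ y → y + x)                  ≈⟨ total-permute order +-commutativeMonoid (λ y → y) (λ eq → eq)
                                          (_+ x) (_- x) +-congʳ +-congʳ
                                          (λ y → solve 2 (λ x y → y :- x :+ x := y) refl x y)
                                          (λ y → solve 2 (λ x y → y :+ x :- x := y) refl x y) ⟨
    Σ (λ y → y)                      ≈⟨ +-identityʳ _ ⟨
    Σ (λ y → y) + 0#                 ∎)
    where
    open Sum +-commutativeMonoid
    Σ = total order +-commutativeMonoid

  private
    -- With 0 replaced by 1, the product over the whole field is the product of the nonzero elements
    -- and can be cancelled.
    h : Carrier → Carrier
    h x with x ≈? 0#
    ... | yes _ = 1#
    ... | no  _ = x

    h-0 : ∀ {x} → x ≈ 0# → h x ≈ 1#
    h-0 {x} x≈0 with x ≈? 0#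
    ... | yes _   = refl
    ... | no  x≉0 = contradiction x≈0 x≉0

    h-≉0 : ∀ {x} → x ≉ 0# → h x ≈ x
    h-≉0 {x} x≉0 with x ≈? 0#
    ... | yes x≈0 = contradiction x≈0 x≉0
    ... | no  _   = refl

    h-cong : ∀ {x y} → x ≈ y → h x ≈ h y
    h-cong {x} {y} x≈y with y ≈? 0#
    ... | yes y≈0 = h-0 (trans x≈y y≈0)
    ... | no  y≉0 = trans (h-≉0 (y≉0 ∘ trans (sym x≈y))) x≈y

    nonzero-product : ∀ {n} (f : Fin n → Carrier) → Sum.sum *-commutativeMonoid (h ∘ f) ≉ 0#
    nonzero-product {zero}  f = 1≉0
    nonzero-product {suc n} f = xy≉0 (h≉0 (f zero)) (nonzero-product (f ∘ suc))
      where
      h≉0 : ∀ x → h x ≉ 0#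
      h≉0 x with x ≈? 0#
      ... | yes _   = 1≉0
      ... | no  x≉0 = x≉0

    constant-product : ∀ n x → Sum.sum *-commutativeMonoid (replicate n x) ≈ x ^ n
    constant-product zero    x = refl
    constant-product (suc n) x = *-congˡ (constant-product n x)

  q≢0 : q ≢ 0
  q≢0 q≡0 = Fin.¬Fin0 (≡.subst Fin q≡0 (from 0#))

  -- Lagrange's theorem for the multiplicative group: compare ∏ h(ax) with ∏ a·h(x), which
  -- differ only in the factor at x = 0.
  fermat : ∀ x → x ^ q ≈ x
  fermat a with a ≈? 0#
  ... | yes a≈0 = trans (^-congˡ q a≈0) (trans (0^q q q≢0) (sym a≈0))
    where
    0^q : ∀ q → q ≢ 0 → 0# ^ q ≈ 0#
    0^q zero    q≢0 = contradiction ≡.refl q≢0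
    0^q (suc _) _   = zeroˡ _
  ... | no  a≉0 = *-cancelˡ-≉0 (nonzero-product to) (begin
    W * a ^ q                ≈⟨ *-comm W _ ⟩
    a ^ q * W                ≈⟨ *-congʳ (constant-product q a) ⟨
    ∏ (replicate q a) * W    ≈⟨ Sum.∑-distrib-+ *-commutativeMonoid (λ _ → a) (h ∘ to) ⟨
    ∏ (λ i → a * h (to i))   ≈⟨ compare ⟨
    a * total order *-commutativeMonoid (h ∘ (a *_)) ≈⟨ *-congˡ permuted ⟨
    a * W                    ≈⟨ *-comm a W ⟩
    W * a                    ∎)
    where
    ∏ : ∀ {n} → (Fin n → Carrier) → Carrier
    ∏ = Sum.sum *-commutativeMonoid
    W = ∏ (h ∘ to)
    a⁻¹ = proj₁ (inverse a a≉0)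
    aa⁻¹ = proj₂ (inverse a a≉0)
    permuted = total-permute order *-commutativeMonoid h h-cong (a *_) (a⁻¹ *_) *-congˡ *-congˡ
      (λ x → trans (sym (*-assoc _ _ _)) (trans (*-congʳ aa⁻¹) (*-identityˡ x)))
      (λ x → trans (sym (*-assoc _ _ _)) (trans (*-congʳ (trans (*-comm _ _) aa⁻¹)) (*-identityˡ x)))
    remove-0 : ∀ {n} (f : Fin n → Carrier) (i₀ : Fin n) → f i₀ ≈ 0# → (∀ i → i ≢ i₀ → f i ≉ 0#) →
               a * ∏ (λ i → h (a * f i)) ≈ ∏ (λ i → a * h (f i))
    remove-0 {suc n} f i₀ f≈0 f≉0 = begin
      a * ∏ (λ i → h (a * f i))
        ≈⟨ *-congˡ (Sum.sum-remove *-commutativeMonoid {i = i₀} (λ i → h (a * f i))) ⟩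
      a * (h (a * f i₀) * ∏ (removeAt (λ i → h (a * f i)) i₀))
        ≈⟨ *-congˡ (*-cong (trans (h-0 (trans (*-congˡ f≈0) (zeroʳ a))) (sym (h-0 f≈0)))
             (Sum.sum-cong-≋ *-commutativeMonoid {n} (λ i → let f≉0′ = f≉0 _ (Fin.punchInᵢ≢i i₀ i) in
               trans (h-≉0 (xy≉0 a≉0 f≉0′)) (*-congˡ (sym (h-≉0 f≉0′)))))) ⟩
      a * (h (f i₀) * ∏ (removeAt (λ i → a * h (f i)) i₀))
        ≈⟨ *-assoc _ _ _ ⟨
      a * h (f i₀) * ∏ (removeAt (λ i → a * h (f i)) i₀)
        ≈⟨ Sum.sum-remove *-commutativeMonoid {i = i₀} (λ i → a * h (f i)) ⟨
      ∏ (λ i → a * h (f i)) ∎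
    compare = remove-0 to (from 0#) (inverseˡ ≡.refl) (λ i i≢ eq → i≢ (≡.sym (inverseʳ (sym eq))))

  fermat^ : ∀ k x → x ^ (q ℕ.^ k) ≈ x
  fermat^ zero    x = *-identityʳ x
  fermat^ (suc k) x = trans (sym (^-assocʳ x q (q ℕ.^ k))) (trans (^-congˡ (q ℕ.^ k) (fermat x)) (fermat^ k x))

  square? : ∀ x → Dec (∃ λ z → z * z ≈ x)
  square? x = map′ (λ (i , eq) → to i , eq) (λ (z , eq) → from z , trans (*-cong (inverseˡ ≡.refl) (inverseˡ ≡.refl)) eq)
    (any? (λ i → (to i * to i) ≈? x))

  -- An order taken from the enumeration, unrelated to the field operations; it serves to choose one
  -- of `x` and `- x`, or one of `x` and `inv x`.
  rank : Carrier → ℕ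
  rank x = toℕ (from x)

  rank-cong : ∀ {x y} → x ≈ y → rank x ≡ rank y
  rank-cong eq = ≡.cong toℕ (from-cong eq)

  rank-injective : ∀ {x y} → rank x ≡ rank y → x ≈ y
  rank-injective eq = trans (sym (inverseˡ ≡.refl)) (inverseˡ (Fin.toℕ-injective eq))

  nonsquare-≈ : ∀ {a b} → a ≈ b → Nonsquare R a → Nonsquare R b
  nonsquare-≈ a≈b a-nonsquare (z , eq) = a-nonsquare (z , trans eq (sym a≈b))

  nonsquare-≉0 : ∀ {a} → Nonsquare R a → a ≉ 0#
  nonsquare-≉0 a-nonsquare a≈0 = a-nonsquare (0# , trans (zeroˡ 0#) (sym a≈0))

  square-ratio : ∀ {a x y} → y ≉ 0# → x * x ≈ a * (y * y) → ∃ λ z → z * z ≈ a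
  square-ratio {a} {x} {y} y≉0 eq = x * inv y , (begin
    x * inv y * (x * inv y)       ≈⟨ solve 2 (λ x z → x :* z :* (x :* z) := x :* x :* (z :* z)) refl x (inv y) ⟩
    x * x * (inv y * inv y)       ≈⟨ *-congʳ eq ⟩
    a * (y * y) * (inv y * inv y) ≈⟨ solve 3 (λ a y z → a :* (y :* y) :* (z :* z) := a :* ((y :* z) :* (y :* z))) refl a y (inv y) ⟩
    a * (y * inv y * (y * inv y)) ≈⟨ *-congˡ (*-cong (inv-inverse y≉0) (inv-inverse y≉0)) ⟩
    a * (1# * 1#)                 ≈⟨ solve 1 (λ a → a :* (con (+ 1) :* con (+ 1)) := a) refl a ⟩
    a                             ∎)

  -- x ↦ x² on one member of each pair {x, −x} and x ↦ ax² on the other is injective.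
  square⊎a*square : ∀ {a} → Nonsquare R a → ∀ y → (∃ λ z → z * z ≈ y) ⊎ (∃ λ z → a * (z * z) ≈ y)
  square⊎a*square {a} a-nonsquare y = let x , eq = injective⇒surjective order order Φ Φ-injective y in split x eq
    where
    leading : ∀ x → Dec (rank x ℕ.≤ rank (- x))
    leading x = rank x ℕ.≤? rank (- x)
    Φ : Carrier → Carrier
    Φ x with leading x
    ... | yes _ = x * x
    ... | no  _ = a * (x * x)
    split : ∀ x → Φ x ≈ y → (∃ λ z → z * z ≈ y) ⊎ (∃ λ z → a * (z * z) ≈ y)
    split x eq with leading x
    ... | yes _ = inj₁ (x , eq)
    ... | no  _ = inj₂ (x , eq)
    swap : ∀ {x y} → x ≈ - y → rank x ℕ.≤ rank (- x) → rank (- y) ℕ.≤ rank y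
    swap {x} {y} x≈-y = ≡.subst₂ ℕ._≤_ (rank-cong x≈-y) (rank-cong (trans (-‿cong x≈-y) (-‿involutive y)))
    swap′ : ∀ {x y} → x ≈ - y → rank (- x) ℕ.≤ rank x → rank y ℕ.≤ rank (- y)
    swap′ {x} {y} x≈-y = ≡.subst₂ ℕ._≤_ (rank-cong (trans (-‿cong x≈-y) (-‿involutive y))) (rank-cong x≈-y)
    mixed : ∀ x y → ¬ rank y ℕ.≤ rank (- y) → x * x ≈ a * (y * y) → x ≈ y
    mixed x y y≰ eq with y ≈? 0#
    ... | yes y≈0 = contradiction (ℕ.≤-reflexive (rank-cong (trans y≈0 (trans (sym -0#≈0#) (-‿cong (sym y≈0)))))) y≰
    ... | no  y≉0 = contradiction (square-ratio y≉0 eq) a-nonsquare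
    Φ-injective : ∀ {x y} → Φ x ≈ Φ y → x ≈ y
    Φ-injective {x} {y} eq with leading x | leading y
    ... | yes x≤ | yes y≤ = [ (λ x≈y → x≈y) , (λ x≈-y → trans x≈-y (sym (rank-injective (ℕ.≤-antisym y≤ (swap x≈-y x≤))))) ]′
                              (x²≈y²⇒x≈±y eq)
    ... | no x≰  | no y≰  = [ (λ x≈y → x≈y) , (λ x≈-y → contradiction (swap′ x≈-y (ℕ.<⇒≤ (ℕ.≰⇒> x≰))) y≰) ]′
                              (x²≈y²⇒x≈±y (*-cancelˡ-≉0 (nonsquare-≉0 a-nonsquare) eq))
    ... | yes _  | no y≰  = mixed x y y≰ eq
    ... | no x≰  | yes _  = sym (mixed y x x≰ (sym eq))

  -- The dichotomy for `a` writes the nonsquare `b` as az², and then ab = (az)².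
  nonsquare*nonsquare : ∀ {a b} → Nonsquare R a → Nonsquare R b → ∃ λ z → z * z ≈ a * b
  nonsquare*nonsquare {a} {b} a-nonsquare b-nonsquare with square⊎a*square a-nonsquare b
  ... | inj₁ b-square = contradiction b-square b-nonsquare
  ... | inj₂ (z , eq) = a * z , trans
    (solve 2 (λ a z → a :* z :* (a :* z) := a :* (a :* (z :* z))) refl a z) (*-congˡ eq)

  -- For `v` nonzero the equation would exhibit -a as (u/v)².
  nonsquare-anisotropic : ∀ {a u v} → Nonsquare R (- a) → u * u + a * (v * v) ≈ 0# → u ≈ 0# × v ≈ 0#
  nonsquare-anisotropic {a} {u} {v} -a-nonsquare eq with v ≈? 0#
  ... | yes v≈0 = x²≈0⇒x≈0 (trans (solve 2 (λ w z → w := w :+ z :* con (+ 0)) refl (u * u) a)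
                    (trans (+-congˡ (*-congˡ (sym (trans (*-congʳ v≈0) (zeroˡ v))))) eq)) , v≈0
  ... | no  v≉0 = contradiction (square-ratio v≉0 (trans (+-inverseˡ-unique _ _ eq) (-‿distribˡ-* a _))) -a-nonsquare

  -- Counting nonzero squares: they are half of the nonzero elements, and inversion
  -- pairs them off except for its only fixed point 1.
  -1-nonsquare⇒q≡3[4] : Nonsquare R (- 1#) → q ≡ 3 [mod4]
  -1-nonsquare⇒q≡3[4] -1-nonsquare = total-ψ , ≡.trans halving (≡.trans (≡.cong (λ s → 1 ℕ.+ (s ℕ.+ s)) inversion)
    (1+2[1+2t]≡3+4t total-ψ))
    where
    open Sum ℕ.+-0-commutativeMonoid
    Σ : (Carrier → ℕ) → ℕ
    Σ = total order ℕ.+-0-commutativeMonoid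
    split : ∀ e f (π : Carrier → Carrier) → Σ (λ x → e x ℕ.+ (f x ℕ.+ f (π x))) ≡ Σ e ℕ.+ (Σ f ℕ.+ Σ (f ∘ π))
    split e f π = ≡.trans (∑-distrib-+ (e ∘ to) _) (≡.cong (Σ e ℕ.+_) (∑-distrib-+ (f ∘ to) (f ∘ π ∘ to)))

    [x≈_] : Carrier → Carrier → ℕ
    [x≈ a ] x = indicator (x ≈? a)
    total-[x≈a] : ∀ a → 1 ≡ Σ [x≈ a ]
    total-[x≈a] a = ≡.sym (count-unique (λ i → to i ≈? a)
      (size-1 (≡.setoid _) (from a) (inverseˡ ≡.refl) (λ i eq → inverseʳ (sym eq))))

    S : Carrier → Set _
    S x = x ≉ 0# × (∃ λ z → z * z ≈ x)
    S? : ∀ x → Dec (S x)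
    S? x = ¬? (x ≈? 0#) ×-dec square? x
    S-≈ : ∀ {x y} → x ≈ y → S x → S y
    S-≈ x≈y (x≉0 , z , eq) = x≉0 ∘ trans x≈y , z , trans eq x≈y
    χ : Carrier → ℕ
    χ x = indicator (S? x)
    χ-cong : ∀ {x y} → x ≈ y → χ x ≡ χ y
    χ-cong {x} {y} x≈y with S? x
    ... | yes Sx = ≡.sym (indicator-yes (S? y) (S-≈ x≈y Sx))
    ... | no ¬Sx = ≡.sym (indicator-no (S? y) (¬Sx ∘ S-≈ (sym x≈y)))

    halves : ∀ x → 1 ≡ [x≈ 0# ] x ℕ.+ (χ x ℕ.+ χ (- x))
    halves x = cases (x ≈? 0#) (square⊎a*square -1-nonsquare x)
      where
      root≉0 : ∀ {y z} → y ≉ 0# → z * z ≈ y → z ≉ 0#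
      root≉0 y≉0 z²≈y z≈0 = y≉0 (trans (sym z²≈y) (trans (*-congʳ z≈0) (zeroˡ _)))
      cases : Dec (x ≈ 0#) → (∃ λ z → z * z ≈ x) ⊎ (∃ λ z → - 1# * (z * z) ≈ x) →
              1 ≡ [x≈ 0# ] x ℕ.+ (χ x ℕ.+ χ (- x))
      cases (yes x≈0) _ = ≡.sym (≡.cong₂ ℕ._+_ (indicator-yes (x ≈? 0#) x≈0)
        (≡.cong₂ ℕ._+_ (indicator-no (S? x) (λ Sx → proj₁ Sx x≈0))
                       (indicator-no (S? (- x)) (λ S-x → proj₁ S-x (trans (-‿cong x≈0) -0#≈0#)))))
      cases (no x≉0) (inj₁ (z , z²≈x)) = ≡.sym (≡.cong₂ ℕ._+_ (indicator-no (x ≈? 0#) x≉0)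
        (≡.cong₂ ℕ._+_ (indicator-yes (S? x) (x≉0 , z , z²≈x))
                       (indicator-no (S? (- x)) λ (_ , w , w²≈-x) → -1-nonsquare (square-ratio (root≉0 x≉0 z²≈x)
                         (trans w²≈-x (trans (-‿cong (sym z²≈x)) (sym (-1*x≈-x _))))))))
      cases (no x≉0) (inj₂ (z , -z²≈x)) = ≡.sym (≡.cong₂ ℕ._+_ (indicator-no (x ≈? 0#) x≉0)
        (≡.cong₂ ℕ._+_ (indicator-no (S? x) λ (_ , w , w²≈x) → -1-nonsquare
                         (square-ratio (root≉0 (-x≉0 x≉0) z²≈-x) (trans w²≈x (sym -z²≈x))))
                       (indicator-yes (S? (- x)) (-x≉0 x≉0 , z , z²≈-x))))
        where z²≈-x = trans (sym (-‿involutive _)) (-‿cong (trans (sym (-1*x≈-x _)) -z²≈x))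

    T : Carrier → Set _
    T x = S x × rank x ℕ.< rank (inv x)
    T? : ∀ x → Dec (T x)
    T? x = S? x ×-dec (rank x ℕ.<? rank (inv x))
    T-≈ : ∀ {x y} → x ≈ y → T x → T y
    T-≈ x≈y (Sx , <) = S-≈ x≈y Sx , ≡.subst₂ ℕ._<_ (rank-cong x≈y) (rank-cong (inv-cong x≈y)) <
    ψ : Carrier → ℕ
    ψ x = indicator (T? x)
    ψ-cong : ∀ {x y} → x ≈ y → ψ x ≡ ψ y
    ψ-cong {x} {y} x≈y with T? x
    ... | yes Tx = ≡.sym (indicator-yes (T? y) (T-≈ x≈y Tx))
    ... | no ¬Tx = ≡.sym (indicator-no (T? y) (¬Tx ∘ T-≈ (sym x≈y)))
    total-ψ = Σ ψ

    S-inv : ∀ {x} → S x → S (inv x)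
    S-inv {x} (x≉0 , z , z²≈x) = inv-≉0 x≉0 , inv z , sym (inv-unique (begin
      x * (inv z * inv z)           ≈⟨ *-congʳ z²≈x ⟨
      z * z * (inv z * inv z)       ≈⟨ solve 2 (λ z y → z :* z :* (y :* y) := z :* y :* (z :* y)) refl z (inv z) ⟩
      z * inv z * (z * inv z)       ≈⟨ *-cong (inv-inverse z≉0) (inv-inverse z≉0) ⟩
      1# * 1#                       ≈⟨ *-identityˡ 1# ⟩
      1#                            ∎))
      where
      z≉0 : z ≉ 0#
      z≉0 z≈0 = x≉0 (trans (sym z²≈x) (trans (*-congʳ z≈0) (zeroˡ z)))

    pairs : ∀ x → χ x ≡ [x≈ 1# ] x ℕ.+ (ψ x ℕ.+ ψ (inv x))
    pairs x = cases (S? x)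
      where
      T-inv⇒ : T (inv x) → rank (inv x) ℕ.< rank x
      T-inv⇒ (_ , <) = ≡.subst (rank (inv x) ℕ.<_) (rank-cong (inv-involutive x)) <
      x≈1⇒ : x ≈ 1# → rank x ≡ rank (inv x)
      x≈1⇒ x≈1 = rank-cong (sym (inv-unique (trans (*-cong x≈1 x≈1) (*-identityˡ 1#))))
      ordered : S x → Tri (rank x ℕ.< rank (inv x)) (rank x ≡ rank (inv x)) (rank x ℕ.> rank (inv x)) →
                1 ≡ [x≈ 1# ] x ℕ.+ (ψ x ℕ.+ ψ (inv x))
      ordered Sx (tri< < ≢ ≯) = ≡.sym (≡.cong₂ ℕ._+_ (indicator-no (x ≈? 1#) (≢ ∘ x≈1⇒))
        (≡.cong₂ ℕ._+_ (indicator-yes (T? x) (Sx , <)) (indicator-no (T? (inv x)) (≯ ∘ T-inv⇒))))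
      ordered Sx (tri≈ ≮ eq ≯) = ≡.sym (≡.cong₂ ℕ._+_ (indicator-yes (x ≈? 1#) x≈1)
        (≡.cong₂ ℕ._+_ (indicator-no (T? x) (≮ ∘ proj₂)) (indicator-no (T? (inv x)) (≯ ∘ T-inv⇒))))
        where
        -- Equal ranks mean `x` is its own inverse, so x² = 1; the root -1 is excluded because `x`
        -- is a square.
        x≈1 : x ≈ 1#
        x≈1 = [ (λ x≈1 → x≈1) , (λ x≈-1 → contradiction (proj₁ (proj₂ Sx) , trans (proj₂ (proj₂ Sx)) x≈-1) -1-nonsquare) ]′
          (x²≈y²⇒x≈±y (trans (trans (*-congˡ (rank-injective eq)) (inv-inverse (proj₁ Sx))) (sym (*-identityˡ 1#))))
      ordered Sx (tri> ≮ ≢ >) = ≡.sym (≡.cong₂ ℕ._+_ (indicator-no (x ≈? 1#) (≢ ∘ x≈1⇒))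
        (≡.cong₂ ℕ._+_ (indicator-no (T? x) (≮ ∘ proj₂)) (indicator-yes (T? (inv x))
          (S-inv Sx , ≡.subst (rank (inv x) ℕ.<_) (rank-cong (sym (inv-involutive x))) >))))
      cases : Dec (S x) → χ x ≡ [x≈ 1# ] x ℕ.+ (ψ x ℕ.+ ψ (inv x))
      cases (no ¬Sx) = ≡.trans (indicator-no (S? x) ¬Sx) (≡.sym (≡.cong₂ ℕ._+_
        (indicator-no (x ≈? 1#) (λ x≈1 → ¬Sx ((λ x≈0 → 1≉0 (trans (sym x≈1) x≈0)) , 1# , trans (*-identityˡ 1#) (sym x≈1))))
        (≡.cong₂ ℕ._+_ (indicator-no (T? x) (¬Sx ∘ proj₁))
                       (indicator-no (T? (inv x)) (λ T → ¬Sx (S-≈ (inv-involutive x) (S-inv (proj₁ T))))))))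
      cases (yes Sx) = ≡.trans (indicator-yes (S? x) Sx) (ordered Sx (ℕ.<-cmp (rank x) (rank (inv x))))

    halving : q ≡ 1 ℕ.+ (Σ χ ℕ.+ Σ χ)
    halving = ≡.trans (≡.trans (≡.sym (ℕ.*-identityʳ q)) (≡.sym (sumℕ-const {q} (λ _ → 1) (λ _ → ≡.refl))))
      (≡.trans (sum-cong-≗ (halves ∘ to)) (≡.trans (split [x≈ 0# ] χ (λ x → - x))
        (≡.cong₂ ℕ._+_ (≡.sym (total-[x≈a] 0#)) (≡.cong (Σ χ ℕ.+_)
          (≡.sym (total-permute order ℕ.+-0-commutativeMonoid χ χ-cong (λ x → - x) (λ x → - x) -‿cong -‿cong -‿involutive -‿involutive))))))

    inversion : Σ χ ≡ 1 ℕ.+ (total-ψ ℕ.+ total-ψ)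
    inversion = ≡.trans (sum-cong-≗ (pairs ∘ to)) (≡.trans (split [x≈ 1# ] ψ inv)
      (≡.cong₂ ℕ._+_ (≡.sym (total-[x≈a] 1#)) (≡.cong (Σ ψ ℕ.+_)
        (≡.sym (total-permute order ℕ.+-0-commutativeMonoid ψ ψ-cong inv inv inv-cong inv-cong inv-involutive inv-involutive)))))

  module _ {i} (i²≈-1 : i * i ≈ - 1#) where
    i^[1+4t]≈i : ∀ t → i ^ (1 ℕ.+ 4 ℕ.* t) ≈ i
    i^[1+4t]≈i t = begin
      i * i ^ (4 ℕ.* t)     ≈⟨ *-congˡ (^-assocʳ i 4 t) ⟨
      i * (i ^ 4) ^ t       ≈⟨ *-congˡ (^-congˡ t i⁴≈1) ⟩
      i * 1# ^ t            ≈⟨ *-congˡ (1^n≈1 t) ⟩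
      i * 1#                ≈⟨ *-identityʳ i ⟩
      i                     ∎
      where
      i⁴≈1 : i ^ 4 ≈ 1#
      i⁴≈1 = begin
        i ^ 4                ≈⟨ solve 1 (λ i → i :^ 4 := i :* i :* (i :* i)) refl i ⟩
        i * i * (i * i)      ≈⟨ *-cong i²≈-1 i²≈-1 ⟩
        - 1# * - 1#          ≈⟨ [-x]²≈x² 1# ⟩
        1# * 1#              ≈⟨ *-identityˡ 1# ⟩
        1#                   ∎

    i^[3+4t]≈-i : ∀ t → i ^ (3 ℕ.+ 4 ℕ.* t) ≈ - i
    i^[3+4t]≈-i t = begin
      i * (i * i ^ (1 ℕ.+ 4 ℕ.* t))   ≈⟨ *-assoc i i _ ⟨
      i * i * i ^ (1 ℕ.+ 4 ℕ.* t)     ≈⟨ *-cong i²≈-1 (i^[1+4t]≈i t) ⟩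
      - 1# * i                        ≈⟨ -1*x≈-x i ⟩
      - i                             ∎

  -- A square root `i` of -1 would satisfy i^q = i by Fermat, but i^(3+4t) = -i.
  q≡3[4]⇒-1-nonsquare : q ≡ 3 [mod4] → 1# + 1# ≉ 0# → Nonsquare R (- 1#)
  q≡3[4]⇒-1-nonsquare (t , eq) 2≉0 (i , i²≈-1) = 2≉0 (xy≈0⇒y≈0 i≉0 (begin
    i * (1# + 1#)            ≈⟨ solve 1 (λ i → i :* (con (+ 1) :+ con (+ 1)) := i :- (:- i)) refl i ⟩
    i - - i                  ≈⟨ +-congˡ (-‿cong (trans (sym (i^[3+4t]≈-i i²≈-1 t))
        (trans (reflexive (≡.cong (i ^_) (≡.sym eq))) (fermat i)))) ⟩
    i - i                    ≈⟨ -‿inverseʳ i ⟩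
    0#                       ∎))
    where
    i≉0 : i ≉ 0#
    i≉0 i≈0 = -x≉0 1≉0 (trans (sym i²≈-1) (trans (*-congʳ i≈0) (zeroˡ i)))

-- Odd characteristic: the Frobenius map and its odd iterates.

module PrimePowerField (R : CommutativeRing c ℓ) {q : ℕ} (R-field : IsFieldOfOrder R q)
                       {p N : ℕ} (p-prime : Prime p) (p≢2 : p ≢ 2) (q≡p^N : q ≡ p ℕ.^ N) where
  open FiniteField R R-field public
  open import Relation.Binary.Reasoning.Setoid setoid

  -- The order p^N annihilates 1, and `(p ^ N) · 1#` is the N-th power of `p · 1#`; a field has no
  -- nonzero nilpotents.
  p·1≈0 : p · 1# ≈ 0#
  p·1≈0 with (p · 1#) ≈? 0#
  ... | yes eq = eq
  ... | no  p·1≉0 = contradiction (trans (sym (power N)) (trans (reflexive (≡.cong (_· 1#) (≡.sym q≡p^N))) (order-annihilates 1#)))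
                      (^-≉0 N p·1≉0)
    where
    power : ∀ N → (p ℕ.^ N) · 1# ≈ (p · 1#) ^ N
    power zero    = +-identityʳ 1#
    power (suc N) = trans (×1-homo-* p (p ℕ.^ N)) (*-congˡ (power N))

  p∣n⇒n·x≈0 : ∀ {n} x → p ∣ n → n · x ≈ 0#
  p∣n⇒n·x≈0 x (divides k ≡.refl) = begin
    (k ℕ.* p) · x             ≈⟨ ×-congʳ (k ℕ.* p) (*-identityˡ x) ⟨
    (k ℕ.* p) · (1# * x)      ≈⟨ ×-assoc-* (k ℕ.* p) 1# x ⟨
    (k ℕ.* p) · 1# * x        ≈⟨ *-congʳ (×1-homo-* k p) ⟩
    k · 1# * p · 1# * x       ≈⟨ *-congʳ (trans (*-congˡ p·1≈0) (zeroʳ _)) ⟩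
    0# * x                    ≈⟨ zeroˡ x ⟩
    0#                        ∎

  -- Since p = 1 + 2h, the equation 2 = 0 would turn p · 1 = 0 into 1 = 0.
  2≉0 : 1# + 1# ≉ 0#
  2≉0 1+1≈0 = let h , p≡1+2h = odd-prime p-prime p≢2 in 1≉0 (begin
    1#                                ≈⟨ +-identityʳ 1# ⟨
    1# + 0#                           ≈⟨ +-congˡ (zeroˡ _) ⟨
    1# + 0# * (h · 1#)                ≈⟨ +-congˡ (*-congʳ (trans (+-congˡ (+-identityʳ 1#)) 1+1≈0)) ⟨
    1# + (2 · 1#) * (h · 1#)          ≈⟨ +-congˡ (×1-homo-* 2 h) ⟨
    (1 ℕ.+ 2 ℕ.* h) · 1#              ≡⟨ ≡.cong (_· 1#) (≡.sym p≡1+2h) ⟩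
    p · 1#                            ≈⟨ p·1≈0 ⟩
    0#                                ∎)

  x+x≈0⇒x≈0 : ∀ {x} → x + x ≈ 0# → x ≈ 0#
  x+x≈0⇒x≈0 {x} eq = xy≈0⇒y≈0 2≉0 (trans (solve 1 (λ x → (con (+ 1) :+ con (+ 1)) :* x := x :+ x) refl x) eq)

  x≈-x⇒x≈0 : ∀ {x} → x ≈ - x → x ≈ 0#
  x≈-x⇒x≈0 {x} eq = x+x≈0⇒x≈0 (trans (+-congˡ eq) (-‿inverseʳ x))

  freshman : ∀ x y → (x + y) ^ p ≈ x ^ p + y ^ p
  freshman x y = trans (Binomial.theorem commutativeSemiring p x y) (expansion p ≡.refl)
    where
    open Sum +-commutativeMonoid
    open Binomial commutativeSemiring using (binomialTerm)
    -- The exponent is generalised to an `m` equal to `p` so that it can be matched as `suc m`,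
    -- which lets the first and last terms be split off.
    expansion : ∀ m → m ≡ p → sum (binomialTerm x y m) ≈ x ^ m + y ^ m
    expansion zero    eq = contradiction eq (≡.≢-sym (ℕ.≢-nonZero⁻¹ p {{prime⇒nonZero p-prime}}))
    expansion (suc m) eq = begin
      first + sum (tail t)                ≈⟨ +-congˡ (sum-init-last (tail t)) ⟩
      first + (sum (init (tail t)) + last (tail t))
        ≈⟨ +-cong first≈ (+-cong (trans (sum-cong-≋ {m} middle≈0) (sum-replicate-zero m)) last≈) ⟩
      y ^ suc m + (0# + x ^ suc m)        ≈⟨ solve 2 (λ x y → y :+ (con (+ 0) :+ x) := x :+ y) refl (x ^ suc m) (y ^ suc m) ⟩
      x ^ suc m + y ^ suc m               ∎
      where
      t = binomialTerm x y (suc m)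
      first = t zero
      first≈ : first ≈ y ^ suc m
      first≈ = trans (+-identityʳ _) (*-identityˡ _)
      last≈ : last (tail t) ≈ x ^ suc m
      last≈ = begin
        t (fromℕ (suc m))
          ≡⟨ ≡.cong (λ k → (suc m C k) · (x ^ k * y ^ (suc m ∸ k))) (toℕ-fromℕ (suc m)) ⟩
        (suc m C suc m) · (x ^ suc m * y ^ (suc m ∸ suc m))
          ≡⟨ ≡.cong₂ (λ c k → c · (x ^ suc m * y ^ k)) (nCn≡1 (suc m)) (ℕ.n∸n≡0 m) ⟩
        1 · (x ^ suc m * 1#)  ≈⟨ trans (+-identityʳ _) (*-identityʳ _) ⟩
        x ^ suc m             ∎
      middle≈0 : ∀ i → init (tail t) i ≈ 0#
      middle≈0 i = p∣n⇒n·x≈0 _ (≡.subst (λ m → p ∣ m C suc (toℕ (inject₁ i))) (≡.sym eq)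
        (prime∣nCk p-prime (suc (toℕ (inject₁ i))) (ℕ.s≤s ℕ.z≤n)
          (≡.subst₂ ℕ._<_ (≡.cong suc (≡.sym (toℕ-inject₁ i))) eq (ℕ.s≤s (toℕ<n i)))))

  frobenius-+ : ∀ k x y → (x + y) ^ (p ℕ.^ k) ≈ x ^ (p ℕ.^ k) + y ^ (p ℕ.^ k)
  frobenius-+ zero    x y = solve 2 (λ x y → (x :+ y) :^ 1 := x :^ 1 :+ y :^ 1) refl x y
  frobenius-+ (suc k) x y = begin
    (x + y) ^ (p ℕ.* p ℕ.^ k)                      ≈⟨ ^-assocʳ (x + y) p (p ℕ.^ k) ⟨
    ((x + y) ^ p) ^ (p ℕ.^ k)                      ≈⟨ ^-congˡ (p ℕ.^ k) (freshman x y) ⟩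
    (x ^ p + y ^ p) ^ (p ℕ.^ k)                    ≈⟨ frobenius-+ k (x ^ p) (y ^ p) ⟩
    (x ^ p) ^ (p ℕ.^ k) + (y ^ p) ^ (p ℕ.^ k)      ≈⟨ +-cong (^-assocʳ x p (p ℕ.^ k)) (^-assocʳ y p (p ℕ.^ k)) ⟩
    x ^ (p ℕ.* p ℕ.^ k) + y ^ (p ℕ.* p ℕ.^ k)      ∎

  p^k-odd : ∀ k → Odd (p ℕ.^ k)
  p^k-odd k = odd-^ k (odd-prime p-prime p≢2)

  frobenius-neg : ∀ k x → (- x) ^ (p ℕ.^ k) ≈ - (x ^ (p ℕ.^ k))
  frobenius-neg k x = let v , eq = p^k-odd k in
    ≡.subst (λ P → (- x) ^ P ≈ - (x ^ P)) (≡.sym eq) ([-x]^odd≈-x^odd x v)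

  0^p^k≈0 : ∀ k {x} → x ≈ 0# → x ^ (p ℕ.^ k) ≈ 0#
  0^p^k≈0 k {x} x≈0 = let v , eq = p^k-odd k in
    ≡.subst (λ P → x ^ P ≈ 0#) (≡.sym eq) (trans (*-congʳ x≈0) (zeroˡ _))

  -- Some odd iterate of x ↦ x^(pᵏ) is the identity. An explicit witness `h` is kept because the
  -- exponent in `norm-root` is computed from it.
  OddPeriod : ℕ → Set _
  OddPeriod k = ∃ λ h → ∀ x → x ^ ((p ℕ.^ k) ℕ.^ (1 ℕ.+ 2 ℕ.* h)) ≈ x

  -- Each application of x ↦ x^P changes the sign of `x`; the induction removes two applications at
  -- a time, whose signs cancel.
  anti-fixed-^odd : ∀ P {x} → (- x) ^ P ≈ - (x ^ P) → x ^ P ≈ - x → ∀ h → x ^ (P ℕ.^ (1 ℕ.+ 2 ℕ.* h)) ≈ - x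
  anti-fixed-^odd P {x} neg x^P≈-x zero    = trans (≡.subst (λ e → x ^ e ≈ x ^ P) (≡.sym (ℕ.*-identityʳ P)) refl) x^P≈-x
  anti-fixed-^odd P {x} neg x^P≈-x (suc h) = begin
    x ^ (P ℕ.^ (1 ℕ.+ 2 ℕ.* suc h))         ≡⟨ ≡.cong (λ e → x ^ (P ℕ.^ e)) (≡.cong suc (≡.cong suc (ℕ.+-suc h (h ℕ.+ 0)))) ⟩
    x ^ (P ℕ.* (P ℕ.* X))                   ≈⟨ ^-assocʳ x P (P ℕ.* X) ⟨
    (x ^ P) ^ (P ℕ.* X)                     ≈⟨ ^-assocʳ (x ^ P) P X ⟨
    ((x ^ P) ^ P) ^ X                       ≈⟨ ^-congˡ X (trans (^-congˡ P x^P≈-x) (trans neg (trans (-‿cong x^P≈-x) (-‿involutive x)))) ⟩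
    x ^ X                                   ≈⟨ anti-fixed-^odd P neg x^P≈-x h ⟩
    - x                                     ∎
    where X = P ℕ.^ (1 ℕ.+ 2 ℕ.* h)

  anti-fixed⇒0 : ∀ k → OddPeriod k → ∀ {x} → x ^ (p ℕ.^ k) ≈ - x → x ≈ 0#
  anti-fixed⇒0 k (h , period) {x} eq =
    x≈-x⇒x≈0 (trans (sym (period x)) (anti-fixed-^odd (p ℕ.^ k) (frobenius-neg k x) eq h))

  -- The exponent is (Pʲ + 1)/(P + 1), where P = pᵏ and x^Pʲ = x.
  norm-root : ∀ k → OddPeriod k → ∃ λ w → ∀ u → (u ^ (1 ℕ.+ 2 ℕ.* w)) ^ (p ℕ.^ k ℕ.+ 1) ≈ u * u
  norm-root k (h , period) = let w , eq = P+1∣P^odd+1 (p^k-odd k) h in w , λ u → begin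
    (u ^ (1 ℕ.+ 2 ℕ.* w)) ^ (p ℕ.^ k ℕ.+ 1)                ≈⟨ ^-assocʳ u (1 ℕ.+ 2 ℕ.* w) (p ℕ.^ k ℕ.+ 1) ⟩
    u ^ ((1 ℕ.+ 2 ℕ.* w) ℕ.* (p ℕ.^ k ℕ.+ 1))              ≡⟨ ≡.cong (u ^_) eq ⟩
    u ^ ((p ℕ.^ k) ℕ.^ (1 ℕ.+ 2 ℕ.* h) ℕ.+ 1)              ≈⟨ ^-homo-* u ((p ℕ.^ k) ℕ.^ (1 ℕ.+ 2 ℕ.* h)) 1 ⟩
    u ^ ((p ℕ.^ k) ℕ.^ (1 ℕ.+ 2 ℕ.* h)) * u ^ 1            ≈⟨ *-cong (period u) (*-identityʳ u) ⟩
    u * u                                                  ∎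

  -- Equal squares leave only u = -v to exclude, and an odd power would preserve that sign, so it
  -- gives equality only at 0.
  ^odd-injective : ∀ w {u v} → u * u ≈ v * v → u ^ (1 ℕ.+ 2 ℕ.* w) ≈ v ^ (1 ℕ.+ 2 ℕ.* w) → u ≈ v
  ^odd-injective w {u} {v} u²≈v² eq = [ (λ u≈v → u≈v) , (λ u≈-v → trans u≈-v (-v≈v u≈-v)) ]′ (x²≈y²⇒x≈±y u²≈v²)
    where
    -v≈v : u ≈ - v → - v ≈ v
    -v≈v u≈-v with v ≈? 0#
    ... | yes v≈0 = trans (-‿cong v≈0) (trans -0#≈0# (sym v≈0))
    ... | no  v≉0 = contradiction (x≈-x⇒x≈0 (trans (sym eq) (trans (^-congˡ (1 ℕ.+ 2 ℕ.* w) u≈-v) ([-x]^odd≈-x^odd v w))))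
                      (^-≉0 (1 ℕ.+ 2 ℕ.* w) v≉0)

  odd-period : ∀ {k j r} → Odd j → k ℕ.* j ≡ N ℕ.* r → OddPeriod k
  odd-period {k} {j} {r} (h , ≡.refl) kj≡Nr = h , λ x → trans
    (reflexive (≡.cong (x ^_) (≡.trans (ℕ.^-*-assoc p k j) (≡.trans (≡.cong (p ℕ.^_) kj≡Nr)
      (≡.trans (≡.sym (ℕ.^-*-assoc p N r)) (≡.cong (ℕ._^ r) (≡.sym q≡p^N)))))))
    (fermat^ r x)

  -- If m·1 is the last square before the first nonsquare among 0, 1, 2, …, then −1 − m·1 is a square.
  -1-sum-of-squares : Nonsquare R (- 1#) →
    ∃₂ λ s t → s * s + t * t ≈ - 1# × (s * s) ^ p ≈ s * s × (t * t) ^ p ≈ t * t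
  -1-sum-of-squares -1-nonsquare = [ (λ p-1-square → contradiction p-1-square (nonsquare-≈ (sym p-1≈-1) -1-nonsquare)) ,
      (λ found → found) ]′
    (search (p ∸ 1))
    where
    -- This guarantees that the search meets a nonsquare: the multiples of 1 begin with the square 0
    -- and end with -1.
    p-1≈-1 : (p ∸ 1) · 1# ≈ - 1#
    p-1≈-1 = +-inverseʳ-unique 1# _ (trans (reflexive (≡.cong (_· 1#)
      (ℕ.m+[n∸m]≡n {1} (ℕ.<⇒≤ (ℕ.nonTrivial⇒n>1 p {{prime⇒nonTrivial p-prime}}))))) p·1≈0)
    -- Multiples of 1 lie in the prime field, so the two squares found are fixed by Frobenius; (e)
    -- passes this on to `s` and `t` themselves.
    fixed : ∀ m → (m · 1#) ^ p ≈ m · 1#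
    fixed zero    = trans (^-congˡ p refl) (≡.subst (λ e → 0# ^ e ≈ 0#) (ℕ.*-identityʳ p) (0^p^k≈0 1 refl))
    fixed (suc m) = trans (freshman 1# (m · 1#)) (+-cong (1^n≈1 p) (fixed m))
    Found = ∃₂ λ s t → s * s + t * t ≈ - 1# × (s * s) ^ p ≈ s * s × (t * t) ^ p ≈ t * t
    step : ∀ m → (∃ λ z → z * z ≈ m · 1#) → Nonsquare R (suc m · 1#) → Found
    step m (s , s²≈m) m+1-nonsquare = let t , t²≈ = nonsquare*nonsquare -1-nonsquare m+1-nonsquare
                                          t²≈-[m+1] = trans t²≈ (-1*x≈-x _) in
      s , t ,
      (begin
        s * s + t * t                ≈⟨ +-cong s²≈m t²≈-[m+1] ⟩
        m · 1# - (1# + m · 1#)       ≈⟨ solve 1 (λ x → x :- (con (+ 1) :+ x) := :- con (+ 1)) refl (m · 1#) ⟩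
        - 1#                         ∎) ,
      trans (^-congˡ p s²≈m) (trans (fixed m) (sym s²≈m)) ,
      (begin
        (t * t) ^ p                  ≈⟨ ^-congˡ p t²≈-[m+1] ⟩
        (- (suc m · 1#)) ^ p         ≈⟨ ≡.subst (λ e → (- (suc m · 1#)) ^ e ≈ - ((suc m · 1#) ^ e)) (ℕ.*-identityʳ p) (frobenius-neg 1 _) ⟩
        - ((suc m · 1#) ^ p)         ≈⟨ -‿cong (fixed (suc m)) ⟩
        - (suc m · 1#)               ≈⟨ t²≈-[m+1] ⟨
        t * t                        ∎)
    search : ∀ m → (∃ λ z → z * z ≈ m · 1#) ⊎ Found
    search zero    = inj₁ (0# , zeroˡ 0#)
    search (suc m) with search m | square? (suc m · 1#)
    ... | inj₂ found | _          = inj₂ found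
    ... | inj₁ _     | yes square = inj₁ square
    ... | inj₁ m-square | no m+1-nonsquare = inj₂ (step m m-square m+1-nonsquare)

-- Sizes of images, and the fibre count.

adjoin : {S : Setoid c ℓ} →
         let open Setoid S in
         {P : Pred Carrier ℓ₃} {Q : Pred Carrier ℓ₄} {m : ℕ} (x : Carrier) → Q x →
         (∀ y → P y → Q y) → (∀ y → P y → ¬ x ≈ y) → (∀ y → Q y → P y ⊎ x ≈ y) →
         SubsetHasSize S P m → SubsetHasSize S Q (m ℕ.+ 1)
adjoin {S = S} {Q = Q} {m = m} x Qx P⇒Q x∉P Q⇒ size = ≡.subst (SubsetHasSize S Q) (ℕ.+-comm 1 m)
  (subset-size S elt elt-∈ elt-injective covers)
  where
  open Setoid S
  open Inverse size
  elt : Fin (suc m) → Carrier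
  elt zero    = x
  elt (suc i) = proj₁ (to i)
  elt-∈ : ∀ i → Q (elt i)
  elt-∈ zero    = Qx
  elt-∈ (suc i) = P⇒Q _ (proj₂ (to i))
  elt-injective : ∀ {i j} → elt i ≈ elt j → i ≡ j
  elt-injective {zero}  {zero}  eq = ≡.refl
  elt-injective {zero}  {suc j} eq = contradiction eq (x∉P _ (proj₂ (to j)))
  elt-injective {suc i} {zero}  eq = contradiction (sym eq) (x∉P _ (proj₂ (to i)))
  elt-injective {suc i} {suc j} eq = ≡.cong suc (≡.trans (≡.sym (inverseʳ {y = to i} refl)) (inverseʳ eq))
  covers : ∀ y → Q y → ∃ λ i → elt i ≈ y
  covers y Qy = [ (λ Py → suc (from (y , Py)) , inverseˡ ≡.refl) , (λ x≈y → zero , x≈y) ]′ (Q⇒ y Qy)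

image-size : {S : Setoid c₁ ℓ₁} {T : Setoid c₂ ℓ₂} →
             let open Setoid S using () renaming (_≈_ to _≈ₛ_)
                 open Setoid T using () renaming (_≈_ to _≈ₜ_)
             in
             {m : ℕ} → HasSize S m →
             (h : Setoid.Carrier S → Setoid.Carrier T) → (∀ {x y} → x ≈ₛ y → h x ≈ₜ h y) →
             (∀ {x y} → h x ≈ₜ h y → x ≈ₛ y) → SubsetHasSize T (λ t → ∃ λ x → h x ≈ₜ t) m
image-size {S = S} {T = T} size h h-cong h-injective = subset-size T (h ∘ to) (λ i → to i , Setoid.refl T)
  (λ {i} eq → ≡.trans (≡.sym (inverseʳ {y = to i} (Setoid.refl S))) (inverseʳ (h-injective eq)))
  (λ t (x , eq) → from x , Setoid.trans T (h-cong (inverseˡ ≡.refl)) eq)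
  where open Inverse size

image₂-size : {R : Setoid c₁ ℓ} {S : Setoid c₂ ℓ₁} {T : Setoid c ℓ₂} →
              let open Setoid R using () renaming (_≈_ to _≈ᵣ_)
                  open Setoid S using () renaming (_≈_ to _≈ₛ_)
                  open Setoid T using () renaming (_≈_ to _≈ₜ_)
              in
              {m n : ℕ} →
              HasSize R m → HasSize S n → (h : Setoid.Carrier R → Setoid.Carrier S → Setoid.Carrier T) →
              (∀ {x x′ y y′} → x ≈ᵣ x′ → y ≈ₛ y′ → h x y ≈ₜ h x′ y′) →
              (∀ {x x′ y y′} → h x y ≈ₜ h x′ y′ → x ≈ᵣ x′ × y ≈ₛ y′) →
              SubsetHasSize T (λ t → ∃₂ λ x y → h x y ≈ₜ t) (m ℕ.* n)
image₂-size {R = R} {S = S} {T = T} {m = m} {n = n} R-size S-size h h-cong h-injective = subset-size T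
  (λ i → h (I.to (proj₁ (remQuot {m} n i))) (J.to (proj₂ (remQuot {m} n i)))) (λ i → _ , _ , Setoid.refl T)
  (λ {i} {j} eq → let eq₁ , eq₂ = h-injective eq in
    ≡.trans (≡.sym (combine-remQuot {m} n i)) (≡.trans (≡.cong₂ combine
      (≡.trans (≡.sym (I.inverseʳ (Setoid.refl R))) (I.inverseʳ eq₁))
      (≡.trans (≡.sym (J.inverseʳ (Setoid.refl S))) (J.inverseʳ eq₂))) (combine-remQuot {m} n j)))
  (λ t (x , y , eq) → combine (I.from x) (J.from y) , Setoid.trans T
    (h-cong (I.inverseˡ (≡.cong proj₁ (remQuot-combine (I.from x) (J.from y))))
            (J.inverseˡ (≡.cong proj₂ (remQuot-combine (I.from x) (J.from y))))) eq)
  where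
  module I = Inverse R-size
  module J = Inverse S-size

-- With q = 1 + n the count reads 1 + nk = (1 + n)², whence k = n + 2. The second index `j` excludes
-- q = 1, where `n` could not be cancelled.
equal-fibres : ∀ {q k} (f : Fin q → ℕ) (i j : Fin q) → i ≢ j → f i ≡ 1 → (∀ j → j ≢ i → f j ≡ k) →
               sumℕ f ≡ q ℕ.^ 2 → k ≡ q ℕ.+ 1
equal-fibres {suc zero} f zero zero i≢j = contradiction ≡.refl i≢j
equal-fibres {q@(suc n@(suc _))} {k} f i _ _ fi≡1 fj≡k sum≡q² = ℕ.*-cancelˡ-≡ k (q ℕ.+ 1) n (ℕ.+-cancelˡ-≡ 1 _ _
  (≡.trans (≡.sym (≡.cong₂ ℕ._+_ fi≡1 (sumℕ-const (removeAt f i) (λ j → fj≡k _ (punchInᵢ≢i i j)))))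
  (≡.trans (≡.sym (Sum.sum-remove ℕ.+-0-commutativeMonoid {i = i} f))
  (≡.trans sum≡q² (solve 1 (λ n → (con 1 :+ n) :* ((con 1 :+ n) :* con 1) := con 1 :+ n :* (con 1 :+ n :+ con 1)) ≡.refl n)))))
  where open +-*-Solver

-- The maps M d carry the fibre over c injectively into the fibre over dc, so all fibres
-- over nonzero elements have the same size k, and 1 + (q − 1)k = q².
module _ {F : CommutativeRing c ℓ} {q : ℕ} (F-field : IsFieldOfOrder F q) {X : Setoid c₁ ℓ₁} (X-size : HasSize X (q ℕ.^ 2)) where
  open FiniteField F F-field
  private module X = Setoid X

  fibre-sizes : (g : X.Carrier → Carrier) → (∀ {x y} → x X.≈ y → g x ≈ g y) →
                (z : X.Carrier) → g z ≈ 0# → (∀ {x} → g x ≈ 0# → z X.≈ x) →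
                (∀ d → d ≉ 0# → ∃ λ (M : X.Carrier → X.Carrier) →
                  (∀ {x y} → M x X.≈ M y → x X.≈ y) × (∀ x → g (M x) ≈ d * g x)) →
                ∀ c → SubsetHasSize X (λ x → g x ≈ c) 1 ⊎ SubsetHasSize X (λ x → g x ≈ c) (q ℕ.+ 1)
  fibre-sizes g g-cong z gz≈0 z-unique scale c = by-cases (c ≈? 0#)
    where
    module I = Inverse X-size
    fibre? : ∀ c i → Dec (g (I.to i) ≈ c)
    fibre? c i = g (I.to i) ≈? c
    fibre-size : ∀ c → SubsetHasSize X (λ x → g x ≈ c) (count (fibre? c))
    fibre-size c = subset-size-map I.to (λ { ≡.refl → X.refl })
      (λ {i} eq → ≡.trans (≡.sym (I.inverseʳ {y = I.to i} X.refl)) (I.inverseʳ eq)) (λ _ eq → eq)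
      (λ x gx≈c → I.from x , trans (g-cong (I.inverseˡ ≡.refl)) gx≈c , I.inverseˡ ≡.refl) (count-size (fibre? c))
    count-≤ : ∀ {c d} → c ≉ 0# → d ≉ 0# → count (fibre? c) ℕ.≤ count (fibre? d)
    count-≤ {c} {d} c≉0 d≉0 = let M , M-injective , gM = scale (d * inv c) (xy≉0 d≉0 (inv-≉0 c≉0)) in
      subset-size-≤ M M-injective (λ x gx≈c → trans (gM x) (trans (*-congˡ gx≈c)
        (trans (*-assoc d (inv c) c) (trans (*-congˡ (trans (*-comm _ _) (inv-inverse c≉0))) (*-identityʳ d)))))
        (fibre-size c) (fibre-size d)
    one-value : ∀ i → count (λ j → fibre? (to j) i) ≡ 1
    one-value i = count-unique (λ j → fibre? (to j) i) (size-1 (≡.setoid _) (from (g (I.to i)))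
      (sym (inverseˡ ≡.refl)) (λ j eq → inverseʳ eq))
    all-points : sumℕ (λ j → count (fibre? (to j))) ≡ q ℕ.^ 2
    all-points = ≡.trans (Sum.∑-comm ℕ.+-0-commutativeMonoid (λ j i → indicator (fibre? (to j) i)))
      (≡.trans (sumℕ-const {q ℕ.^ 2} _ one-value) (ℕ.*-identityʳ _))
    size-over-0 : ∀ c → c ≈ 0# → SubsetHasSize X (λ x → g x ≈ c) 1
    size-over-0 c c≈0 = size-1 X z (trans gz≈0 (sym c≈0)) (λ x gx≈c → z-unique (trans gx≈c c≈0))
    to≈0 : to (from 0#) ≈ 0#
    to≈0 = inverseˡ ≡.refl
    by-cases : Dec (c ≈ 0#) → _
    by-cases (yes c≈0) = inj₁ (size-over-0 c c≈0)
    by-cases (no  c≉0) = inj₂ (≡.subst (SubsetHasSize X (λ x → g x ≈ c))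
      (equal-fibres (λ j → count (fibre? (to j))) (from 0#) (from c)
        (λ eq → c≉0 (trans (sym (inverseˡ ≡.refl)) (inverseˡ (≡.sym eq))))
        (ℕ.≤-antisym (subset-size-≤ {S = X} {T = X} (λ x → x) (λ eq → eq) (λ _ eq → eq) (fibre-size (to (from 0#))) (size-over-0 _ to≈0))
                     (subset-size-≤ {S = X} {T = X} (λ x → x) (λ eq → eq) (λ _ eq → eq) (size-over-0 _ to≈0) (fibre-size (to (from 0#)))))
        (λ j j≢0 → let toj≉0 = λ eq → j≢0 (≡.sym (inverseʳ (sym eq))) in ℕ.≤-antisym (count-≤ toj≉0 c≉0) (count-≤ c≉0 toj≉0))
        all-points)
      (fibre-size c))

-- Coordinates over F, and the criteria for planarity and for the unital.

module PlaneLemmas (F : CommutativeRing c₁ ℓ₁) (K : CommutativeRing c₂ ℓ₂) (p n : ℕ)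
                   (E : QuadraticExtension F K (p ℕ.^ n)) (ξ : CommutativeRing.Carrier K)
                   (ξ∉F : ∀ s → ¬ CommutativeRing._≈_ K (QuadraticExtension.ι E s) ξ) where
  open QuadraticExtension E
  open Plane K
  open Setting F K p n E ξ ξ∉F
  private
    q = p ℕ.^ n
    module F = FiniteField F F-field
    module ι = IsRingMonomorphism ι-mono
  open FiniteField K K-field
  open import Relation.Binary.Reasoning.Setoid setoid

  ⊕-cong : ∀ {s s′ t t′} → s F.≈ s′ → t F.≈ t′ → (s ⊕ t ·ξ) ≈ (s′ ⊕ t′ ·ξ)
  ⊕-cong s≈s′ t≈t′ = +-cong (ι.⟦⟧-cong s≈s′) (*-congʳ (ι.⟦⟧-cong t≈t′))

  coordinates-≈ : ∀ x → x ≈ (x₀ x ⊕ x₁ x ·ξ)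
  coordinates-≈ x = proj₂ (proj₂ (coordinates x))

  x₀-⊕ : ∀ {x s t} → x ≈ (s ⊕ t ·ξ) → x₀ x F.≈ s
  x₀-⊕ {x} eq = 1-coordinate-unique (trans (sym (coordinates-≈ x)) eq)

  x₁-⊕ : ∀ {x s t} → x ≈ (s ⊕ t ·ξ) → x₁ x F.≈ t
  x₁-⊕ {x} eq = ξ-coordinate-unique (trans (sym (coordinates-≈ x)) eq)

  x₀-cong : ∀ {x y} → x ≈ y → x₀ x F.≈ x₀ y
  x₀-cong {x} {y} x≈y = x₀-⊕ (trans x≈y (coordinates-≈ y))

  x₁-cong : ∀ {x y} → x ≈ y → x₁ x F.≈ x₁ y
  x₁-cong {x} {y} x≈y = x₁-⊕ (trans x≈y (coordinates-≈ y))

  coordinates-injective : ∀ {x y} → x₀ x F.≈ x₀ y → x₁ x F.≈ x₁ y → x ≈ y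
  coordinates-injective {x} {y} eq₀ eq₁ = trans (coordinates-≈ x) (trans (⊕-cong eq₀ eq₁) (sym (coordinates-≈ y)))

  ⊕-+ : ∀ s t s′ t′ → (s F.+ s′ ⊕ t F.+ t′ ·ξ) ≈ (s ⊕ t ·ξ) + (s′ ⊕ t′ ·ξ)
  ⊕-+ s t s′ t′ = trans (+-cong (ι.+-homo s s′) (*-congʳ (ι.+-homo t t′)))
    (solve 5 (λ s t s′ t′ ξ → s :+ s′ :+ (t :+ t′) :* ξ := s :+ t :* ξ :+ (s′ :+ t′ :* ξ)) refl (ι s) (ι t) (ι s′) (ι t′) ξ)

  ⊕-neg : ∀ s t → (F.- s ⊕ F.- t ·ξ) ≈ - (s ⊕ t ·ξ)
  ⊕-neg s t = trans (+-cong (ι.-‿homo s) (*-congʳ (ι.-‿homo t)))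
    (solve 3 (λ s t ξ → :- s :+ :- t :* ξ := :- (s :+ t :* ξ)) refl (ι s) (ι t) ξ)

  +-⊕ : ∀ {x y s t s′ t′} → x ≈ (s ⊕ t ·ξ) → y ≈ (s′ ⊕ t′ ·ξ) → x + y ≈ (s F.+ s′ ⊕ t F.+ t′ ·ξ)
  +-⊕ {s = s} {t} {s′} {t′} eq eq′ = trans (+-cong eq eq′) (sym (⊕-+ s t s′ t′))

  neg-⊕ : ∀ {x s t} → x ≈ (s ⊕ t ·ξ) → - x ≈ (F.- s ⊕ F.- t ·ξ)
  neg-⊕ {s = s} {t} eq = trans (-‿cong eq) (sym (⊕-neg s t))

  0-⊕ : 0# ≈ (F.0# ⊕ F.0# ·ξ)
  0-⊕ = sym (trans (+-cong ι.0#-homo (trans (*-congʳ ι.0#-homo) (zeroˡ ξ))) (+-identityˡ 0#))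

  ξ-multiple-⊕ : ∀ {x} t → x ≈ ι t * ξ → x ≈ (F.0# ⊕ t ·ξ)
  ξ-multiple-⊕ t eq = trans eq (sym (trans (+-congʳ ι.0#-homo) (+-identityˡ _)))

  planar : (f : Carrier → Carrier) → (∀ {x y} → x ≈ y → f x ≈ f y) →
           (B : Carrier → Carrier → Carrier) → (∀ x y → f (x + y) ≈ f x + f y + B x y) →
           (∀ {x y} a → x ≈ y → B x a ≈ B y a) → (∀ x y a → B (x + y) a ≈ B x a + B y a) →
           (∀ {x a} → B x a ≈ 0# → x ≈ 0# ⊎ a ≈ 0#) → Planar f
  planar f f-cong B polarisation B-cong B-+ B-kernel a a≉0 = Δ-injective , surjective
    where
    Δ : Carrier → Carrier
    Δ x = f (x + a) - f x
    Δ-B : ∀ x → Δ x ≈ f a + B x a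
    Δ-B x = trans (+-congʳ (polarisation x a)) (solve 3 (λ fx fa b → fx :+ fa :+ b :- fx := fa :+ b) refl (f x) (f a) (B x a))
    Δ-injective : ∀ {x y} → Δ x ≈ Δ y → x ≈ y
    Δ-injective {x} {y} eq = x-y≈0⇒x≈y ([ (λ eq → eq) , (λ a≈0 → contradiction a≈0 a≉0) ]′ (B-kernel
      (+-cancelʳ (B y a) _ _ (begin
        B (x - y) a + B y a       ≈⟨ B-+ (x - y) y a ⟨
        B (x - y + y) a           ≈⟨ B-cong a (solve 2 (λ x y → x :- y :+ y := x) refl x y) ⟩
        B x a                     ≈⟨ +-cancelˡ (f a) _ _ (trans (sym (Δ-B x)) (trans eq (Δ-B y))) ⟩
        B y a                     ≈⟨ +-identityˡ _ ⟨
        0# + B y a                ∎))))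
    surjective : ∀ y → ∃ λ x → ∀ {z} → z ≈ x → Δ z ≈ y
    surjective y = let x , Δx≈y = injective⇒surjective order order Δ Δ-injective y in
      x , λ z≈x → trans (+-cong (f-cong (+-congʳ z≈x)) (-‿cong (f-cong z≈x))) Δx≈y

  ξ≉0 : ξ ≉ 0#
  ξ≉0 ξ≈0 = ξ∉F F.0# (trans ι.0#-homo (sym ξ≈0))

  ιξ-injective : ∀ {s t} → ι s * ξ ≈ ι t * ξ → s F.≈ t
  ιξ-injective {s} {t} eq = ι.injective (*-cancelˡ-≉0 ξ≉0 (trans (*-comm _ _) (trans eq (*-comm _ _))))

  -- Only the lines L a b depend on f: they meet 𝒰 in the x for which f(x+a) and b have the same 1-coordinate.
  unital : (f : Carrier → Carrier) → (∀ {x y} → x ≈ y → f x ≈ f y) →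
           (∀ c → SubsetHasSize setoid (λ x → x₀ (f x) F.≈ c) 1 ⊎ SubsetHasSize setoid (λ x → x₀ (f x) F.≈ c) (q ℕ.+ 1)) →
           IsUnital q (Π f) 𝒰
  unital f f-cong fibres = 𝒰-size , line
    where
    open Setoid points using () renaming (refl to reflₚ; sym to symₚ)
    𝒰-size : SubsetHasSize points 𝒰 (q ℕ.^ 3 ℕ.+ 1)
    -- Counting the pairs (x, t) gives `q ^ 2 * q`, whereas `q ^ 3` unfolds to `q * q ^ 2`; the
    -- final 1 is `dir∞`.
    𝒰-size = ≡.subst (λ m → SubsetHasSize points 𝒰 (m ℕ.+ 1)) (ℕ.*-comm (q ℕ.^ 2) q)
      (adjoin dir∞ ∞
        (λ { _ (x , t , affine _ eq) → affine t (sym eq) })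
        (λ { _ (x , t , ()) ∞ })
        (λ { _ (affine t eq) → inj₁ (_ , t , affine refl (sym eq)) ; _ ∞ → inj₂ ∞ })
        (image₂-size order F.order (λ x t → pt x (ι t * ξ)) (λ x≈ t≈ → affine x≈ (*-congʳ (ι.⟦⟧-cong t≈)))
          (λ { (affine x≈ eq) → x≈ , ιξ-injective eq })))

    line : ∀ l → SubsetHasSize points (𝒰 ∩ (_∈[ f ] l)) 1 ⊎ SubsetHasSize points (𝒰 ∩ (_∈[ f ] l)) (q ℕ.+ 1)
    line L∞ = inj₁ (size-1 points dir∞ (∞ , L∞-∞) (λ { _ (∞ , _) → ∞ }))
    line (N a) = inj₂ (adjoin dir∞ (∞ , N-∞)
      (λ { _ (t , affine x≈ y≈) → affine t (sym y≈) , N-affine (sym x≈) })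
      (λ { _ (t , ()) ∞ })
      (λ { _ (affine t eq , N-affine x≈) → inj₁ (t , affine (sym x≈) (sym eq)) ; _ (∞ , _) → inj₂ ∞ })
      (image-size F.order (λ t → pt a (ι t * ξ)) (λ t≈ → affine refl (*-congʳ (ι.⟦⟧-cong t≈)))
        (λ { (affine _ eq) → ιξ-injective eq })))
    line (L a b) = Sum⊎.map intersection intersection (fibres (x₀ b))
      where
      intersection : ∀ {m} → SubsetHasSize setoid (λ x → x₀ (f x) F.≈ x₀ b) m → SubsetHasSize points (𝒰 ∩ (_∈[ f ] L a b)) m
      -- The fibre variable is the argument of `f`, so the corresponding point of the line has
      -- abscissa x - a.
      intersection = subset-size-map (λ x → pt (x - a) (f x - b))
        (λ x≈y → affine (+-congʳ x≈y) (+-congʳ (f-cong x≈y)))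
        (λ { (affine eq _) → +-cancelʳ (- a) _ _ eq })
        (λ x eq → affine (x₁ (f x) F.- x₁ b) (begin
            f x - b                                           ≈⟨ +-⊕ (coordinates-≈ (f x)) (neg-⊕ (coordinates-≈ b)) ⟩
            (x₀ (f x) F.- x₀ b ⊕ x₁ (f x) F.- x₁ b ·ξ)        ≈⟨ ⊕-cong (F.x≈y⇒x∙y⁻¹≈ε eq) F.refl ⟩
            (F.0# ⊕ x₁ (f x) F.- x₁ b ·ξ)                     ≈⟨ trans (+-congʳ ι.0#-homo) (+-identityˡ _) ⟩
            ι (x₁ (f x) F.- x₁ b) * ξ                         ∎)
          , L-affine (+-congʳ (f-cong (solve 2 (λ x a → x := x :- a :+ a) refl x a))))
        (λ { (pt x y) (affine t eq , L-affine on) → x + a ,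
             F.trans (x₀-⊕ (trans (solve 2 (λ fx b → fx := fx :- b :+ b) refl (f (x + a)) b)
                    (+-⊕ (trans (sym on) (ξ-multiple-⊕ t eq)) (coordinates-≈ b)))) (F.+-identityˡ _) ,
             affine (solve 2 (λ x a → x :+ a :- a := x) refl x a) (sym on)
           ; dir∞ (_ , ()) })

-- The powers x^(pᵏ+1): reparametrisation as squares, and polar forms.

record SquareParametrisation (R : CommutativeRing c ℓ) (N : CommutativeRing.Carrier R → CommutativeRing.Carrier R) : Set (c ⊔ ℓ) where
  open CommutativeRing R
  field
    -- On a finite field the injective `ψ` is a bijection, so a coordinate may be written as `ψ u`,
    -- and `N` of it is then u².
    ψ           : Carrier → Carrier
    ψ-cong      : ∀ {u v} → u ≈ v → ψ u ≈ ψ v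
    ψ-injective : ∀ {u v} → ψ u ≈ ψ v → u ≈ v
    N∘ψ         : ∀ u → N (ψ u) ≈ u * u

module NormPowers (R : CommutativeRing c ℓ) {q : ℕ} (R-field : IsFieldOfOrder R q)
                  {p N : ℕ} (p-prime : Prime p) (p≢2 : p ≢ 2) (q≡p^N : q ≡ p ℕ.^ N) where
  open PrimePowerField R R-field {N = N} p-prime p≢2 q≡p^N
  open import Relation.Binary.Reasoning.Setoid setoid

  -- `ψ u` determines u² as its (pᵏ+1)-st power, hence `u` up to sign, and the sign survives because
  -- the exponent of `ψ` is odd.
  power-parametrisation : ∀ k → OddPeriod k → SquareParametrisation R (_^ (p ℕ.^ k ℕ.+ 1))
  power-parametrisation k period = let w , root = norm-root k period in record
    { ψ           = _^ (1 ℕ.+ 2 ℕ.* w)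
    ; ψ-cong      = ^-congˡ (1 ℕ.+ 2 ℕ.* w)
    ; ψ-injective = λ {u} {v} eq → ^odd-injective w (trans (sym (root u)) (trans (^-congˡ (p ℕ.^ k ℕ.+ 1) eq) (root v))) eq
    ; N∘ψ         = root
    }

  frobenius-injective : ∀ i {x y} → x ^ (p ℕ.^ i) ≈ y ^ (p ℕ.^ i) → x ≈ y
  frobenius-injective i {x} {y} eq with (x - y) ≈? 0#
  ... | yes x-y≈0 = x-y≈0⇒x≈y x-y≈0
  ... | no  x-y≉0 = contradiction (trans (frobenius-+ i x (- y)) (trans (+-congˡ (frobenius-neg i y)) (x≈y⇒x∙y⁻¹≈ε eq)))
                      (^-≉0 (p ℕ.^ i) x-y≉0)

  -- Precomposing with the inverse Frobenius `τ⁻` absorbs the outer power: (τ⁻(u)²)^(pⁱ) = u². The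
  -- inverse exists because an injection of a finite field is onto.
  frobenius-parametrisation : ∀ i {M N} → (∀ t → N t ≈ M t ^ (p ℕ.^ i)) → SquareParametrisation R M → SquareParametrisation R N
  frobenius-parametrisation i {M} {N} N≈ M-parametrisation = record
    { ψ           = ψ ∘ τ⁻
    ; ψ-cong      = λ u≈v → ψ-cong (frobenius-injective i (trans (ττ⁻ _) (trans u≈v (sym (ττ⁻ _)))))
    ; ψ-injective = λ eq → trans (sym (ττ⁻ _)) (trans (^-congˡ (p ℕ.^ i) (ψ-injective eq)) (ττ⁻ _))
    ; N∘ψ         = λ u → trans (N≈ _) (trans (^-congˡ (p ℕ.^ i) (N∘ψ (τ⁻ u)))
                      (trans (^-distrib-* _ _ (p ℕ.^ i)) (*-cong (ττ⁻ u) (ττ⁻ u))))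
    }
    where
    open SquareParametrisation M-parametrisation
    τ⁻ : Carrier → Carrier
    τ⁻ u = proj₁ (injective⇒surjective order order (_^ (p ℕ.^ i)) (frobenius-injective i) u)
    ττ⁻ : ∀ u → τ⁻ u ^ (p ℕ.^ i) ≈ u
    ττ⁻ u = proj₂ (injective⇒surjective order order (_^ (p ℕ.^ i)) (frobenius-injective i) u)

  -- The biadditive form obtained by polarising x^(pᵏ+1); for k = 0 it is 2xy.
  polar : ℕ → Carrier → Carrier → Carrier
  polar k x y = x ^ (p ℕ.^ k) * y + x * y ^ (p ℕ.^ k)

  norm-polar : ∀ k x y → (x + y) ^ (p ℕ.^ k ℕ.+ 1) ≈ x ^ (p ℕ.^ k ℕ.+ 1) + y ^ (p ℕ.^ k ℕ.+ 1) + polar k x y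
  norm-polar k x y = begin
    (x + y) ^ (P ℕ.+ 1)                              ≈⟨ ^-homo-* (x + y) P 1 ⟩
    (x + y) ^ P * (x + y) ^ 1                        ≈⟨ *-congʳ (frobenius-+ k x y) ⟩
    (x ^ P + y ^ P) * (x + y) ^ 1                    ≈⟨ solve 4 (λ x y x′ y′ → (x′ :+ y′) :* (x :+ y) :^ 1
                                                          := x′ :* x :^ 1 :+ y′ :* y :^ 1 :+ (x′ :* y :+ x :* y′))
                                                          refl x y (x ^ P) (y ^ P) ⟩
    x ^ P * x ^ 1 + y ^ P * y ^ 1 + polar k x y      ≈⟨ +-congʳ (+-cong (^-homo-* x P 1) (^-homo-* y P 1)) ⟨
    x ^ (P ℕ.+ 1) + y ^ (P ℕ.+ 1) + polar k x y      ∎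
    where P = p ℕ.^ k

  polar-cong : ∀ k {x x′ y y′} → x ≈ x′ → y ≈ y′ → polar k x y ≈ polar k x′ y′
  polar-cong k x≈ y≈ = +-cong (*-cong (^-congˡ (p ℕ.^ k) x≈) y≈) (*-cong x≈ (^-congˡ (p ℕ.^ k) y≈))

  polar-+ : ∀ k x y z → polar k (x + y) z ≈ polar k x z + polar k y z
  polar-+ k x y z = trans (+-congʳ (*-congʳ (frobenius-+ k x y)))
    (solve 6 (λ x y z x′ y′ z′ → (x′ :+ y′) :* z :+ (x :+ y) :* z′ := x′ :* z :+ x :* z′ :+ (y′ :* z :+ y :* z′))
      refl x y z (x ^ (p ℕ.^ k)) (y ^ (p ℕ.^ k)) (z ^ (p ℕ.^ k)))

  polar-neg : ∀ k x y → polar k x (- y) ≈ - polar k x y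
  polar-neg k x y = trans (+-congˡ (*-congˡ (frobenius-neg k y)))
    (solve 4 (λ x y x′ y′ → x′ :* :- y :+ x :* :- y′ := :- (x′ :* y :+ x :* y′)) refl x y (x ^ (p ℕ.^ k)) (y ^ (p ℕ.^ k)))

  polar-* : ∀ k u x y → polar k (u * x) (u * y) ≈ u ^ (p ℕ.^ k ℕ.+ 1) * polar k x y
  polar-* k u x y = begin
    (u * x) ^ P * (u * y) + u * x * (u * y) ^ P
      ≈⟨ +-cong (*-congʳ (^-distrib-* u x P)) (*-congˡ (^-distrib-* u y P)) ⟩
    u ^ P * x ^ P * (u * y) + u * x * (u ^ P * y ^ P)
      ≈⟨ solve 6 (λ u x y u′ x′ y′ → u′ :* x′ :* (u :* y) :+ u :* x :* (u′ :* y′) := u′ :* u :^ 1 :* (x′ :* y :+ x :* y′))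
           refl u x y (u ^ P) (x ^ P) (y ^ P) ⟩
    u ^ P * u ^ 1 * polar k x y
      ≈⟨ *-congʳ (^-homo-* u P 1) ⟨
    u ^ (P ℕ.+ 1) * polar k x y ∎
    where P = p ℕ.^ k

  -- With u = x/y, a zero of the polar form is y^(P+1)(uᴾ + u).
  polar-kernel : ∀ k → OddPeriod k → ∀ {x y} → x ≉ 0# → polar k x y ≈ 0# → y ≈ 0#
  polar-kernel k period {x} {y} x≉0 eq = begin
    y                ≈⟨ *-identityˡ y ⟨
    1# * y           ≈⟨ *-congʳ (inv-inverse x≉0) ⟨
    x * inv x * y    ≈⟨ *-assoc x (inv x) y ⟩
    x * (inv x * y)  ≈⟨ *-congˡ (anti-fixed⇒0 k period (+-inverseʳ-unique u (u ^ P) (begin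
        u + u ^ P                              ≈⟨ +-cong (trans (sym (*-identityˡ u)) (*-congʳ (sym (1^n≈1 P)))) (sym (*-identityˡ _)) ⟩
        polar k 1# u                           ≈⟨ *-cancelˡ-≉0 (^-≉0 (P ℕ.+ 1) x≉0) (begin
           x ^ (P ℕ.+ 1) * polar k 1# u        ≈⟨ polar-* k x 1# u ⟨
           polar k (x * 1#) (x * u)            ≈⟨ polar-cong k (*-identityʳ x)
               (trans (sym (*-assoc x (inv x) y)) (trans (*-congʳ (inv-inverse x≉0)) (*-identityˡ y))) ⟩
           polar k x y                         ≈⟨ eq ⟩
           0#                                  ≈⟨ zeroʳ _ ⟨
           x ^ (P ℕ.+ 1) * 0#                  ∎) ⟩
        0#                                     ∎))) ⟩
    x * 0#           ≈⟨ zeroʳ x ⟩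
    0#               ∎
    where
    P = p ℕ.^ k
    u = inv x * y

-- The common coordinate shape of the functions in (a)-(d).

module CoordinateFunctions (F : CommutativeRing c₁ ℓ₁) (K : CommutativeRing c₂ ℓ₂) (p n : ℕ)
                           (p-prime : Prime p) (p≢2 : p ≢ 2)
                           (E : QuadraticExtension F K (p ℕ.^ n)) (ξ : CommutativeRing.Carrier K)
                           (ξ∉F : ∀ s → ¬ CommutativeRing._≈_ K (QuadraticExtension.ι E s) ξ) where
  open QuadraticExtension E
  open Plane K
  open Setting F K p n E ξ ξ∉F
  open PlaneLemmas F K p n E ξ ξ∉F
  private
    q = p ℕ.^ n
    module K = CommutativeRing K
    module ι = IsRingMonomorphism ι-mono
  open PrimePowerField F F-field {N = n} p-prime p≢2 ≡.refl
  open NormPowers F F-field {N = n} p-prime p≢2 ≡.refl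
  open import Relation.Binary.Reasoning.Setoid setoid

  private module _ {α} (represents : ∀ d → d ≉ 0# → ∃₂ λ r s → r * r + α * (s * s) ≈ d) where
    -- The map is multiplication of u + v√-α by r + s√-α, an element of norm `d`. Multiplying by the
    -- conjugate r - s√-α gives back `d * u` and `d * v`, which is what `first` and `second` record.
    rotate : ∀ d → d ≉ 0# → ∃ λ (m : Carrier → Carrier → Carrier × Carrier) →
             (∀ u v → let u′ , v′ = m u v in u′ * u′ + α * (v′ * v′) ≈ d * (u * u + α * (v * v))) ×
             (∀ {u v s t} → proj₁ (m u v) ≈ proj₁ (m s t) → proj₂ (m u v) ≈ proj₂ (m s t) → u ≈ s × v ≈ t)
    rotate d d≉0 with represents d d≉0
    ... | r , s , eq = (λ u v → r * u - α * (s * v) , s * u + r * v) ,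
      (λ u v → trans (solve 5 (λ r s u v α →
          (r :* u :- α :* (s :* v)) :* (r :* u :- α :* (s :* v)) :+ α :* ((s :* u :+ r :* v) :* (s :* u :+ r :* v))
          := (r :* r :+ α :* (s :* s)) :* (u :* u :+ α :* (v :* v))) refl r s u v α) (*-congʳ eq)) ,
      (λ {u} {v} {u′} {v′} eq₁ eq₂ →
        *-cancelˡ-≉0 d≉0 (trans (sym (first u v)) (trans (+-cong (*-congˡ eq₁) (*-congˡ eq₂)) (first u′ v′))) ,
        *-cancelˡ-≉0 d≉0 (trans (sym (second u v)) (trans (+-cong (*-congˡ eq₂) (-‿cong (*-congˡ eq₁))) (second u′ v′))))
      where
      first : ∀ u v → r * (r * u - α * (s * v)) + α * s * (s * u + r * v) ≈ d * u
      first u v = trans (solve 5 (λ r s u v α → r :* (r :* u :- α :* (s :* v)) :+ α :* s :* (s :* u :+ r :* v)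
                    := (r :* r :+ α :* (s :* s)) :* u) refl r s u v α) (*-congʳ eq)
      second : ∀ u v → r * (s * u + r * v) - s * (r * u - α * (s * v)) ≈ d * v
      second u v = trans (solve 5 (λ r s u v α → r :* (s :* u :+ r :* v) :- s :* (r :* u :- α :* (s :* v))
                    := (r :* r :+ α :* (s :* s)) :* v) refl r s u v α) (*-congʳ eq)

  -- After reparametrising both coordinates, the 1-coordinate of f is u² + αv², a norm form from F(√−α);
  -- multiplication by an element of norm d is the bijection between fibres.
  norm-form-unital : ∀ {α N₀ N₁} → Nonsquare F (- α) → (∀ d → d ≉ 0# → ∃₂ λ r s → r * r + α * (s * s) ≈ d) →
                     (∀ {s t} → s ≈ t → N₀ s ≈ N₀ t) → (∀ {s t} → s ≈ t → N₁ s ≈ N₁ t) →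
                     SquareParametrisation F N₀ → SquareParametrisation F N₁ →
                     (f : K.Carrier → K.Carrier) → (∀ {x y} → x K.≈ y → f x K.≈ f y) →
                     (∀ x → x₀ (f x) ≈ N₀ (x₀ x) + α * N₁ (x₁ x)) →
                     IsUnital q (Π f) 𝒰
  norm-form-unital {α} {N₀} {N₁} -α-nonsquare represents N₀-cong N₁-cong parametrisation₀ parametrisation₁ f f-cong f₀ =
    unital f f-cong (fibre-sizes F-field (IsFieldOfOrder.order K-field) (x₀ ∘ f) (x₀-cong ∘ f-cong) z gz≈0 z-unique scale)
    where
    module ψ₀ = SquareParametrisation parametrisation₀
    module ψ₁ = SquareParametrisation parametrisation₁
    g = x₀ ∘ f
    u v : K.Carrier → Carrier
    u x = proj₁ (injective⇒surjective order order ψ₀.ψ ψ₀.ψ-injective (x₀ x))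
    v x = proj₁ (injective⇒surjective order order ψ₁.ψ ψ₁.ψ-injective (x₁ x))
    ψ₀u : ∀ x → ψ₀.ψ (u x) ≈ x₀ x
    ψ₀u x = proj₂ (injective⇒surjective order order ψ₀.ψ ψ₀.ψ-injective (x₀ x))
    ψ₁v : ∀ x → ψ₁.ψ (v x) ≈ x₁ x
    ψ₁v x = proj₂ (injective⇒surjective order order ψ₁.ψ ψ₁.ψ-injective (x₁ x))
    g-ψ : ∀ {x u v} → ψ₀.ψ u ≈ x₀ x → ψ₁.ψ v ≈ x₁ x → g x ≈ u * u + α * (v * v)
    g-ψ {x} eq₀ eq₁ = trans (f₀ x) (+-cong (trans (N₀-cong (sym eq₀)) (ψ₀.N∘ψ _)) (*-congˡ (trans (N₁-cong (sym eq₁)) (ψ₁.N∘ψ _))))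
    g-uv : ∀ x → g x ≈ u x * u x + α * (v x * v x)
    g-uv x = g-ψ (ψ₀u x) (ψ₁v x)
    θ : Carrier → Carrier → K.Carrier
    θ u v = ψ₀.ψ u ⊕ ψ₁.ψ v ·ξ
    g-θ : ∀ u v → g (θ u v) ≈ u * u + α * (v * v)
    g-θ u v = g-ψ (sym (x₀-⊕ K.refl)) (sym (x₁-⊕ K.refl))
    z = θ 0# 0#
    gz≈0 : g z ≈ 0#
    gz≈0 = trans (g-θ 0# 0#) (solve 1 (λ α → con (+ 0) :* con (+ 0) :+ α :* (con (+ 0) :* con (+ 0)) := con (+ 0)) refl α)
    z-unique : ∀ {x} → g x ≈ 0# → z K.≈ x
    z-unique {x} gx≈0 = let u≈0 , v≈0 = nonsquare-anisotropic -α-nonsquare (trans (sym (g-uv x)) gx≈0) in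
      K.trans (⊕-cong (trans (ψ₀.ψ-cong (sym u≈0)) (ψ₀u x)) (trans (ψ₁.ψ-cong (sym v≈0)) (ψ₁v x))) (K.sym (coordinates-≈ x))
    scale : ∀ d → d ≉ 0# → ∃ λ (M : K.Carrier → K.Carrier) →
            (∀ {x y} → M x K.≈ M y → x K.≈ y) × (∀ x → g (M x) ≈ d * g x)
    scale d d≉0 = let m , m-scale , m-injective = rotate represents d d≉0 in
      (λ x → θ (proj₁ (m (u x) (v x))) (proj₂ (m (u x) (v x)))) ,
      (λ {x} {y} eq → let u≈ , v≈ = m-injective (ψ₀.ψ-injective (1-coordinate-unique eq)) (ψ₁.ψ-injective (ξ-coordinate-unique eq)) in
        coordinates-injective (trans (sym (ψ₀u x)) (trans (ψ₀.ψ-cong u≈) (ψ₀u y)))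
                              (trans (sym (ψ₁v x)) (trans (ψ₁.ψ-cong v≈) (ψ₁v y)))) ,
      (λ x → trans (g-θ _ _) (trans (m-scale (u x) (v x)) (*-congˡ (sym (g-uv x)))))

  module _ (k₀ k₁ i r : ℕ) (α β : Carrier) where
    -- In (a) k₀ = k₁ = 0 and in (b) k₀ = k₁ = k, both with β = 0. In (c) and (d) α = β = 1 and k₀ =
    -- 0: for (c), 10 = 3² + 1 and 6 = 2·3 give k₁ = 2, i = 0, r = 1; for (d), 18 = 2·3² and 54 =
    -- 2·3³ give k₁ = 0, i = 2, r = 3.
    f₀ f₁ : Carrier → Carrier → Carrier
    f₀ s t = s ^ (p ℕ.^ k₀ ℕ.+ 1) + α * (t ^ (p ℕ.^ k₁ ℕ.+ 1)) ^ (p ℕ.^ i)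
    f₁ s t = s * t + s * t + β * (t * t) ^ (p ℕ.^ r)

    B₀ B₁ : Carrier → Carrier → Carrier → Carrier → Carrier
    B₀ s t s′ t′ = polar k₀ s s′ + α * polar k₁ t t′ ^ (p ℕ.^ i)
    B₁ s t s′ t′ = (s * t′ + t * s′) + (s * t′ + t * s′) + β * (t * t′ + t * t′) ^ (p ℕ.^ r)

    f₀-cong : ∀ {s s′ t t′} → s ≈ s′ → t ≈ t′ → f₀ s t ≈ f₀ s′ t′
    f₀-cong s≈ t≈ = +-cong (^-congˡ (p ℕ.^ k₀ ℕ.+ 1) s≈) (*-congˡ (^-congˡ (p ℕ.^ i) (^-congˡ (p ℕ.^ k₁ ℕ.+ 1) t≈)))

    f₁-cong : ∀ {s s′ t t′} → s ≈ s′ → t ≈ t′ → f₁ s t ≈ f₁ s′ t′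
    f₁-cong s≈ t≈ = +-cong (+-cong (*-cong s≈ t≈) (*-cong s≈ t≈)) (*-congˡ (^-congˡ (p ℕ.^ r) (*-cong t≈ t≈)))

    B₀-cong : ∀ {s s′ t t′ u v} → s ≈ s′ → t ≈ t′ → B₀ s t u v ≈ B₀ s′ t′ u v
    B₀-cong s≈ t≈ = +-cong (polar-cong k₀ s≈ refl) (*-congˡ (^-congˡ (p ℕ.^ i) (polar-cong k₁ t≈ refl)))

    B₁-cong : ∀ {s s′ t t′ u v} → s ≈ s′ → t ≈ t′ → B₁ s t u v ≈ B₁ s′ t′ u v
    B₁-cong s≈ t≈ = +-cong (+-cong lemma lemma) (*-congˡ (^-congˡ (p ℕ.^ r) (+-cong (*-congʳ t≈) (*-congʳ t≈))))
      where lemma = +-cong (*-congʳ s≈) (*-congʳ t≈)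

    f₀-polarisation : ∀ s t s′ t′ → f₀ (s + s′) (t + t′) ≈ f₀ s t + f₀ s′ t′ + B₀ s t s′ t′
    f₀-polarisation s t s′ t′ = begin
      f₀ (s + s′) (t + t′)
        ≈⟨ +-cong (norm-polar k₀ s s′) (*-congˡ (trans (^-congˡ (p ℕ.^ i) (norm-polar k₁ t t′))
             (trans (frobenius-+ i _ _) (+-congʳ (frobenius-+ i _ _))))) ⟩
      _ ≈⟨ solve 7 (λ α a b c a′ b′ c′ → a :+ b :+ c :+ α :* (a′ :+ b′ :+ c′) := a :+ α :* a′ :+ (b :+ α :* b′) :+ (c :+ α :* c′))
             refl α _ _ _ _ _ _ ⟩
      f₀ s t + f₀ s′ t′ + B₀ s t s′ t′ ∎

    f₁-polarisation : ∀ s t s′ t′ → f₁ (s + s′) (t + t′) ≈ f₁ s t + f₁ s′ t′ + B₁ s t s′ t′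
    f₁-polarisation s t s′ t′ = begin
      f₁ (s + s′) (t + t′)
        ≈⟨ +-congˡ (*-congˡ (trans (^-congˡ (p ℕ.^ r) (solve 2 (λ t t′ →
            (t :+ t′) :* (t :+ t′) := t :* t :+ t′ :* t′ :+ (t :* t′ :+ t :* t′)) refl t t′))
             (trans (frobenius-+ r _ _) (+-congʳ (frobenius-+ r _ _))))) ⟩
      _ ≈⟨ solve 8 (λ s t s′ t′ β a b c → (s :+ s′) :* (t :+ t′) :+ (s :+ s′) :* (t :+ t′) :+ β :* (a :+ b :+ c)
             := s :* t :+ s :* t :+ β :* a :+ (s′ :* t′ :+ s′ :* t′ :+ β :* b) :+ ((s :* t′ :+ t :* s′) :+ (s :* t′ :+ t :* s′) :+ β :* c))
             refl s t s′ t′ β _ _ _ ⟩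
      f₁ s t + f₁ s′ t′ + B₁ s t s′ t′ ∎

    B₀-+ : ∀ s t s′ t′ u v → B₀ (s + s′) (t + t′) u v ≈ B₀ s t u v + B₀ s′ t′ u v
    B₀-+ s t s′ t′ u v = begin
      B₀ (s + s′) (t + t′) u v
        ≈⟨ +-cong (polar-+ k₀ s s′ u) (*-congˡ (trans (^-congˡ (p ℕ.^ i) (polar-+ k₁ t t′ v)) (frobenius-+ i _ _))) ⟩
      _ ≈⟨ solve 5 (λ α a b a′ b′ → a :+ b :+ α :* (a′ :+ b′) := a :+ α :* a′ :+ (b :+ α :* b′)) refl α _ _ _ _ ⟩
      B₀ s t u v + B₀ s′ t′ u v ∎

    B₁-+ : ∀ s t s′ t′ u v → B₁ (s + s′) (t + t′) u v ≈ B₁ s t u v + B₁ s′ t′ u v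
    B₁-+ s t s′ t′ u v = begin
      B₁ (s + s′) (t + t′) u v
        ≈⟨ +-congˡ (*-congˡ (trans (^-congˡ (p ℕ.^ r) (solve 3 (λ t t′ v →
            (t :+ t′) :* v :+ (t :+ t′) :* v := t :* v :+ t :* v :+ (t′ :* v :+ t′ :* v)) refl t t′ v))
             (frobenius-+ r _ _))) ⟩
      _ ≈⟨ solve 9 (λ s t s′ t′ u v β a b → ((s :+ s′) :* v :+ (t :+ t′) :* u) :+ ((s :+ s′) :* v :+ (t :+ t′) :* u) :+ β :* (a :+ b)
             := ((s :* v :+ t :* u) :+ (s :* v :+ t :* u) :+ β :* a) :+ ((s′ :* v :+ t′ :* u) :+ (s′ :* v :+ t′ :* u) :+ β :* b))
             refl s t s′ t′ u v β _ _ ⟩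
      B₁ s t u v + B₁ s′ t′ u v ∎

    module _ (f : K.Carrier → K.Carrier) (f≈ : ∀ x → f x K.≈ (f₀ (x₀ x) (x₁ x) ⊕ f₁ (x₀ x) (x₁ x) ·ξ)) where
      f-cong : ∀ {x y} → x K.≈ y → f x K.≈ f y
      f-cong {x} {y} x≈y = K.trans (f≈ x) (K.trans (⊕-cong (f₀-cong (x₀-cong x≈y) (x₁-cong x≈y))
          (f₁-cong (x₀-cong x≈y) (x₁-cong x≈y))) (K.sym (f≈ y)))

      coordinate-planar : (∀ {s t s′ t′} → B₀ s t s′ t′ ≈ 0# → B₁ s t s′ t′ ≈ 0# →
                             (s ≈ 0# × t ≈ 0#) ⊎ (s′ ≈ 0# × t′ ≈ 0#)) → Planar f
      coordinate-planar kernel = planar f f-cong B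
        (λ x y → K.trans (f≈ (x K.+ y)) (K.trans
          (⊕-cong (trans (f₀-cong (x₀-+ x y) (x₁-+ x y)) (f₀-polarisation _ _ _ _))
              (trans (f₁-cong (x₀-+ x y) (x₁-+ x y)) (f₁-polarisation _ _ _ _)))
          (K.sym (+-⊕ (+-⊕ (f≈ x) (f≈ y)) K.refl))))
        (λ a x≈y → ⊕-cong (B₀-cong (x₀-cong x≈y) (x₁-cong x≈y)) (B₁-cong (x₀-cong x≈y) (x₁-cong x≈y)))
        (λ x y a → K.trans (⊕-cong (trans (B₀-cong (x₀-+ x y) (x₁-+ x y)) (B₀-+ _ _ _ _ _ _))
            (trans (B₁-cong (x₀-+ x y) (x₁-+ x y)) (B₁-+ _ _ _ _ _ _)))
          (⊕-+ _ _ _ _))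
        (λ {x} {a} eq → [ (λ (x₀≈0 , x₁≈0) → inj₁ (both-0 x₀≈0 x₁≈0)) , (λ (a₀≈0 , a₁≈0) → inj₂ (both-0 a₀≈0 a₁≈0)) ]′
          (kernel (1-coordinate-unique (K.trans eq 0-⊕)) (ξ-coordinate-unique (K.trans eq 0-⊕))))
        where
        B : K.Carrier → K.Carrier → K.Carrier
        B x y = B₀ (x₀ x) (x₁ x) (x₀ y) (x₁ y) ⊕ B₁ (x₀ x) (x₁ x) (x₀ y) (x₁ y) ·ξ
        x₀-+ : ∀ x y → x₀ (x K.+ y) ≈ x₀ x + x₀ y
        x₀-+ x y = x₀-⊕ (+-⊕ (coordinates-≈ x) (coordinates-≈ y))
        x₁-+ : ∀ x y → x₁ (x K.+ y) ≈ x₁ x + x₁ y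
        x₁-+ x y = x₁-⊕ (+-⊕ (coordinates-≈ x) (coordinates-≈ y))
        both-0 : ∀ {x} → x₀ x ≈ 0# → x₁ x ≈ 0# → x K.≈ K.0#
        both-0 {x} x₀≈0 x₁≈0 = K.trans (coordinates-≈ x) (K.trans (⊕-cong x₀≈0 x₁≈0) (K.sym 0-⊕))

      coordinate-unital : OddPeriod k₀ → OddPeriod k₁ → Nonsquare F (- α) → (∀ d → d ≉ 0# → ∃₂ λ r s → r * r + α * (s * s) ≈ d) →
                          IsUnital q (Π f) 𝒰
      coordinate-unital period₀ period₁ -α-nonsquare represents = norm-form-unital -α-nonsquare represents
        (^-congˡ (p ℕ.^ k₀ ℕ.+ 1)) (λ t≈ → ^-congˡ (p ℕ.^ i) (^-congˡ (p ℕ.^ k₁ ℕ.+ 1) t≈))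
        (power-parametrisation k₀ period₀) (frobenius-parametrisation i (λ _ → refl) (power-parametrisation k₁ period₁))
        f f-cong (λ x → x₀-⊕ (f≈ x))

-- Values of the norm forms, and the kernel of the polarisation in (a) and (b).

module Kernels (R : CommutativeRing c ℓ) {q : ℕ} (R-field : IsFieldOfOrder R q)
               {p N : ℕ} (p-prime : Prime p) (p≢2 : p ≢ 2) (q≡p^N : q ≡ p ℕ.^ N) where
  open PrimePowerField R R-field {N = N} p-prime p≢2 q≡p^N
  open NormPowers R R-field {N = N} p-prime p≢2 q≡p^N
  open import Relation.Binary.Reasoning.Setoid setoid

  -- One variable suffices for each value: `d` is either r² or αs².
  represents-nonsquare : ∀ {α} → Nonsquare R α → ∀ d → d ≉ 0# → ∃₂ λ r s → r * r + α * (s * s) ≈ d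
  represents-nonsquare {α} α-nonsquare d _ = [
    (λ (z , eq) → z , 0# , trans (solve 2 (λ z α → z :* z :+ α :* (con (+ 0) :* con (+ 0)) := z :* z) refl z α) eq) ,
    (λ (z , eq) → 0# , z , trans (solve 2 (λ z α → con (+ 0) :* con (+ 0) :+ α :* (z :* z) := α :* (z :* z)) refl z α) eq) ]′
    (square⊎a*square α-nonsquare d)

  -- If `d` is not a square it is -z², and s² + t² = -1 turns this into (sz)² + (tz)².
  represents-1 : Nonsquare R (- 1#) → ∀ d → d ≉ 0# → ∃₂ λ r s → r * r + 1# * (s * s) ≈ d
  represents-1 -1-nonsquare d _ = let s , t , s²+t²≈-1 , _ = -1-sum-of-squares -1-nonsquare in [
    (λ (z , eq) → z , 0# , trans (solve 1 (λ z → z :* z :+ con (+ 1) :* (con (+ 0) :* con (+ 0)) := z :* z) refl z) eq) ,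
    (λ (z , eq) → s * z , t * z , trans (solve 3 (λ s t z → s :* z :* (s :* z) :+ con (+ 1) :* (t :* z :* (t :* z)) :=
        (s :* s :+ t :* t) :* (z :* z)) refl s t z)
      (trans (*-congʳ s²+t²≈-1) eq)) ]′
    (square⊎a*square -1-nonsquare d)

  -- Here -1 is a square, because the count of squares would otherwise make q ≡ 3; so `α` and -α
  -- belong to the same square class.
  nonsquare-neg : q ≡ 1 [mod4] → ∀ {α} → Nonsquare R α → Nonsquare R (- α)
  nonsquare-neg (t , q≡1[4]) {α} α-nonsquare (z , z²≈-α) with square? (- 1#)
  ... | yes (i , i²≈-1) = α-nonsquare (i * z , (begin
    i * z * (i * z)      ≈⟨ solve 2 (λ i z → i :* z :* (i :* z) := i :* i :* (z :* z)) refl i z ⟩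
    i * i * (z * z)      ≈⟨ *-cong i²≈-1 z²≈-α ⟩
    - 1# * - α           ≈⟨ solve 1 (λ α → :- con (+ 1) :* :- α := α) refl α ⟩
    α                    ∎))
  ... | no -1-nonsquare = contradiction (residue[4]-unique {r = 1} {s = 3} (t , q≡1[4]) (-1-nonsquare⇒q≡3[4] -1-nonsquare)) (λ ())

  halve : ∀ {x y} → x + x + 0# * y ≈ 0# → x ≈ 0#
  halve {x} {y} eq = x+x≈0⇒x≈0 (trans (solve 2 (λ x y → x :+ x := x :+ x :+ con (+ 0) :* y) refl x y) eq)

  -- With u = s/t = −s′/t′ and w the polar form of t and t′, the equations give α = u^(P+1)/w^(pⁱ−1), a square.
  zhouPott-kernel : ∀ k i r {α} → OddPeriod k → Nonsquare R α → ∀ {s t s′ t′} →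
                    polar k s s′ + α * polar k t t′ ^ (p ℕ.^ i) ≈ 0# →
                    (s * t′ + t * s′) + (s * t′ + t * s′) + 0# * (t * t′ + t * t′) ^ (p ℕ.^ r) ≈ 0# →
                    (s ≈ 0# × t ≈ 0#) ⊎ (s′ ≈ 0# × t′ ≈ 0#)
  zhouPott-kernel k i r {α} period α-nonsquare {s} {t} {s′} {t′} eq₀ eq₁ = cases (t ≈? 0#) (s ≈? 0#) (t′ ≈? 0#)
    where
    P = p ℕ.^ k
    E≈0 : s * t′ + t * s′ ≈ 0#
    E≈0 = halve eq₁
    cases : Dec (t ≈ 0#) → Dec (s ≈ 0#) → Dec (t′ ≈ 0#) → (s ≈ 0# × t ≈ 0#) ⊎ (s′ ≈ 0# × t′ ≈ 0#)
    cases (yes t≈0) (yes s≈0) _ = inj₁ (s≈0 , t≈0)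
    cases (yes t≈0) (no s≉0) _ = inj₂ (polar-kernel k period s≉0 (begin
      polar k s s′                                   ≈⟨ +-identityʳ _ ⟨
      polar k s s′ + 0#                              ≈⟨ +-congˡ (trans (*-congˡ (0^p^k≈0 i polar≈0)) (zeroʳ α)) ⟨
      polar k s s′ + α * polar k t t′ ^ (p ℕ.^ i)    ≈⟨ eq₀ ⟩
      0#                                             ∎) , t′≈0)
      where
      t′≈0 : t′ ≈ 0#
      t′≈0 = xy≈0⇒y≈0 s≉0 (trans (trans (sym (+-identityʳ _)) (+-congˡ (sym (trans (*-congʳ t≈0) (zeroˡ s′))))) E≈0)
      polar≈0 : polar k t t′ ≈ 0#
      polar≈0 = trans (+-cong (trans (*-congˡ t′≈0) (zeroʳ _)) (trans (*-congʳ t≈0) (zeroˡ _))) (+-identityˡ 0#)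
    cases (no t≉0) _ (yes t′≈0) = inj₂ (xy≈0⇒y≈0 t≉0 (trans (trans (sym (+-identityˡ _))
        (+-congʳ (sym (trans (*-congˡ t′≈0) (zeroʳ s))))) E≈0) , t′≈0)
    cases (no t≉0) _ (no t′≉0) = contradiction (square-ratio (^-≉0 b w≉0) (*-cancelˡ-≉0 w≉0 (begin
      w * (u ^ a * u ^ a)                   ≈⟨ *-congˡ (^-homo-* u a a) ⟨
      w * u ^ (a ℕ.+ a)                     ≡⟨ ≡.cong (λ e → w * u ^ e) P+1≡a+a ⟨
      w * u ^ (P ℕ.+ 1)                     ≈⟨ *-comm w _ ⟩
      u ^ (P ℕ.+ 1) * w                     ≈⟨ u^[P+1]w≈αw^p^i ⟩
      α * w ^ (p ℕ.^ i)                     ≡⟨ ≡.cong (λ e → α * w ^ e) p^i≡1+2b ⟩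
      α * (w * w ^ (2 ℕ.* b))               ≡⟨ ≡.cong (λ e → α * (w * w ^ (b ℕ.+ e))) (ℕ.+-identityʳ b) ⟩
      α * (w * w ^ (b ℕ.+ b))               ≈⟨ *-congˡ (*-congˡ (^-homo-* w b b)) ⟩
      α * (w * (w ^ b * w ^ b))             ≈⟨ solve 3 (λ α w x → α :* (w :* x) := w :* (α :* x)) refl α w (w ^ b * w ^ b) ⟩
      w * (α * (w ^ b * w ^ b))             ∎))) α-nonsquare
      where
      w = polar k t t′
      u = s * inv t
      w≉0 : w ≉ 0#
      w≉0 = t′≉0 ∘ polar-kernel k period t≉0
      -- As `p` is odd, pⁱ - 1 = 2b and P + 1 = 2a, so after cancelling one `w` both remaining
      -- powers are squares and α = (uᵃ/wᵇ)².
      b = proj₁ (p^k-odd i)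
      p^i≡1+2b = proj₂ (p^k-odd i)
      a = 1 ℕ.+ proj₁ (p^k-odd k)
      P+1≡a+a : P ℕ.+ 1 ≡ a ℕ.+ a
      P+1≡a+a = odd+1 (p^k-odd k)
      ut≈s : u * t ≈ s
      ut≈s = trans (*-assoc s (inv t) t) (trans (*-congˡ (trans (*-comm _ _) (inv-inverse t≉0))) (*-identityʳ s))
      -ut′≈s′ : - (u * t′) ≈ s′
      -ut′≈s′ = *-cancelˡ-≉0 t≉0 (begin
        t * - (u * t′)           ≈⟨ solve 3 (λ t u t′ → t :* :- (u :* t′) := :- (u :* t :* t′)) refl t u t′ ⟩
        - (u * t * t′)           ≈⟨ -‿cong (*-congʳ ut≈s) ⟩
        - (s * t′)               ≈⟨ +-inverseʳ-unique _ _ E≈0 ⟨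
        t * s′                   ∎)
      u^[P+1]w≈αw^p^i : u ^ (P ℕ.+ 1) * w ≈ α * w ^ (p ℕ.^ i)
      u^[P+1]w≈αw^p^i = sym (trans (+-inverseʳ-unique _ _ eq₀) (trans (-‿cong (begin
        polar k s s′                       ≈⟨ polar-cong k ut≈s -ut′≈s′ ⟨
        polar k (u * t) (- (u * t′))       ≈⟨ polar-neg k (u * t) (u * t′) ⟩
        - polar k (u * t) (u * t′)         ≈⟨ -‿cong (polar-* k u t t′) ⟩
        - (u ^ (P ℕ.+ 1) * w)              ∎)) (-‿involutive _)))

-- Characteristic 3: the kernels of the polarisations in (c) and (d).

module Characteristic3 (R : CommutativeRing c ℓ) {q : ℕ} (R-field : IsFieldOfOrder R q)
                       {N : ℕ} (3-prime : Prime 3) (3≢2 : 3 ≢ 2) (q≡3^N : q ≡ 3 ℕ.^ N) where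
  open PrimePowerField R R-field {N = N} 3-prime 3≢2 q≡3^N
  open NormPowers R R-field {N = N} 3-prime 3≢2 q≡3^N
  open import Relation.Binary.Reasoning.Setoid setoid

  3≈0 : 1# + 1# + 1# ≈ 0#
  3≈0 = trans (trans (+-assoc 1# 1# 1#) (+-congˡ (+-congˡ (sym (+-identityʳ 1#))))) p·1≈0

  3x≈0 : ∀ x → (1# + 1# + 1#) * x ≈ 0#
  3x≈0 x = trans (*-congʳ 3≈0) (zeroˡ x)

  -- Disposes of the cases where `t` or `t′` is 0, common to (c) and (d): then `Y` vanishes, leaving
  -- s t′ + t s′ = 0 and s s′ = 0. Only `generic` depends on the family.
  degenerate : ∀ {s t s′ t′ Y} →
               (s * t′ + t * s′) + (s * t′ + t * s′) + 1# * Y ≈ 0# → (t * t′ ≈ 0# → Y ≈ 0#) →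
               (t * t′ ≈ 0# → s * s′ ≈ 0#) → (t ≉ 0# → t′ ≉ 0# → (s ≈ 0# × t ≈ 0#) ⊎ (s′ ≈ 0# × t′ ≈ 0#)) →
               (s ≈ 0# × t ≈ 0#) ⊎ (s′ ≈ 0# × t′ ≈ 0#)
  degenerate {s} {t} {s′} {t′} {Y} eq₁ Y≈0 ss′≈0 generic = cases (t ≈? 0#) (s ≈? 0#) (t′ ≈? 0#)
    where
    E≈0 : t * t′ ≈ 0# → s * t′ + t * s′ ≈ 0#
    E≈0 tt′≈0 = x+x≈0⇒x≈0 (trans (sym (+-identityʳ _)) (trans (+-congˡ (sym (trans (*-identityˡ Y) (Y≈0 tt′≈0)))) eq₁))
    cases : Dec (t ≈ 0#) → Dec (s ≈ 0#) → Dec (t′ ≈ 0#) → (s ≈ 0# × t ≈ 0#) ⊎ (s′ ≈ 0# × t′ ≈ 0#)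
    cases (yes t≈0) (yes s≈0) _ = inj₁ (s≈0 , t≈0)
    cases (yes t≈0) (no s≉0) _ = inj₂ (xy≈0⇒y≈0 s≉0 (ss′≈0 tt′≈0) ,
      xy≈0⇒y≈0 s≉0 (trans (trans (sym (+-identityʳ _)) (+-congˡ (sym (trans (*-congʳ t≈0) (zeroˡ s′))))) (E≈0 tt′≈0)))
      where tt′≈0 = trans (*-congʳ t≈0) (zeroˡ t′)
    cases (no t≉0) _ (yes t′≈0) = inj₂
      (xy≈0⇒y≈0 t≉0 (trans (trans (sym (+-identityˡ _)) (+-congʳ (sym (trans (*-congˡ t′≈0) (zeroʳ s))))) (E≈0 tt′≈0)) , t′≈0)
      where tt′≈0 = trans (*-congˡ t′≈0) (zeroʳ t)
    cases (no t≉0) _ (no t′≉0) = generic t≉0 t′≉0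

  -- s/t and s′/t′ are the roots of a quadratic whose discriminant, up to squares, is −(t⁴ + t′⁴)².
  cohenGanley-kernel : Nonsquare R (- 1#) → ∀ {s t s′ t′} →
    polar 0 s s′ + 1# * polar 2 t t′ ^ 1 ≈ 0# →
    (s * t′ + t * s′) + (s * t′ + t * s′) + 1# * (t * t′ + t * t′) ^ 3 ≈ 0# →
    (s ≈ 0# × t ≈ 0#) ⊎ (s′ ≈ 0# × t′ ≈ 0#)
  cohenGanley-kernel -1-nonsquare {s} {t} {s′} {t′} eq₀ eq₁ = degenerate eq₁
    (λ tt′≈0 → 0^p^k≈0 1 (trans (+-cong tt′≈0 tt′≈0) (+-identityˡ 0#)))
    (λ tt′≈0 → x+x≈0⇒x≈0 (trans (solve 5 (λ s t s′ t′ m → s :* s′ :+ s :* s′ :=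
        s :^ 1 :* s′ :+ s :* s′ :^ 1 :+ con (+ 1) :* (t :^ 9 :* t′ :+ t :* t′ :^ 9) :^ 1 :- t :* t′ :* (t :^ 8 :+ t′ :^ 8)) refl s
            t s′ t′ 0#)
      (trans (+-cong eq₀ (trans (-‿cong (trans (*-congʳ tt′≈0) (zeroˡ _))) -0#≈0#)) (+-identityˡ 0#))))
    (λ t≉0 t′≉0 → contradiction (generic t≉0 t′≉0) -1-nonsquare)
    where
    m = t * t′
    E = s * t′ + t * s′
    δ = s * t′ - t * s′
    v = t ^ 4 + t′ ^ 4
    b₀ = polar 0 s s′ + 1# * polar 2 t t′ ^ 1
    b₁ = E + E + 1# * (m + m) ^ 3
    -- Start from δ² = E² - 4m·ss′. The multiple b₁(b₁ - 16m³) = 4E² - 64m⁶ trades E² for m⁶, and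
    -- 2m·b₀ trades ss′ for m(t⁸ + t′⁸). What remains differs from -(mv)² by a multiple of 3, whose
    -- cofactor is written out.
    δ²≈ : δ * δ ≈ - 1# * (m * v * (m * v))
    δ²≈ = begin
      δ * δ
        ≈⟨ solve 4 (λ s t s′ t′ → let m = t :* t′; E = s :* t′ :+ t :* s′; δ = s :* t′ :- t :* s′; v = t :^ 4 :+ t′ :^ 4
                                      b₀ = s :^ 1 :* s′ :+ s :* s′ :^ 1 :+ con (+ 1) :* (t :^ 9 :* t′ :+ t :* t′ :^ 9) :^ 1
                                      b₁ = E :+ E :+ con (+ 1) :* (m :+ m) :^ 3 in
             δ :* δ := :- con (+ 1) :* (m :* v :* (m :* v)) :+ b₁ :* (b₁ :- con (+ 16) :* m :^ 3) :- con (+ 2) :* m :* b₀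
               :+ (con (+ 1) :+ con (+ 1) :+ con (+ 1)) :* (con (+ 22) :* m :^ 6 :+ m :* m :* (t :^ 8 :+ t′ :^ 8) :- E :* E)) refl
                   s t s′ t′ ⟩
      _ ≈⟨ +-cong (+-cong (+-congˡ (trans (*-congʳ eq₁) (zeroˡ _))) (-‿cong (trans (*-congˡ eq₀) (zeroʳ _)))) (3x≈0 _) ⟩
      - 1# * (m * v * (m * v)) + 0# - 0# + 0#
        ≈⟨ solve 1 (λ x → x :+ con (+ 0) :- con (+ 0) :+ con (+ 0) := x) refl _ ⟩
      - 1# * (m * v * (m * v)) ∎
    generic : t ≉ 0# → t′ ≉ 0# → ∃ λ z → z * z ≈ - 1#
    generic t≉0 t′≉0 with v ≈? 0#
    ... | no  v≉0 = square-ratio (xy≉0 (xy≉0 t≉0 t′≉0) v≉0) δ²≈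
    -- Here the discriminant gives nothing, but t⁴ = -t′⁴ already exhibits -1 as (t²/t′²)².
    ... | yes v≈0 = square-ratio (xy≉0 t′≉0 t′≉0) (begin
      t * t * (t * t)                ≈⟨ solve 1 (λ t → t :* t :* (t :* t) := t :^ 4) refl t ⟩
      t ^ 4                          ≈⟨ +-inverseˡ-unique _ _ v≈0 ⟩
      - (t′ ^ 4)                     ≈⟨ solve 1 (λ t → :- (t :^ 4) := :- con (+ 1) :* (t :* t :* (t :* t))) refl t′ ⟩
      - 1# * (t′ * t′ * (t′ * t′))   ∎)

  -- Modulo w¹¹ = 1 and 3 = 0: the residues mod 11 of the subset sums of {1, 3, 9, 5, 4} take the value 0
  -- twice and every other value three times.
  [1+w]^121≈-1 : ∀ {w} → w ^ 11 ≈ 1# → (1# + w) ^ 121 ≈ - 1#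
  [1+w]^121≈-1 {w} w¹¹≈1 = begin
    -- 121 = 1 + 3 + 9 + 27 + 81, so Frobenius splits the power into factors 1 + w^(3ᵏ); modulo 11,
    -- 27 and 81 become 5 and 4.
    y ^ 121
      ≈⟨ trans (^-homo-* y 1 120) (*-congˡ (trans (^-homo-* y 3 117) (*-congˡ (trans (^-homo-* y 9 108) (*-congˡ (^-homo-* y 27 81)))))) ⟩
    y ^ 1 * (y ^ 3 * (y ^ 9 * (y ^ 27 * y ^ 81)))
      ≈⟨ *-cong (*-identityʳ y) (*-cong (power 1) (*-cong (power 2)
          (*-cong (trans (power 3) (+-congˡ w²⁷≈w⁵)) (trans (power 4) (+-congˡ w⁸¹≈w⁴))))) ⟩
    y * ((1# + w ^ 3) * ((1# + w ^ 9) * ((1# + w ^ 5) * (1# + w ^ 4))))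
      ≈⟨ solve 1 (λ w → (:1 :+ w) :* ((:1 :+ w :^ 3) :* ((:1 :+ w :^ 9) :* ((:1 :+ w :^ 5) :* (:1 :+ w :^ 4)))) := A w :+ w :^ 11
          :* (B w :+ w :^ 11)) refl w ⟩
    _ ≈⟨ +-congˡ (*-cong w¹¹≈1 (+-congˡ w¹¹≈1)) ⟩
    _ ≈⟨ solve 1 (λ w → A w :+ :1 :* (B w :+ :1) := :- :1 :+ (:1 :+ :1 :+ :1) :* (:1 :+ nonzero w)) refl w ⟩
    - 1# + (1# + 1# + 1#) * _  ≈⟨ trans (+-congˡ (3x≈0 _)) (+-identityʳ _) ⟩
    - 1#                       ∎
    where
    y = 1# + w
    :1 : ∀ {n} → Polynomial n
    :1 = con (+ 1)
    -- The expanded product sorted by degree: `A` holds the terms below 11, and w¹¹(B + w¹¹) those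
    -- above.
    nonzero A B : ∀ {n} → Polynomial n → Polynomial n
    nonzero w = w :+ w :^ 2 :+ w :^ 3 :+ w :^ 4 :+ w :^ 5 :+ w :^ 6 :+ w :^ 7 :+ w :^ 8 :+ w :^ 9 :+ w :^ 10
    A w = :1 :+ nonzero w :- w :^ 2 :+ (w :^ 4 :+ w :^ 5 :+ w :^ 8 :+ w :^ 9 :+ w :^ 9 :+ w :^ 10)
    B w = nonzero w :- w :^ 9 :+ (w :+ w :^ 2 :+ w :^ 2 :+ w :^ 3 :+ w :^ 6 :+ w :^ 7)
    power : ∀ k → y ^ (3 ℕ.^ k) ≈ 1# + w ^ (3 ℕ.^ k)
    power k = trans (frobenius-+ k 1# w) (+-congʳ (1^n≈1 (3 ℕ.^ k)))
    reduce : ∀ k r → w ^ (11 ℕ.* k ℕ.+ r) ≈ w ^ r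
    reduce k r = begin
      w ^ (11 ℕ.* k ℕ.+ r)     ≈⟨ ^-homo-* w (11 ℕ.* k) r ⟩
      w ^ (11 ℕ.* k) * w ^ r   ≈⟨ *-congʳ (^-assocʳ w 11 k) ⟨
      (w ^ 11) ^ k * w ^ r     ≈⟨ *-congʳ (trans (^-congˡ k w¹¹≈1) (1^n≈1 k)) ⟩
      1# * w ^ r               ≈⟨ *-identityˡ _ ⟩
      w ^ r                    ∎
    w²⁷≈w⁵ : w ^ 27 ≈ w ^ 5
    w²⁷≈w⁵ = reduce 2 5
    w⁸¹≈w⁴ : w ^ 81 ≈ w ^ 4
    w⁸¹≈w⁴ = reduce 7 4

  -- Its 121st power is −1.
  1+m⁴⁴-nonsquare : q ≡ 243 → ∀ {m} → m ≉ 0# → Nonsquare R (1# + m ^ 44)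
  1+m⁴⁴-nonsquare q≡243 {m} m≉0 (z , z²≈) = 2≉0 (begin
    1# + 1#          ≈⟨ +-congˡ (x^242≈1 z≉0) ⟨
    1# + z ^ 242     ≈⟨ +-congˡ z^242≈-1 ⟩
    1# - 1#          ≈⟨ -‿inverseʳ 1# ⟩
    0#               ∎)
    where
    x^242≈1 : ∀ {x} → x ≉ 0# → x ^ 242 ≈ 1#
    x^242≈1 {x} x≉0 = *-cancelˡ-≉0 x≉0 (trans (≡.subst (λ q → x ^ q ≈ x) q≡243 (fermat x)) (sym (*-identityʳ x)))
    z^242≈-1 : z ^ 242 ≈ - 1#
    z^242≈-1 = begin
      z ^ 242                 ≈⟨ ^-assocʳ z 2 121 ⟨
      (z ^ 2) ^ 121           ≈⟨ ^-congˡ 121 (trans (*-congˡ (*-identityʳ z)) z²≈) ⟩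
      -- 44 · 11 = 242 · 2 and m²⁴² = 1, so m⁴⁴ is an eleventh root of unity.
      (1# + m ^ 44) ^ 121     ≈⟨ [1+w]^121≈-1 (trans (^-assocʳ m 44 11) (trans (sym (^-assocʳ m 242 2))
                                   (trans (^-congˡ 2 (x^242≈1 m≉0)) (1^n≈1 2)))) ⟩
      - 1#                    ∎
    z≉0 : z ≉ 0#
    z≉0 z≈0 = -x≉0 1≉0 (trans (sym z^242≈-1) (trans (^-congˡ 242 z≈0) (zeroˡ _)))

  -- The two equations say E = -m²⁷ and ss′ = -m⁹ for m = tt′. Since 4 = 1, the discriminant E² -
  -- 4m·ss′ is m⁵⁴ + m¹⁰ = m¹⁰(1 + m⁴⁴). It equals δ², which would make the nonsquare 1 + m⁴⁴ a
  -- square.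
  penttilaWilliams-kernel : q ≡ 243 → ∀ {s t s′ t′} →
    polar 0 s s′ + 1# * polar 0 t t′ ^ (3 ℕ.^ 2) ≈ 0# →
    (s * t′ + t * s′) + (s * t′ + t * s′) + 1# * (t * t′ + t * t′) ^ (3 ℕ.^ 3) ≈ 0# →
    (s ≈ 0# × t ≈ 0#) ⊎ (s′ ≈ 0# × t′ ≈ 0#)
  penttilaWilliams-kernel q≡243 {s} {t} {s′} {t′} eq₀ eq₁ = degenerate eq₁
    (λ m≈0 → 0^p^k≈0 3 (trans (+-cong m≈0 m≈0) (+-identityˡ 0#)))
    (λ m≈0 → trans ss′≈ (trans (-‿cong (0^p^k≈0 2 m≈0)) -0#≈0#))
    (λ t≉0 t′≉0 → contradiction (square-ratio (^-≉0 5 (xy≉0 t≉0 t′≉0)) δ²≈) (1+m⁴⁴-nonsquare q≡243 (xy≉0 t≉0 t′≉0)))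
    where
    m = t * t′
    E = s * t′ + t * s′
    δ = s * t′ - t * s′
    doubled : ∀ {x y} → x + x + (y + y) ≈ 0# → x ≈ - y
    doubled {x} {y} eq = +-inverseˡ-unique x y (x+x≈0⇒x≈0 (trans
      (solve 2 (λ x y → x :+ y :+ (x :+ y) := x :+ x :+ (y :+ y)) refl x y) eq))
    E≈ : E ≈ - m ^ 27
    E≈ = doubled (trans (+-congˡ (sym (trans (*-identityˡ _) (frobenius-+ 3 m m)))) eq₁)
    ss′≈ : s * s′ ≈ - m ^ 9
    ss′≈ = doubled (trans (sym (+-cong
      (solve 2 (λ s s′ → s :^ 1 :* s′ :+ s :* s′ :^ 1 := s :* s′ :+ s :* s′) refl s s′)
      (trans (*-identityˡ _) (trans (^-congˡ 9 (solve 2 (λ t t′ → t :^ 1 :* t′ :+ t :* t′ :^ 1 := t :* t′ :+ t :* t′) refl t t′))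
          (frobenius-+ 2 m m))))) eq₀)
    δ²≈ : δ * δ ≈ (1# + m ^ 44) * (m ^ 5 * m ^ 5)
    δ²≈ = begin
      δ * δ
        ≈⟨ solve 4 (λ s t s′ t′ → (s :* t′ :- t :* s′) :* (s :* t′ :- t :* s′) :=
             (s :* t′ :+ t :* s′) :* (s :* t′ :+ t :* s′) :- con (+ 4) :* (t :* t′) :* (s :* s′)) refl s t s′ t′ ⟩
      _ ≈⟨ +-cong (*-cong E≈ E≈) (-‿cong (*-congˡ ss′≈)) ⟩
      _ ≈⟨ solve 1 (λ m → :- (m :^ 27) :* :- (m :^ 27) :- con (+ 4) :* m :* :- (m :^ 9) :=
             (con (+ 1) :+ m :^ 44) :* (m :^ 5 :* m :^ 5) :+ (con (+ 1) :+ con (+ 1) :+ con (+ 1)) :* m :^ 10) refl m ⟩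
      _ ≈⟨ trans (+-congˡ (3x≈0 _)) (+-identityʳ _) ⟩
      (1# + m ^ 44) * (m ^ 5 * m ^ 5) ∎

-- Families (a) and (b).

module DicksonZhouPott (F : CommutativeRing c₁ ℓ₁) (K : CommutativeRing c₂ ℓ₂) (p n : ℕ)
                       (p-prime : Prime p) (p≢2 : p ≢ 2)
                       (E : QuadraticExtension F K (p ℕ.^ n)) (ξ : CommutativeRing.Carrier K)
                       (ξ∉F : ∀ s → ¬ CommutativeRing._≈_ K (QuadraticExtension.ι E s) ξ) where
  open QuadraticExtension E
  open Plane K
  open Setting F K p n E ξ ξ∉F
  open PlaneLemmas F K p n E ξ ξ∉F using (⊕-cong)
  open CoordinateFunctions F K p n p-prime p≢2 E ξ ξ∉F
  open PrimePowerField F F-field {N = n} p-prime p≢2 ≡.refl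
  open Kernels F F-field {N = n} p-prime p≢2 ≡.refl
  private
    q = p ℕ.^ n
    module K = CommutativeRing K

    double : ∀ x y → 2 · x ≈ x + x + 0# * y
    double x y = trans (+-congˡ (+-identityʳ x)) (solve 2 (λ x y → x :+ x := x :+ x :+ con (+ 0) :* y) refl x y)

  -- Stated for any `f` of this shape so that (a) is the instance k = 0, where x ↦ x^(p⁰) already is
  -- the identity; the callers only rewrite 2pⁱ and p^(k+i) + pⁱ as exponents of iterated powers.
  zhouPott-family : q ≡ 1 [mod4] → ∀ {α} → Nonsquare F α → ∀ i k → OddPeriod k → (f : K.Carrier → K.Carrier) →
                    (∀ x → f x K.≈ (f₀ k k i 0 α 0# (x₀ x) (x₁ x) ⊕ f₁ k k i 0 α 0# (x₀ x) (x₁ x) ·ξ)) →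
                    Planar f × IsUnital q (Π f) 𝒰
  zhouPott-family q≡1[4] {α} α-nonsquare i k period f f≈ =
    coordinate-planar k k i 0 α 0# f f≈ (zhouPott-kernel k i 0 period α-nonsquare) ,
    coordinate-unital k k i 0 α 0# f f≈ period period (nonsquare-neg q≡1[4] α-nonsquare) (represents-nonsquare α-nonsquare)

  dickson-planar-unital : q ≡ 1 [mod4] → ∀ {α} → Nonsquare F α → ∀ i →
                          Planar (dickson α i) × IsUnital q (Π (dickson α i)) 𝒰
  dickson-planar-unital q≡1[4] {α} α-nonsquare i = zhouPott-family q≡1[4] α-nonsquare i 0 (0 , *-identityʳ) (dickson α i)
    (λ x → ⊕-cong (+-congˡ (*-congˡ (sym (^-assocʳ (x₁ x) 2 (p ℕ.^ i))))) (double _ _))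

  zhouPott-planar-unital : q ≡ 1 [mod4] → ∀ {α} → Nonsquare F α → ∀ i k → OddCofactor k n →
                           Planar (zhouPott α i k) × IsUnital q (Π (zhouPott α i k)) 𝒰
  zhouPott-planar-unital q≡1[4] {α} α-nonsquare i k odd-cof = let j , r , j-odd , kj≡nr = odd-cofactor {k} {n} odd-cof in
    zhouPott-family q≡1[4] α-nonsquare i k (odd-period {k = k} {r = r} j-odd kj≡nr) (zhouPott α i k)
      (λ x → ⊕-cong (+-congˡ (*-congˡ (trans (reflexive (≡.cong (x₁ x ^_) (m^[k+i]+m^i≡[m^k+1]m^i p k i)))
          (sym (^-assocʳ (x₁ x) (p ℕ.^ k ℕ.+ 1) (p ℕ.^ i)))))) (double _ _))

-- Families (c) and (d).

module CohenGanleyPenttilaWilliams (F : CommutativeRing c₁ ℓ₁) (K : CommutativeRing c₂ ℓ₂) (n : ℕ)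
                                   (3-prime : Prime 3) (3≢2 : 3 ≢ 2)
                                   (E : QuadraticExtension F K (3 ℕ.^ n)) (ξ : CommutativeRing.Carrier K)
                                   (ξ∉F : ∀ s → ¬ CommutativeRing._≈_ K (QuadraticExtension.ι E s) ξ)
                                   (n-odd : Odd n) where
  open QuadraticExtension E
  open Plane K
  open Setting F K 3 n E ξ ξ∉F
  open PlaneLemmas F K 3 n E ξ ξ∉F using (⊕-cong)
  open CoordinateFunctions F K 3 n 3-prime 3≢2 E ξ ξ∉F
  open PrimePowerField F F-field {N = n} 3-prime 3≢2 ≡.refl
  open Kernels F F-field {N = n} 3-prime 3≢2 ≡.refl
  open Characteristic3 F F-field {N = n} 3-prime 3≢2 ≡.refl
  private
    q = 3 ℕ.^ n

    -1-nonsquare : Nonsquare F (- 1#)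
    -1-nonsquare = q≡3[4]⇒-1-nonsquare (^-odd[4] n (1 , ≡.refl) n-odd) 2≉0

  cohenGanley-planar-unital : Planar cohenGanley × IsUnital q (Π cohenGanley) 𝒰
  cohenGanley-planar-unital = coordinate-planar 0 2 0 1 1# 1# cohenGanley f≈ (cohenGanley-kernel -1-nonsquare) ,
    -- The period for k₁ = 2: `n` applications of x ↦ x⁹ are two of x ↦ x^q, and `n` is odd.
    coordinate-unital 0 2 0 1 1# 1# cohenGanley f≈ (0 , *-identityʳ) (odd-period {k = 2} {r = 2} n-odd (ℕ.*-comm 2 n))
      -1-nonsquare (represents-1 -1-nonsquare)
    where
    f≈ : ∀ x → CommutativeRing._≈_ K (cohenGanley x) (f₀ 0 2 0 1 1# 1# (x₀ x) (x₁ x) ⊕ f₁ 0 2 0 1 1# 1# (x₀ x) (x₁ x) ·ξ)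
    f≈ x = ⊕-cong
      (+-congˡ (solve 1 (λ t → t :^ 10 := con (+ 1) :* (t :^ 10) :^ 1) refl (x₁ x)))
      (+-cong (+-congˡ (+-identityʳ _)) (solve 1 (λ t → t :^ 6 := con (+ 1) :* (t :* t) :^ 3) refl (x₁ x)))

  penttilaWilliams-planar-unital : n ≡ 5 → Planar penttilaWilliams × IsUnital q (Π penttilaWilliams) 𝒰
  penttilaWilliams-planar-unital n≡5 =
    coordinate-planar 0 0 2 3 1# 1# penttilaWilliams f≈ (penttilaWilliams-kernel (≡.cong (3 ℕ.^_) n≡5)) ,
    coordinate-unital 0 0 2 3 1# 1# penttilaWilliams f≈ (0 , *-identityʳ) (0 , *-identityʳ) -1-nonsquare (represents-1 -1-nonsquare)
    where
    f≈ : ∀ x → CommutativeRing._≈_ K (penttilaWilliams x) (f₀ 0 0 2 3 1# 1# (x₀ x) (x₁ x) ⊕ f₁ 0 0 2 3 1# 1# (x₀ x) (x₁ x) ·ξ)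
    f≈ x = ⊕-cong
      (+-congˡ (solve 1 (λ t → t :^ 18 := con (+ 1) :* (t :^ 2) :^ 9) refl (x₁ x)))
      (+-cong (+-congˡ (+-identityʳ _)) (solve 1 (λ t → t :^ 54 := con (+ 1) :* (t :* t) :^ 27) refl (x₁ x)))

-- Family (e): conjugation, trace and squares in K over F.

module BudaghyanHelleseth (F : CommutativeRing c₁ ℓ₁) (K : CommutativeRing c₂ ℓ₂) (p n : ℕ)
                          (p-prime : Prime p) (p≢2 : p ≢ 2)
                          (E : QuadraticExtension F K (p ℕ.^ n)) (ξ : CommutativeRing.Carrier K)
                          (ξ∉F : ∀ s → ¬ CommutativeRing._≈_ K (QuadraticExtension.ι E s) ξ)
                          (q≡3[4] : p ℕ.^ n ≡ 3 [mod4]) where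
  open QuadraticExtension E
  open Plane K
  open Setting F K p n E ξ ξ∉F
  open PlaneLemmas F K p n E ξ ξ∉F
  private
    q = p ℕ.^ n
    module ι = IsRingMonomorphism ι-mono
    module F where
      open PrimePowerField F F-field {N = n} p-prime p≢2 ≡.refl public
      open Kernels F F-field {N = n} p-prime p≢2 ≡.refl public
  open PrimePowerField K K-field {N = n ℕ.* 2} p-prime p≢2 (ℕ.^-*-assoc p n 2)
  open NormPowers K K-field {N = n ℕ.* 2} p-prime p≢2 (ℕ.^-*-assoc p n 2)
  open import Relation.Binary.Reasoning.Setoid setoid

  private
    p-odd : Odd p
    p-odd = odd-prime p-prime p≢2

    n-odd : Odd n
    n-odd = odd-exponent n p-odd q≡3[4]

    p≡3[4] : p ≡ 3 [mod4]
    p≡3[4] = odd-base[4] n p-odd n-odd q≡3[4]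

    -1-nonsquare : Nonsquare F (F.- F.1#)
    -1-nonsquare = F.q≡3[4]⇒-1-nonsquare q≡3[4] F.2≉0

    -- The order of K is q² ≡ 1 (mod 4), while a field in which -1 is a nonsquare has order 3 modulo
    -- 4.
    i-exists : ∃ λ i → i * i ≈ - 1#
    i-exists with square? (- 1#)
    ... | yes i = i
    ... | no -1-nonsquareₖ = contradiction
      (residue[4]-unique {r = 3} {s = 1} (-1-nonsquare⇒q≡3[4] -1-nonsquareₖ) (odd-square[4] (odd-^ n p-odd))) (λ ())
    i = proj₁ i-exists
    i²≈-1 = proj₂ i-exists

    i≉0 : i ≉ 0#
    i≉0 i≈0 = -x≉0 1≉0 (trans (sym i²≈-1) (trans (*-congʳ i≈0) (zeroˡ i)))

    i^m≈-i : ∀ {m} → m ≡ 3 [mod4] → i ^ m ≈ - i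
    i^m≈-i (t , ≡.refl) = i^[3+4t]≈-i i²≈-1 t

    i^m≈i : ∀ {m} → m ≡ 1 [mod4] → i ^ m ≈ i
    i^m≈i (t , ≡.refl) = i^[1+4t]≈i i²≈-1 t

    ι-^ : ∀ s m → ι (s F.^ m) ≈ ι s ^ m
    ι-^ s zero    = ι.1#-homo
    ι-^ s (suc m) = trans (ι.*-homo s (s F.^ m)) (*-congˡ (ι-^ s m))

    ι-fixed : ∀ s → ι s ^ q ≈ ι s
    ι-fixed s = trans (sym (ι-^ s q)) (ι.⟦⟧-cong (F.fermat s))

    conj-⊕ : ∀ s t → (s ⊕ t ·ξ) ^ q ≈ ι s + ι t * ξ ^ q
    conj-⊕ s t = trans (frobenius-+ n (ι s) (ι t * ξ)) (+-cong (ι-fixed s) (trans (^-distrib-* (ι t) ξ q) (*-congʳ (ι-fixed t))))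

    -- If conjugation fixed ξ it would fix all of K, but it sends `i` to -i because q ≡ 3 (mod 4).
    ξ^q≉ξ : ξ ^ q ≉ ξ
    ξ^q≉ξ ξ^q≈ξ = i≉0 (x≈-x⇒x≈0 (begin
      i                              ≈⟨ coordinates-≈ i ⟩
      (x₀ i ⊕ x₁ i ·ξ)               ≈⟨ +-congˡ (*-congˡ ξ^q≈ξ) ⟨
      ι (x₀ i) + ι (x₁ i) * ξ ^ q    ≈⟨ conj-⊕ (x₀ i) (x₁ i) ⟨
      (x₀ i ⊕ x₁ i ·ξ) ^ q           ≈⟨ ^-congˡ q (coordinates-≈ i) ⟨
      i ^ q                          ≈⟨ i^m≈-i q≡3[4] ⟩
      - i                            ∎))

    -- Subtracting x₀ + x₁ξ from its conjugate leaves x₁(ξ^q - ξ) = 0.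
    fixed⇒∈F : ∀ {x} → x ^ q ≈ x → x ≈ ι (x₀ x)
    fixed⇒∈F {x} x^q≈x = begin
      x                        ≈⟨ coordinates-≈ x ⟩
      ι (x₀ x) + ι (x₁ x) * ξ  ≈⟨ +-congˡ (*-congʳ ιx₁≈0) ⟩
      ι (x₀ x) + 0# * ξ        ≈⟨ solve 2 (λ s ξ → s :+ con (+ 0) :* ξ := s) refl (ι (x₀ x)) ξ ⟩
      ι (x₀ x)                 ∎
      where
      ιx₁≈0 : ι (x₁ x) ≈ 0#
      ιx₁≈0 = xy≈0⇒y≈0 {ξ ^ q - ξ} (ξ^q≉ξ ∘ x-y≈0⇒x≈y) (begin
        (ξ ^ q - ξ) * ι (x₁ x)
          ≈⟨ solve 4 (λ s t ξ ξ′ → (ξ′ :- ξ) :* t := s :+ t :* ξ′ :- (s :+ t :* ξ)) refl (ι (x₀ x)) (ι (x₁ x)) ξ (ξ ^ q) ⟩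
        ι (x₀ x) + ι (x₁ x) * ξ ^ q - (x₀ x ⊕ x₁ x ·ξ)
          ≈⟨ x≈y⇒x∙y⁻¹≈ε (trans (sym (conj-⊕ _ _)) (trans (^-congˡ q (sym (coordinates-≈ x))) (trans x^q≈x (coordinates-≈ x)))) ⟩
        0# ∎)

    -- An element of F is plus or minus a square of F, and -1 = i² in K.
    ι-square : ∀ s → ∃ λ z → z * z ≈ ι s
    ι-square s = [ (λ (z , z²≈s) → ι z , trans (sym (ι.*-homo z z)) (ι.⟦⟧-cong z²≈s)) ,
      (λ (z , -z²≈s) → i * ι z , (begin
        i * ι z * (i * ι z)        ≈⟨ solve 2 (λ i z → i :* z :* (i :* z) := i :* i :* (z :* z)) refl i (ι z) ⟩
        i * i * (ι z * ι z)        ≈⟨ *-cong i²≈-1 (sym (ι.*-homo z z)) ⟩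
        - 1# * ι (z F.* z)         ≈⟨ -1*x≈-x _ ⟩
        - ι (z F.* z)              ≈⟨ ι.-‿homo _ ⟨
        ι (F.- (z F.* z))          ≈⟨ ι.⟦⟧-cong (F.trans (F.sym (F.-1*x≈-x _)) -z²≈s) ⟩
        ι s                        ∎)) ]′
      (F.square⊎a*square -1-nonsquare s)

    -- (1 + i)² = 2i, and 2 is a square because it lies in F.
    i-square : ∃ λ z → z * z ≈ i
    i-square = let y , y²≈2 = ι-square (F.1# F.+ F.1#)
                   y²≈1+1 = trans y²≈2 (trans (ι.+-homo _ _) (+-cong ι.1#-homo ι.1#-homo))
      in square-ratio (λ y≈0 → 2≉0 (trans (sym y²≈1+1) (trans (*-congʳ y≈0) (zeroˡ y)))) (begin
        (1# + i) * (1# + i)        ≈⟨ solve 1 (λ i → (con (+ 1) :+ i) :* (con (+ 1) :+ i) := con (+ 1) :+ i :* i :+ i :*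
            (con (+ 1) :+ con (+ 1))) refl i ⟩
        1# + i * i + i * (1# + 1#) ≈⟨ +-congʳ (+-congˡ i²≈-1) ⟩
        1# - 1# + i * (1# + 1#)    ≈⟨ solve 1 (λ x → con (+ 1) :- con (+ 1) :+ x := x) refl _ ⟩
        i * (1# + 1#)              ≈⟨ *-congˡ y²≈1+1 ⟨
        i * (y * y)                ∎)

    fixed⇒square : ∀ {x} → x ^ q ≈ x → ∃ λ z → z * z ≈ x
    fixed⇒square {x} x^q≈x = let z , z²≈ = ι-square (x₀ x) in z , trans z²≈ (sym (fixed⇒∈F x^q≈x))

    -- Conjugation negates both `x` and `i`, so it fixes `x * i`, which is thus a square y². With i
    -- = z², x = -(xi)i = (iyz)².
    anti-fixed⇒square : ∀ {x} → x ^ q ≈ - x → ∃ λ z → z * z ≈ x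
    anti-fixed⇒square {x} x^q≈-x = i * (y * z) , (begin
      i * (y * z) * (i * (y * z))     ≈⟨ solve 3 (λ i y z → i :* (y :* z) :* (i :* (y :* z)) := i :* i :* (y :* y :* (z :* z))) refl i y z ⟩
      i * i * (y * y * (z * z))       ≈⟨ *-congˡ (*-cong y²≈ z²≈) ⟩
      i * i * (x * i * i)             ≈⟨ solve 2 (λ i x → i :* i :* (x :* i :* i) := i :* i :* (i :* i) :* x) refl i x ⟩
      i * i * (i * i) * x             ≈⟨ *-congʳ (*-cong i²≈-1 i²≈-1) ⟩
      - 1# * - 1# * x                 ≈⟨ solve 1 (λ x → :- con (+ 1) :* :- con (+ 1) :* x := x) refl x ⟩
      x                               ∎)
      where
      xi-square = fixed⇒square {x * i} (trans (^-distrib-* x i q) (trans (*-cong x^q≈-x (i^m≈-i q≡3[4]))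
        (solve 2 (λ x i → :- x :* :- i := x :* i) refl x i)))
      y = proj₁ xi-square
      y²≈ = proj₂ xi-square
      z = proj₁ i-square
      z²≈ = proj₂ i-square

    conj-conj : ∀ x → (x ^ q) ^ q ≈ x
    conj-conj x = trans (^-assocʳ x q q) (trans (reflexive (≡.cong (λ e → x ^ (q ℕ.* e)) (≡.sym (ℕ.*-identityʳ q)))) (fermat x))

    Tr : Carrier → Carrier
    Tr x = x + x ^ q

    Tr-fixed : ∀ x → Tr x ^ q ≈ Tr x
    Tr-fixed x = trans (frobenius-+ n x (x ^ q)) (trans (+-congˡ (conj-conj x)) (+-comm _ _))

    Tr-cong : ∀ {x y} → x ≈ y → Tr x ≈ Tr y
    Tr-cong x≈y = +-cong x≈y (^-congˡ q x≈y)

    Tr-+ : ∀ x y → Tr (x + y) ≈ Tr x + Tr y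
    Tr-+ x y = trans (+-congˡ (frobenius-+ n x y)) (solve 4 (λ x y x′ y′ → x :+ y :+ (x′ :+ y′) := x :+ x′ :+ (y :+ y′)) refl x y
        (x ^ q) (y ^ q))

    Tr-ι : ∀ s x → Tr (ι s * x) ≈ ι s * Tr x
    Tr-ι s x = trans (+-congˡ (trans (^-distrib-* (ι s) x q) (*-congʳ (ι-fixed s)))) (sym (distribˡ _ _ _))

    norm-fixed : ∀ x → (x ^ (q ℕ.+ 1)) ^ q ≈ x ^ (q ℕ.+ 1)
    norm-fixed x = begin
      (x ^ (q ℕ.+ 1)) ^ q      ≈⟨ ^-congˡ q (trans (^-homo-* x q 1) (*-congˡ (*-identityʳ x))) ⟩
      (x ^ q * x) ^ q          ≈⟨ ^-distrib-* (x ^ q) x q ⟩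
      (x ^ q) ^ q * x ^ q      ≈⟨ *-congʳ (conj-conj x) ⟩
      x * x ^ q                ≈⟨ *-comm x _ ⟩
      x ^ q * x                ≈⟨ trans (^-homo-* x q 1) (*-congˡ (*-identityʳ x)) ⟨
      x ^ (q ℕ.+ 1)            ∎

    polar-fixed : ∀ x y → polar n x y ^ q ≈ polar n x y
    polar-fixed x y = begin
      (x ^ q * y + x * y ^ q) ^ q                    ≈⟨ frobenius-+ n _ _ ⟩
      (x ^ q * y) ^ q + (x * y ^ q) ^ q              ≈⟨ +-cong (^-distrib-* _ _ q) (^-distrib-* _ _ q) ⟩
      (x ^ q) ^ q * y ^ q + x ^ q * (y ^ q) ^ q      ≈⟨ +-cong (*-congʳ (conj-conj x)) (*-congˡ (conj-conj y)) ⟩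
      x * y ^ q + x ^ q * y                          ≈⟨ +-comm _ _ ⟩
      x ^ q * y + x * y ^ q                          ∎

    fixed-^ : ∀ {s} k → s F.^ p F.≈ s → s F.^ (p ℕ.^ k) F.≈ s
    fixed-^ {s} zero    _ = F.*-identityʳ s
    fixed-^ {s} (suc k) s^p≈s = F.trans (F.sym (F.^-assocʳ s p (p ℕ.^ k))) (F.trans (F.^-congˡ (p ℕ.^ k) s^p≈s) (fixed-^ k s^p≈s))

    -- Frobenius sends `s` to `s` or to -s; as `n` is odd, the second happens only for s = 0.
    root-fixed : ∀ {s} → (s F.* s) F.^ p F.≈ s F.* s → s F.^ p F.≈ s
    root-fixed {s} s²-fixed = [ (λ s^p≈s → s^p≈s) , (λ s^p≈-s → let s≈0 = s≈0 s^p≈-s in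
                                                                      F.trans s^p≈-s (F.trans (F.-‿cong s≈0)
                                                                          (F.trans F.-0#≈0# (F.sym s≈0)))) ]′
      (F.x²≈y²⇒x≈±y (F.trans (F.sym (F.^-distrib-* s s p)) s²-fixed))
      where
      s≈0 : s F.^ p F.≈ F.- s → s F.≈ F.0#
      s≈0 s^p≈-s = F.anti-fixed⇒0 1 (F.odd-period {k = 1} {r = 1} n-odd (ℕ.*-comm 1 n))
        (≡.subst (λ e → s F.^ e F.≈ F.- s) (≡.sym (ℕ.*-identityʳ p)) s^p≈-s)

  module _ (k : ℕ) where
    private
      P = p ℕ.^ k

      period : F.OddPeriod k
      period = F.odd-period {k = k} {r = k} n-odd (ℕ.*-comm k n)

      -- For even k take μ = i; for odd k take μ = s + ti with s² + t² = −1 and s, t in the prime field.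
      P+1-root-of--1 : ∃ λ μ → μ ^ (P ℕ.+ 1) ≈ - 1#
      P+1-root-of--1 = [ even , odd-k ]′ (even⊎odd k)
        where
        by-conjugate : ∀ μ ν → μ ^ P ≈ ν → ν * μ ≈ - 1# → ∃ λ μ → μ ^ (P ℕ.+ 1) ≈ - 1#
        by-conjugate μ ν μ^P≈ν νμ≈-1 = μ , trans (^-homo-* μ P 1) (trans (*-cong μ^P≈ν (*-identityʳ μ)) νμ≈-1)
        even : (∃ λ h → k ≡ 2 ℕ.* h) → ∃ λ μ → μ ^ (P ℕ.+ 1) ≈ - 1#
        even (h , k≡2h) = by-conjugate i i (i^m≈i (≡.subst (λ e → p ℕ.^ e ≡ 1 [mod4]) (≡.sym k≡2h) (even-power[4] h p-odd))) i²≈-1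
        odd-k : Odd k → ∃ λ μ → μ ^ (P ℕ.+ 1) ≈ - 1#
        odd-k k-odd = by-conjugate (ι s + ι t * i) (ι s - ι t * i)
          (begin
            (ι s + ι t * i) ^ P              ≈⟨ frobenius-+ k _ _ ⟩
            ι s ^ P + (ι t * i) ^ P          ≈⟨ +-congˡ (^-distrib-* (ι t) i P) ⟩
            ι s ^ P + ι t ^ P * i ^ P        ≈⟨ +-cong (prime-field s s²-fixed)
                (*-cong (prime-field t t²-fixed) (i^m≈-i (^-odd-3[4] k p≡3[4] k-odd))) ⟩
            ι s + ι t * - i                  ≈⟨ +-congˡ (-‿distribʳ-* _ _) ⟨
            ι s - ι t * i                    ∎)
          (begin
            (ι s - ι t * i) * (ι s + ι t * i)  ≈⟨ solve 3 (λ s t i →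
                (s :- t :* i) :* (s :+ t :* i) := s :* s :- i :* i :* (t :* t)) refl (ι s) (ι t) i ⟩
            ι s * ι s - i * i * (ι t * ι t)    ≈⟨ +-congˡ (-‿cong (*-congʳ i²≈-1)) ⟩
            ι s * ι s - - 1# * (ι t * ι t)     ≈⟨ solve 2 (λ x y → x :- :- con (+ 1) :* y := x :+ y) refl _ _ ⟩
            ι s * ι s + ι t * ι t              ≈⟨ trans (ι.+-homo _ _) (+-cong (ι.*-homo s s) (ι.*-homo t t)) ⟨
            ι (s F.* s F.+ t F.* t)            ≈⟨ ι.⟦⟧-cong s²+t²≈-1 ⟩
            ι (F.- F.1#)                       ≈⟨ trans (ι.-‿homo _) (-‿cong ι.1#-homo) ⟩
            - 1#                               ∎)
          where
          sum-of-squares = F.-1-sum-of-squares -1-nonsquare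
          s = proj₁ sum-of-squares
          t = proj₁ (proj₂ sum-of-squares)
          s²+t²≈-1 = proj₁ (proj₂ (proj₂ sum-of-squares))
          s²-fixed = proj₁ (proj₂ (proj₂ (proj₂ sum-of-squares)))
          t²-fixed = proj₂ (proj₂ (proj₂ (proj₂ sum-of-squares)))
          prime-field : ∀ s → (s F.* s) F.^ p F.≈ s F.* s → ι s ^ P ≈ ι s
          prime-field s s²-fixed = trans (sym (ι-^ s P)) (ι.⟦⟧-cong (fixed-^ k (root-fixed s²-fixed)))

      -- Squares of F are (P+1)-st powers already in F, by the reparametrisation; -1 needs an
      -- element `μ` of K.
      P+1-root : ∀ d → ∃ λ ν → ν ^ (P ℕ.+ 1) ≈ ι d
      P+1-root d = [ (λ (z , z²≈d) → ι (ψ z) , trans (ι-root z) (ι.⟦⟧-cong z²≈d)) ,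
        (λ (z , -z²≈d) → μ * ι (ψ z) , (begin
          (μ * ι (ψ z)) ^ (P ℕ.+ 1)            ≈⟨ ^-distrib-* μ (ι (ψ z)) (P ℕ.+ 1) ⟩
          μ ^ (P ℕ.+ 1) * ι (ψ z) ^ (P ℕ.+ 1)  ≈⟨ *-cong μ^[P+1]≈-1 (ι-root z) ⟩
          - 1# * ι (z F.* z)                   ≈⟨ *-congʳ (trans (ι.-‿homo _) (-‿cong ι.1#-homo)) ⟨
          ι (F.- F.1#) * ι (z F.* z)           ≈⟨ ι.*-homo _ _ ⟨
          ι (F.- F.1# F.* (z F.* z))           ≈⟨ ι.⟦⟧-cong -z²≈d ⟩
          ι d                                  ∎)) ]′
        (F.square⊎a*square -1-nonsquare d)
        where
        μ = proj₁ P+1-root-of--1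
        μ^[P+1]≈-1 = proj₂ P+1-root-of--1
        ψ : F.Carrier → F.Carrier
        ψ z = z F.^ (1 ℕ.+ 2 ℕ.* proj₁ (F.norm-root k period))
        ι-root : ∀ z → ι (ψ z) ^ (P ℕ.+ 1) ≈ ι (z F.* z)
        ι-root z = trans (sym (ι-^ (ψ z) (P ℕ.+ 1))) (ι.⟦⟧-cong (proj₂ (F.norm-root k period) z))

    module _ {b : Carrier} (b-nonsquare : Nonsquare K b) where
      private
        f = budaghyanHelleseth b k

        f-cong : ∀ {x y} → x ≈ y → f x ≈ f y
        f-cong x≈y = +-cong (Tr-cong (*-congˡ (^-congˡ (P ℕ.+ 1) x≈y))) (*-congˡ (^-congˡ (q ℕ.+ 1) x≈y))

        -- P + 1 is even, so x^(P+1) is a nonzero square and does not change the square class of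
        -- `b`.
        c-nonsquare : ∀ {x} → x ≉ 0# → Nonsquare K (b * x ^ (P ℕ.+ 1))
        c-nonsquare {x} x≉0 (z , z²≈) = b-nonsquare (square-ratio (^-≉0 a x≉0) (trans z²≈ (*-congˡ (trans
          (reflexive (≡.cong (x ^_) (odd+1 (p^k-odd k)))) (^-homo-* x a a)))))
          where
          a = 1 ℕ.+ proj₁ (p^k-odd k)

        T : Carrier → Carrier
        T x = Tr (b * x ^ (P ℕ.+ 1))

        -- `f` is a trace plus ξ times a norm, and both are fixed by conjugation, so they are its
        -- two coordinates. The same reading applies to the polarisation.
        trace-norm-⊕ : ∀ {x y} → x ^ q ≈ x → y ^ q ≈ y → x + ξ * y ≈ (x₀ x ⊕ x₀ y ·ξ)
        trace-norm-⊕ x-fixed y-fixed = +-cong (fixed⇒∈F x-fixed) (trans (*-comm ξ _) (*-congʳ (fixed⇒∈F y-fixed)))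

        ι[x₀f]≈T : ∀ x → ι (x₀ (f x)) ≈ T x
        ι[x₀f]≈T x = trans (ι.⟦⟧-cong (x₀-⊕ (trace-norm-⊕ (Tr-fixed _) (norm-fixed x)))) (sym (fixed⇒∈F (Tr-fixed _)))

        T≈0⇒x≈0 : ∀ {x} → T x ≈ 0# → x ≈ 0#
        T≈0⇒x≈0 {x} Tx≈0 with x ≈? 0#
        ... | yes x≈0 = x≈0
        ... | no  x≉0 = contradiction (anti-fixed⇒square (+-inverseʳ-unique _ _ Tx≈0)) (c-nonsquare x≉0)

        T-scale : ∀ {ν} d → ν ^ (P ℕ.+ 1) ≈ ι d → ∀ x → T (ν * x) ≈ ι d * T x
        T-scale {ν} d ν-root x = trans (Tr-cong (begin
          b * (ν * x) ^ (P ℕ.+ 1)               ≈⟨ *-congˡ (^-distrib-* ν x (P ℕ.+ 1)) ⟩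
          b * (ν ^ (P ℕ.+ 1) * x ^ (P ℕ.+ 1))   ≈⟨ *-congˡ (*-congʳ ν-root) ⟩
          b * (ι d * x ^ (P ℕ.+ 1))             ≈⟨ solve 3 (λ b d x → b :* (d :* x) := d :* (b :* x)) refl b (ι d) _ ⟩
          ι d * (b * x ^ (P ℕ.+ 1))             ∎)) (Tr-ι d _)

        0^[m+1]≈0 : ∀ m → 0# ^ (m ℕ.+ 1) ≈ 0#
        0^[m+1]≈0 m = trans (^-homo-* 0# m 1) (trans (*-congˡ (zeroˡ 1#)) (zeroʳ _))

      budaghyanHelleseth-unital : IsUnital q (Π (budaghyanHelleseth b k)) 𝒰
      budaghyanHelleseth-unital = unital f f-cong (fibre-sizes F-field order (x₀ ∘ f) (x₀-cong ∘ f-cong) 0#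
        (ι.injective (trans (ι[x₀f]≈T 0#) (trans T0≈0 (sym ι.0#-homo))))
        (λ {x} gx≈0 → sym (T≈0⇒x≈0 (trans (sym (ι[x₀f]≈T x)) (trans (ι.⟦⟧-cong gx≈0) ι.0#-homo))))
        scale)
        where
        T0≈0 : T 0# ≈ 0#
        T0≈0 = trans (Tr-cong (trans (*-congˡ (0^[m+1]≈0 P)) (zeroʳ b))) (trans (+-identityˡ _) (0^p^k≈0 n refl))
        scale : ∀ d → d F.≉ F.0# → ∃ λ (M : Carrier → Carrier) → (∀ {x y} → M x ≈ M y → x ≈ y) × (∀ x → x₀ (f (M x)) F.≈ d F.* x₀ (f x))
        scale d d≉0 = let ν , ν-root = P+1-root d in (ν *_) ,
          *-cancelˡ-≉0 (λ ν≈0 → d≉0 (ι.injective (trans (sym ν-root)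
              (trans (^-congˡ (P ℕ.+ 1) ν≈0) (trans (0^[m+1]≈0 P) (sym ι.0#-homo)))))) ,
          (λ x → ι.injective (begin
            ι (x₀ (f (ν * x)))     ≈⟨ ι[x₀f]≈T (ν * x) ⟩
            T (ν * x)              ≈⟨ T-scale d ν-root x ⟩
            ι d * T x              ≈⟨ *-congˡ (ι[x₀f]≈T x) ⟨
            ι d * ι (x₀ (f x))     ≈⟨ ι.*-homo d _ ⟨
            ι (d F.* x₀ (f x))     ∎))

      -- For t = x/a, the ξ-coordinate of `B x a` = 0 says t^q = -t. Then s = t^P + t also satisfies
      -- s^q = -s, so the trace condition reads s(γ - γ^q) = 0 with γ = b·a^(P+1) a nonsquare.
      -- Elements of F are squares in K, so γ ≠ γ^q, whence s = 0 and t^P = -t. For even `k` the two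
      -- sign rules are compatible only at t = 0.
      budaghyanHelleseth-planar : (∃ λ h → k ≡ 2 ℕ.* h) → Planar (budaghyanHelleseth b k)
      budaghyanHelleseth-planar (h , k≡2h) = planar f f-cong B polarisation
        (λ a x≈y → +-cong (Tr-cong (*-congˡ (polar-cong k x≈y refl))) (*-congˡ (polar-cong n x≈y refl)))
        B-+ (λ {x} {a} → B-kernel {x} {a})
        where
        B : Carrier → Carrier → Carrier
        B x y = Tr (b * polar k x y) + ξ * polar n x y
        polarisation : ∀ x y → f (x + y) ≈ f x + f y + B x y
        polarisation x y = begin
          f (x + y)
            ≈⟨ +-cong (trans (Tr-cong (trans (*-congˡ (norm-polar k x y)) (trans (distribˡ b _ _) (+-congʳ (distribˡ b _ _)))))
                        (trans (Tr-+ _ _) (+-congʳ (Tr-+ _ _)))) (*-congˡ (norm-polar n x y)) ⟩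
          T x + T y + Tr (b * polar k x y) + ξ * (x ^ (q ℕ.+ 1) + y ^ (q ℕ.+ 1) + polar n x y)
            ≈⟨ solve 7 (λ a b c ξ a′ b′ c′ → a :+ b :+ c :+ ξ :* (a′ :+ b′ :+ c′) := a :+ ξ :* a′ :+ (b :+ ξ :* b′) :+ (c :+ ξ :* c′))
                 refl (T x) (T y) (Tr (b * polar k x y)) ξ (x ^ (q ℕ.+ 1)) (y ^ (q ℕ.+ 1)) (polar n x y) ⟩
          f x + f y + B x y ∎
        B-+ : ∀ x y a → B (x + y) a ≈ B x a + B y a
        B-+ x y a = begin
          B (x + y) a
            ≈⟨ +-cong (trans (Tr-cong (trans (*-congˡ (polar-+ k x y a)) (distribˡ b _ _))) (Tr-+ _ _)) (*-congˡ (polar-+ n x y a)) ⟩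
          Tr (b * polar k x a) + Tr (b * polar k y a) + ξ * (polar n x a + polar n y a)
            ≈⟨ solve 5 (λ c d ξ c′ d′ → c :+ d :+ ξ :* (c′ :+ d′) := c :+ ξ :* c′ :+ (d :+ ξ :* d′)) refl
                 (Tr (b * polar k x a)) (Tr (b * polar k y a)) ξ (polar n x a) (polar n y a) ⟩
          B x a + B y a ∎

        -- t^(Pⁿ) is −t because n is odd and t because Pⁿ = qᵏ with k even.
        anti-fixed-twice : ∀ {t} → t ^ q ≈ - t → t ^ P ≈ - t → t ≈ 0#
        anti-fixed-twice {t} t^q≈-t t^P≈-t = x≈-x⇒x≈0 (begin
          t                        ≈⟨ t^q^2h≈t h ⟨
          t ^ (q ℕ.^ (2 ℕ.* h))    ≡⟨ ≡.cong (t ^_) exponent ⟩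
          t ^ (P ℕ.^ (1 ℕ.+ 2 ℕ.* proj₁ n-odd)) ≈⟨ anti-fixed-^odd P (frobenius-neg k t) t^P≈-t (proj₁ n-odd) ⟩
          - t                      ∎)
          where
          t^q^2h≈t : ∀ h → t ^ (q ℕ.^ (2 ℕ.* h)) ≈ t
          t^q^2h≈t zero    = *-identityʳ t
          t^q^2h≈t (suc h) = begin
            t ^ (q ℕ.^ (2 ℕ.* suc h))        ≡⟨ ≡.cong (λ e → t ^ (q ℕ.^ suc e)) (ℕ.+-suc h (h ℕ.+ 0)) ⟩
            t ^ (q ℕ.* q ℕ.^ (1 ℕ.+ 2 ℕ.* h)) ≈⟨ ^-assocʳ t q (q ℕ.^ (1 ℕ.+ 2 ℕ.* h)) ⟨
            (t ^ q) ^ (q ℕ.^ (1 ℕ.+ 2 ℕ.* h)) ≈⟨ ^-assocʳ (t ^ q) q (q ℕ.^ (2 ℕ.* h)) ⟨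
            ((t ^ q) ^ q) ^ (q ℕ.^ (2 ℕ.* h)) ≈⟨ ^-congˡ (q ℕ.^ (2 ℕ.* h)) (conj-conj t) ⟩
            t ^ (q ℕ.^ (2 ℕ.* h))            ≈⟨ t^q^2h≈t h ⟩
            t                                ∎
          exponent : q ℕ.^ (2 ℕ.* h) ≡ P ℕ.^ (1 ℕ.+ 2 ℕ.* proj₁ n-odd)
          exponent = ≡.trans (≡.cong (q ℕ.^_) (≡.sym k≡2h)) (≡.trans (ℕ.^-*-assoc p n k) (≡.trans (≡.cong (p ℕ.^_) (ℕ.*-comm n k))
            (≡.trans (≡.sym (ℕ.^-*-assoc p k n)) (≡.cong (P ℕ.^_) (proj₂ n-odd)))))

        B-kernel : ∀ {x a} → B x a ≈ 0# → x ≈ 0# ⊎ a ≈ 0#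
        B-kernel {x} {a} Bxa≈0 with a ≈? 0#
        ... | yes a≈0 = inj₂ a≈0
        ... | no  a≉0 = inj₁ (begin
          x       ≈⟨ at≈x ⟨
          a * t   ≈⟨ *-congˡ (anti-fixed-twice t^q≈-t t^P≈-t) ⟩
          a * 0#  ≈⟨ zeroʳ a ⟩
          0#      ∎)
          where
          t = inv a * x
          at≈x : a * t ≈ x
          at≈x = trans (sym (*-assoc a (inv a) x)) (trans (*-congʳ (inv-inverse a≉0)) (*-identityˡ x))
          polar-t : ∀ k → polar k x a ≈ a ^ (p ℕ.^ k ℕ.+ 1) * (t ^ (p ℕ.^ k) + t)
          polar-t k = begin
            polar k x a                               ≈⟨ polar-cong k at≈x (*-identityʳ a) ⟨
            polar k (a * t) (a * 1#)                  ≈⟨ polar-* k a t 1# ⟩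
            a ^ (p ℕ.^ k ℕ.+ 1) * polar k t 1#        ≈⟨ *-congˡ
                (+-cong (*-identityʳ _) (trans (*-congˡ (1^n≈1 (p ℕ.^ k))) (*-identityʳ t))) ⟩
            a ^ (p ℕ.^ k ℕ.+ 1) * (t ^ (p ℕ.^ k) + t) ∎
          B-⊕ : (x₀ (Tr (b * polar k x a)) ⊕ x₀ (polar n x a) ·ξ) ≈ (F.0# ⊕ F.0# ·ξ)
          B-⊕ = trans (sym (trace-norm-⊕ (Tr-fixed _) (polar-fixed x a))) (trans Bxa≈0 0-⊕)
          trace≈0 : Tr (b * polar k x a) ≈ 0#
          trace≈0 = trans (fixed⇒∈F (Tr-fixed _)) (trans (ι.⟦⟧-cong (1-coordinate-unique B-⊕)) ι.0#-homo)
          polar≈0 : polar n x a ≈ 0#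
          polar≈0 = trans (fixed⇒∈F (polar-fixed x a)) (trans (ι.⟦⟧-cong (ξ-coordinate-unique B-⊕)) ι.0#-homo)
          t^q≈-t : t ^ q ≈ - t
          t^q≈-t = +-inverseˡ-unique _ _ (xy≈0⇒y≈0 (^-≉0 (q ℕ.+ 1) a≉0) (trans (sym (polar-t n)) polar≈0))
          γ s : Carrier
          γ = b * a ^ (P ℕ.+ 1)
          s = t ^ P + t
          s^q≈-s : s ^ q ≈ - s
          s^q≈-s = begin
            (t ^ P + t) ^ q          ≈⟨ frobenius-+ n (t ^ P) t ⟩
            (t ^ P) ^ q + t ^ q      ≈⟨ +-cong (trans (^-assocʳ t P q)
                (trans (reflexive (≡.cong (t ^_) (ℕ.*-comm P q))) (sym (^-assocʳ t q P)))) t^q≈-t ⟩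
            (t ^ q) ^ P - t          ≈⟨ +-congʳ (trans (^-congˡ P t^q≈-t) (frobenius-neg k t)) ⟩
            - (t ^ P) - t            ≈⟨ -‿+-comm _ _ ⟩
            - (t ^ P + t)            ∎
          s[γ-γ^q]≈0 : s * (γ - γ ^ q) ≈ 0#
          s[γ-γ^q]≈0 = begin
            s * (γ - γ ^ q)          ≈⟨ solve 3 (λ s c c′ → s :* (c :- c′) := c :* s :+ c′ :* :- s) refl s γ (γ ^ q) ⟩
            γ * s + γ ^ q * - s      ≈⟨ +-congˡ (*-congˡ s^q≈-s) ⟨
            γ * s + γ ^ q * s ^ q    ≈⟨ +-congˡ (^-distrib-* γ s q) ⟨
            Tr (γ * s)               ≈⟨ Tr-cong (trans (*-congˡ (polar-t k)) (sym (*-assoc b _ _))) ⟨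
            Tr (b * polar k x a)     ≈⟨ trace≈0 ⟩
            0#                       ∎
          t^P≈-t : t ^ P ≈ - t
          t^P≈-t with s ≈? 0#
          ... | yes s≈0 = +-inverseˡ-unique _ _ s≈0
          ... | no  s≉0 = contradiction (fixed⇒square (sym (x-y≈0⇒x≈y (xy≈0⇒y≈0 s≉0 s[γ-γ^q]≈0)))) (c-nonsquare a≉0)

open import Data.Nat using (_<_; _^_; _%_)

theorem2p5 :
  ∀ {c₁ ℓ₁ c₂ ℓ₂} (F : CommutativeRing c₁ ℓ₁) (K : CommutativeRing c₂ ℓ₂)
  (p n : ℕ) → Prime p → p ≢ 2 → 0 < n →
  (E : QuadraticExtension F K (p ^ n)) →
  (ξ : CommutativeRing.Carrier K) →
  (ξ∉F : ∀ s → ¬ CommutativeRing._≈_ K (QuadraticExtension.ι E s) ξ) →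
  let open Plane K
      open Setting F K p n E ξ ξ∉F
      q = p ^ n
  in
  -- (a)
  (q % 4 ≡ 1 → ∀ α → Nonsquare F α → ∀ i → 0 < i → i < n →
    Planar (dickson α i) × IsUnital q (Π (dickson α i)) 𝒰)
  ×
  -- (b)
  (q % 4 ≡ 1 → ∀ α → Nonsquare F α → ∀ i k → 0 < i → i < n → 0 < k → k < n →
    OddCofactor k n →
    Planar (zhouPott α i k) × IsUnital q (Π (zhouPott α i k)) 𝒰)
  ×
  -- (c)
  (p ≡ 3 → ¬ 2 ∣ n →
    Planar cohenGanley × IsUnital q (Π cohenGanley) 𝒰)
  ×
  -- (d)
  (p ≡ 3 → n ≡ 5 →
    Planar penttilaWilliams × IsUnital q (Π penttilaWilliams) 𝒰)
  ×
  -- (e): the function is planar exactly for even k (for odd k, x = jy with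
  -- j² = -1 is in the kernel of its polarisation at y); the unital property
  -- holds for all k.
  (q % 4 ≡ 3 → ∀ k → 0 < k → k < n → OddCofactor k n →
    ∀ b → ¬ CommutativeRing._≈_ K b (CommutativeRing.0# K) → Nonsquare K b →
    (2 ∣ k → Planar (budaghyanHelleseth b k)) ×
    IsUnital q (Π (budaghyanHelleseth b k)) 𝒰)
theorem2p5 F K p n p-prime p≢2 _ E ξ ξ∉F =
  (λ q%4≡1 α α-nonsquare i _ _ → DZP.dickson-planar-unital (residue[4] q%4≡1) α-nonsquare i) ,
  (λ q%4≡1 α α-nonsquare i k _ _ _ _ odd-cof → DZP.zhouPott-planar-unital (residue[4] q%4≡1) α-nonsquare i k odd-cof) ,
  (λ { ≡.refl 2∤n → CohenGanleyPenttilaWilliams.cohenGanley-planar-unital F K n p-prime p≢2 E ξ ξ∉F (odd 2∤n) }) ,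
  -- The pair `(2 , n≡5)` proves `n` odd, as 5 = 1 + 2·2.
  (λ { ≡.refl n≡5 → CohenGanleyPenttilaWilliams.penttilaWilliams-planar-unital F K n p-prime p≢2 E ξ ξ∉F (2 , n≡5) n≡5 }) ,
  (λ q%4≡3 k _ _ _ _ _ b-nonsquare →
    (λ { (divides h k≡h*2) → BudaghyanHelleseth.budaghyanHelleseth-planar F K p n p-prime p≢2 E ξ ξ∉F (residue[4] q%4≡3)
                               k b-nonsquare (h , ≡.trans k≡h*2 (ℕ.*-comm h 2)) }) ,
    BudaghyanHelleseth.budaghyanHelleseth-unital F K p n p-prime p≢2 E ξ ξ∉F (residue[4] q%4≡3) k b-nonsquare)
  where
  module DZP = DicksonZhouPott F K p n p-prime p≢2 E ξ ξ∉F
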